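{- Let $(\mathcal N,\mathcal O,\mathfrak l)$ be a plabic network containing a square with vertices $A,B,C,D$ in clockwise order, with $A,C$ trivalent white and $B,D$ trivalent black, and edges $h_1:A\to B$ of weight $\alpha_1$, $h_2:A\to D$ of weight $\alpha_2$, $h_3:B\to C$ of weight $\alpha_3$, $h_4:C\to D$ of weight $\alpha_4$; the remaining edges at these vertices are $e_1$ incoming at $A$, $e_2$ incoming at $B$, $e_3$ outgoing at $D$, $e_4$ outgoing at $C$. Perform the square move: the colours of the four vertices are switched, $h_1$ and $h_4$ are reversed (becoming $-h_1:B\to A$ and $-h_4:D\to C$), $h_2,h_3$ and all other edges keep their direction, the weights of $h_1,h_2,h_3,h_4$ become $$\tilde\alpha_1=\frac{\alpha_3\alpha_4}{\tilde\alpha_2},\quad\tilde\alpha_2=\alpha_2+\alpha_1\alpha_3\alpha_4,\quad\tilde\alpha_3=\frac{\alpha_2\alpha_3}{\tilde\alpha_2},\quad\tilde\alpha_4=\frac{\alpha_1\alpha_3}{\tilde\alpha_2},$$ and all other weights and the boundary conditions are unchanged. Let $F_j$ be the edge vector at $h_j$ before the move and $\tilde F_j$ the edge vector at the corresponding edge ($-h_1,h_2,h_3,-h_4$ for $j=1,2,3,4$) after the move. Then $$\tilde F_4=\tilde\alpha_4\alpha_3^{ -1}(-1)^{\mathrm{int}(h_3)+\mathrm{int}(h_4)+\gamma_2(h_4)+\mathrm{wind}(h_3,h_4)+1}F_3+\tilde\alpha_4(-1)^{\mathrm{int}(h_4)+\gamma_2(h_4)}F_4,$$ $$\tilde F_2=\alpha_1(-1)^{\mathrm{int}(h_1)+\gamma_2(h_4)+\mathrm{wind}(h_2,-h_4)+\mathrm{wind}(h_3,h_4)+1}F_3+\alpha_2\alpha_4^{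 -1}(-1)^{1+\mathrm{int}(h_2)+\mathrm{int}(h_4)+\gamma_2(h_4)+\mathrm{wind}(h_2,-h_4)}F_4,$$ $$\tilde F_1=\tilde\alpha_1(-1)^{\mathrm{int}(h_1)+\mathrm{wind}(-h_1,h_2)}\tilde F_2,$$ $$\tilde F_3=(-1)^{\mathrm{int}(h_3)+\mathrm{int}(h_4)+\gamma_2(h_4)+\mathrm{wind}(h_3,h_4)+1}\alpha_2\alpha_1^{ -1}\tilde F_4.$$
   Context: Fix positive integers $k<n$. A plabic graph of type $(k,n)$ is a finite directed graph drawn planarly in a disk, with no component isolated from the boundary, such that: it has $n$ boundary vertices $b_1,\dots,b_n$ labelled clockwise, all on a common straight interval of the boundary of the disk, each of degree 1 (a boundary source if its edge is outgoing, a boundary sink if incoming; exactly $k$ are sources, indexed by $I=\{i_1<\dots<i_k\}$); all other (internal) vertices are strictly inside the disk and are bivalent or trivalent; each internal vertex either has exactly one incoming edge (white) or exactly one outgoing edge (black), bivalent vertices being assigned either colour. Edges are straight segments, regarded as vectors directed by the orientation $\mathcal O$. A plabic network is a plabic graph with positive edge weights $w_e$. The square is a face of the graph. A gauge ray direction $\mathfrak l$ is an oriented direction such that the ray in direction $\mathfrak l$ from any boundary vertex points inside the disk, no internal edge is parallel to $\mathfrak l$, and the rays starting at boundary vertices contain no internal vertices. The gauge rays are the rays $\mathfrak l_{i_r}$ starting at the boundary sources. For plane vectors $s(u,v)=+1,0,-1$ if $(u,v)$ is positively (counterclockwise) oriented, parallel, negatively oriented; $\gamma_2(e)=\frac{1-s(e,\mathfrak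 l)}2$. For consecutive directed edges, $\mathrm{wind}(e,f)=\pm1$ if $s(e,f)=s(e,\mathfrak l)=s(\mathfrak l,f)=\pm1$, and $0$ otherwise. $\mathrm{int}(e)$ is the number of intersections of $e$ with the gauge rays (the common starting point of $\mathfrak l_{i_r}$ and the edge at $b_{i_r}$ is not counted). System of edge vectors: given linearly independent vectors $B_j$ at the boundary sinks, the edge vectors are the unique solution of $E_{e_j}=(-1)^{\mathrm{int}(e_j)}w_{e_j}B_j$ at the edge $e_j$ ending at each boundary sink $b_j$; $E_e=(-1)^{\mathrm{int}(e)+\mathrm{wind}(e,f)}w_eE_f$ for each incoming edge $e$ at a bivalent or black vertex with outgoing edge $f$; $E_{e}=(-1)^{\mathrm{int}(e)+\mathrm{wind}(e,f)}w_{e}E_{f}+(-1)^{\mathrm{int}(e)+\mathrm{wind}(e,g)}w_{e}E_{g}$ at each trivalent white vertex with incoming edge $e$ and outgoing edges $f,g$. The edge vectors outside the square are the same before and after the move. -}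

module Defs where

open import Level using (_⊔_; suc; 0ℓ)
open import Algebra.Bundles using (CommutativeRing)
open import Algebra.Module.Bundles using (Module)
open import Data.Bool using (Bool; if_then_else_; _∧_; _∨_)
open import Data.Empty using (⊥-elim)
open import Data.Fin as Fin using (Fin)
import Data.Fin.Properties as Fin
open import Data.Integer as ℤ using (ℤ; +_; 0ℤ; 1ℤ; -1ℤ; ∣_∣)
import Data.Integer.DivMod as ℤ
open import Data.Nat as ℕ using (ℕ)
open import Data.Product using (_×_; _,_; proj₁; proj₂; ∃-syntax; Σ-syntax)
open import Data.Sum using (_⊎_; inj₁; inj₂)
import Data.Sum.Properties as Sum
import Data.Vec as Vec
open import Relation.Binary using (Rel; IsStrictTotalOrder; tri<; tri≈; tri>; DecidableEquality)
open import Relation.Binary.Construct.Closure.Equivalence using (EqClosure)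
open import Relation.Binary.PropositionalEquality using (_≡_; _≢_)
open import Relation.Nullary using (¬_; Dec; yes; no; does)
open import Relation.Nullary.Decidable using (_×-dec_; _⊎-dec_; map′)

-- ℝ is an instance classically: the order is total and decidable, and the
-- value of the inverse at 0 is unconstrained.
record OrderedField c ℓ₁ ℓ₂ : Set (suc (c ⊔ ℓ₁ ⊔ ℓ₂)) where
  infix 4 _<_ _≤_
  infix 9 _⁻¹
  field
    commutativeRing : CommutativeRing c ℓ₁
  open CommutativeRing commutativeRing public
  field
    _<_                : Rel Carrier ℓ₂
    isStrictTotalOrder : IsStrictTotalOrder _≈_ _<_
    +-monoˡ-<          : ∀ {x y} z → x < y → x + z < y + z
    *-pos              : ∀ {x y} → 0# < x → 0# < y → 0# < x * y
    0<1                : 0# < 1#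
    _⁻¹                : Carrier → Carrier
    ⁻¹-cong            : ∀ {x y} → x ≈ y → x ⁻¹ ≈ y ⁻¹
    *-inverseʳ         : ∀ {x} → ¬ x ≈ 0# → x * x ⁻¹ ≈ 1#

  open IsStrictTotalOrder isStrictTotalOrder public
    using (compare; _≟_; _<?_; <-resp-≈)
    renaming (trans to <-trans; irrefl to <-irrefl; asym to <-asym)

  _≤_ : Rel Carrier (ℓ₁ ⊔ ℓ₂)
  x ≤ y = x < y ⊎ x ≈ y

  _≤?_ : ∀ x y → Dec (x ≤ y)
  x ≤? y = (x <? y) ⊎-dec (x ≟ y)

  sign : Carrier → ℤ
  sign x with compare x 0#
  ... | tri< _ _ _ = -1ℤ
  ... | tri≈ _ _ _ = 0ℤ
  ... | tri> _ _ _ = 1ℤ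

  open import Algebra.Properties.Semiring.Exp semiring public using (_^_)

  -- Only the parity of the exponent matters, hence the absolute value.
  infix 9 [-1]^_
  [-1]^_ : ℤ → Carrier
  [-1]^ z = (- 1#) ^ ∣ z ∣

module Plane {c ℓ₁ ℓ₂} (K : OrderedField c ℓ₁ ℓ₂) where
  open OrderedField K

  Pt : Set c
  Pt = Carrier × Carrier

  infix 4 _≈ₚ_
  infixl 6 _+ₚ_ _-ₚ_
  infixr 7 _·_
  infix 8 -ₚ_

  _≈ₚ_ : Rel Pt ℓ₁
  (x , y) ≈ₚ (x′ , y′) = x ≈ x′ × y ≈ y′

  0ₚ : Pt
  0ₚ = 0# , 0#

  _+ₚ_ _-ₚ_ : Pt → Pt → Pt
  (x , y) +ₚ (x′ , y′) = x + x′ , y + y′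
  (x , y) -ₚ (x′ , y′) = x - x′ , y - y′

  -ₚ_ : Pt → Pt
  -ₚ (x , y) = - x , - y

  _·_ : Carrier → Pt → Pt
  a · (x , y) = a * x , a * y

  cross : Pt → Pt → Carrier
  cross (x , y) (x′ , y′) = x * y′ - y * x′

  Direction : Set (c ⊔ ℓ₁)
  Direction = Σ[ v ∈ Pt ] ¬ v ≈ₚ 0ₚ

  OnSegment : Pt → Pt → Pt → Set (c ⊔ ℓ₁ ⊔ ℓ₂)
  OnSegment p q x = ∃[ s ] (0# ≤ s × s ≤ 1# × x ≈ₚ p +ₚ s · (q -ₚ p))

  -- The starting point is left out.
  OnRay : Pt → Direction → Pt → Set (c ⊔ ℓ₁ ⊔ ℓ₂)
  OnRay b (l , _) x = ∃[ t ] (0# < t × x ≈ₚ b +ₚ t · l)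

  RayMeetsSegment : Pt → Direction → Pt → Pt → Set (c ⊔ ℓ₁ ⊔ ℓ₂)
  RayMeetsSegment b l p q = ∃[ x ] (OnRay b l x × OnSegment p q x)

  s⟨_,_⟩ : Pt → Pt → ℤ
  s⟨ u , v ⟩ = sign (cross u v)

  -- The value at s(e,l) = 0, where the quotient is not an integer, is
  -- irrelevant: γ₂ is only used for edges not parallel to the gauge direction.
  γ₂ : Direction → Pt → ℤ
  γ₂ (l , _) e = (1ℤ ℤ.- s⟨ e , l ⟩) ℤ./ (+ 2)

  wind : Direction → Pt → Pt → ℤ
  wind (l , _) e f =
    if does (s⟨ e , f ⟩ ℤ.≟ s⟨ e , l ⟩) ∧ does (s⟨ e , l ⟩ ℤ.≟ s⟨ l , f ⟩)
    then s⟨ e , f ⟩ else 0ℤ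

  RightOf : Pt → Pt → Pt → Set ℓ₂
  RightOf p q x = cross (q -ₚ p) (x -ₚ p) < 0#

  RightOfOrOn : Pt → Pt → Pt → Set (ℓ₁ ⊔ ℓ₂)
  RightOfOrOn p q x = cross (q -ₚ p) (x -ₚ p) ≤ 0#

  -- Negative (doubled) signed area; the shoelace sum of a quadrilateral is the
  -- cross product of its diagonals.
  ClockwiseQuad : Pt → Pt → Pt → Pt → Set ℓ₂
  ClockwiseQuad a b c d = cross (c -ₚ a) (d -ₚ b) < 0#

  -- Interior of a simple clockwise, possibly non-convex, quadrilateral: such a
  -- quadrilateral has at least one interior diagonal, and it is cut along it
  -- into two clockwise triangles.  The open diagonal is interior, the sides
  -- are not.
  InteriorCutAlong₁₃ : Pt → Pt → Pt → Pt → Pt → Set (ℓ₁ ⊔ ℓ₂)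
  InteriorCutAlong₁₃ a b c d x =
    RightOf a b c × RightOf c d a ×
    ( (RightOf a b x × RightOf b c x × RightOfOrOn c a x)
    ⊎ (RightOf c d x × RightOf d a x × RightOfOrOn a c x))

  InteriorOfQuad : Pt → Pt → Pt → Pt → Pt → Set (ℓ₁ ⊔ ℓ₂)
  InteriorOfQuad a b c d x =
    InteriorCutAlong₁₃ a b c d x ⊎ InteriorCutAlong₁₃ b c d a x

module RayMeetsSegmentDecidable {c ℓ₁ ℓ₂} (K : OrderedField c ℓ₁ ℓ₂) where
  open OrderedField K
  open Plane K
  open import Algebra.Properties.Ring ring
    using (x[y-z]≈xy-xz)
  open import Algebra.Properties.Group +-group
    using (//-rightDividesˡ; x∙y⁻¹≈ε⇒x≈y; ∙-cancelˡ)
  open import Algebra.Properties.AbelianGroup +-abelianGroup using (⁻¹-∙-comm)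
  open import Algebra.Properties.CommutativeSemigroup *-commutativeSemigroup
    using (x∙yz≈y∙xz; x∙yz≈xz∙y)
  open import Algebra.Properties.CommutativeSemigroup +-commutativeSemigroup
    using () renaming (interchange to +-interchange)
  open import Relation.Binary.Reasoning.Setoid setoid

  private
    x+[y-x]≈y : ∀ x y → x + (y - x) ≈ y
    x+[y-x]≈y x y = trans (+-comm x (y - x)) (//-rightDividesˡ x y)

    [x+y]-x≈y : ∀ x y → (x + y) - x ≈ y
    [x+y]-x≈y x y = begin
      (x + y) - x   ≈⟨ +-congʳ (+-comm x y) ⟩
      (y + x) - x   ≈⟨ +-assoc y x (- x) ⟩
      y + (x - x)   ≈⟨ +-congˡ (-‿inverseʳ x) ⟩
      y + 0#        ≈⟨ +-identityʳ y ⟩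
      y             ∎

    x≈y+z⇒x-y≈z : ∀ {x y z} → x ≈ y + z → x - y ≈ z
    x≈y+z⇒x-y≈z {x} {y} {z} e = trans (+-congʳ e) ([x+y]-x≈y y z)

    -‿interchange : ∀ w x y z → (w + x) - (y + z) ≈ (w - y) + (x - z)
    -‿interchange w x y z = begin
      (w + x) - (y + z)       ≈⟨ +-congˡ (sym (⁻¹-∙-comm y z)) ⟩
      (w + x) + (- y + - z)   ≈⟨ +-interchange w x (- y) (- z) ⟩
      (w - y) + (x - z)       ∎

    ≤-cases : ∀ x y → x ≤ y ⊎ y < x
    ≤-cases x y with compare x y
    ... | tri< p _ _ = inj₁ (inj₁ p)
    ... | tri≈ _ p _ = inj₁ (inj₂ p)
    ... | tri> _ _ p = inj₂ p

    ≮⇒≥ : ∀ {x y} → ¬ x < y → y ≤ x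
    ≮⇒≥ {x} {y} n with ≤-cases y x
    ... | inj₁ p = p
    ... | inj₂ p = ⊥-elim (n p)

    <-respʳ : ∀ {x y z} → y ≈ z → x < y → x < z
    <-respʳ = proj₁ <-resp-≈

    <-respˡ : ∀ {x y z} → y ≈ z → y < x → z < x
    <-respˡ = proj₂ <-resp-≈

    ≤-respʳ : ∀ {x y z} → y ≈ z → x ≤ y → x ≤ z
    ≤-respʳ e (inj₁ p) = inj₁ (<-respʳ e p)
    ≤-respʳ e (inj₂ p) = inj₂ (trans p e)

    ≤-respˡ : ∀ {x y z} → y ≈ z → y ≤ x → z ≤ x
    ≤-respˡ e (inj₁ p) = inj₁ (<-respˡ e p)
    ≤-respˡ e (inj₂ p) = inj₂ (trans (sym e) p)

    <-≤-trans : ∀ {x y z} → x < y → y ≤ z → x < z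
    <-≤-trans p (inj₁ q) = <-trans p q
    <-≤-trans p (inj₂ q) = <-respʳ q p

    ≤-trans : ∀ {x y z} → x ≤ y → y ≤ z → x ≤ z
    ≤-trans (inj₁ p) q = inj₁ (<-≤-trans p q)
    ≤-trans (inj₂ p) q = ≤-respˡ (sym p) q

    +-monoˡ-≤ : ∀ {x y} z → x ≤ y → x + z ≤ y + z
    +-monoˡ-≤ z (inj₁ p) = inj₁ (+-monoˡ-< z p)
    +-monoˡ-≤ z (inj₂ p) = inj₂ (+-congʳ p)

    +-monoʳ-≤ : ∀ {x y} z → x ≤ y → z + x ≤ z + y
    +-monoʳ-≤ z p = ≤-respˡ (+-comm _ z) (≤-respʳ (+-comm _ z) (+-monoˡ-≤ z p))

    x≤y⇒0≤y-x : ∀ {x y} → x ≤ y → 0# ≤ y - x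
    x≤y⇒0≤y-x {x} p = ≤-respˡ (-‿inverseʳ x) (+-monoˡ-≤ (- x) p)

    0≤y-x⇒x≤y : ∀ {x y} → 0# ≤ y - x → x ≤ y
    0≤y-x⇒x≤y {x} {y} p =
      ≤-respˡ (+-identityˡ x) (≤-respʳ (//-rightDividesˡ x y) (+-monoˡ-≤ x p))

    *-nonneg : ∀ {x y} → 0# ≤ x → 0# ≤ y → 0# ≤ x * y
    *-nonneg (inj₁ p) (inj₁ q) = inj₁ (*-pos p q)
    *-nonneg {x} (inj₁ p) (inj₂ q) = inj₂ (sym (trans (*-congˡ (sym q)) (zeroʳ x)))
    *-nonneg {x} {y} (inj₂ p) q = inj₂ (sym (trans (*-congʳ (sym p)) (zeroˡ y)))

    *-monoʳ-≤ : ∀ {x y z} → 0# ≤ z → x ≤ y → z * x ≤ z * y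
    *-monoʳ-≤ {x} {y} {z} p q =
      0≤y-x⇒x≤y (≤-respʳ (x[y-z]≈xy-xz z y x) (*-nonneg p (x≤y⇒0≤y-x q)))

    between-≤0 : ∀ {s a a′} → 0# ≤ s → s ≤ 1# → a ≤ 0# → a′ ≤ 0# → a + s * (a′ - a) ≤ 0#
    between-≤0 {s} {a} {a′} 0≤s s≤1 a≤0 a′≤0 with ≤-cases a a′
    ... | inj₁ a≤a′ = ≤-trans (+-monoʳ-≤ a (≤-respʳ (trans (*-comm _ 1#) (*-identityˡ _))
            (≤-respˡ (*-comm _ s) (*-monoʳ-≤ (x≤y⇒0≤y-x a≤a′) s≤1))))
            (≤-respˡ (sym (x+[y-x]≈y a a′)) a′≤0)
    ... | inj₂ a′<a = ≤-trans (+-monoʳ-≤ a (*-monoʳ-≤ 0≤s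
            (≤-respʳ (-‿inverseʳ a) (+-monoˡ-≤ (- a) (inj₁ a′<a)))))
            (≤-respˡ (sym (trans (+-congˡ (zeroʳ s)) (+-identityʳ a))) a≤0)

    *-cancelʳ-⁻¹ : ∀ {x y z} → ¬ z ≈ 0# → x * z ≈ y → x ≈ y * z ⁻¹
    *-cancelʳ-⁻¹ {x} {y} {z} z≉0 e = begin
      x               ≈⟨ sym (*-identityʳ x) ⟩
      x * 1#          ≈⟨ *-congˡ (sym (*-inverseʳ z≉0)) ⟩
      x * (z * z ⁻¹)  ≈⟨ sym (*-assoc x z (z ⁻¹)) ⟩
      x * z * z ⁻¹    ≈⟨ *-congʳ e ⟩
      y * z ⁻¹        ∎

    [yz⁻¹]z≈y : ∀ {z} y → ¬ z ≈ 0# → y * z ⁻¹ * z ≈ y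
    [yz⁻¹]z≈y {z} y z≉0 = begin
      y * z ⁻¹ * z    ≈⟨ *-assoc y (z ⁻¹) z ⟩
      y * (z ⁻¹ * z)  ≈⟨ *-congˡ (trans (*-comm (z ⁻¹) z) (*-inverseʳ z≉0)) ⟩
      y * 1#          ≈⟨ *-identityʳ y ⟩
      y               ∎

    cross-cong : ∀ {l u v} → u ≈ₚ v → cross l u ≈ cross l v
    cross-cong (e , e′) = +-cong (*-congˡ e′) (-‿cong (*-congˡ e))

    cross-+ : ∀ l u v → cross l (u +ₚ v) ≈ cross l u + cross l v
    cross-+ (l , l′) (u , u′) (v , v′) =
      trans (+-cong (distribˡ l u′ v′) (-‿cong (distribˡ l′ u v)))
            (-‿interchange (l * u′) (l * v′) (l′ * u) (l′ * v))

    cross-· : ∀ l a v → cross l (a · v) ≈ a * cross l v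
    cross-· (l , l′) a (v , v′) =
      trans (+-cong (x∙yz≈y∙xz l a v′) (-‿cong (x∙yz≈y∙xz l′ a v)))
            (sym (x[y-z]≈xy-xz a (l * v′) (l′ * v)))

    cross-self : ∀ l → cross l l ≈ 0#
    cross-self (l , l′) = trans (+-congˡ (-‿cong (*-comm l′ l))) (-‿inverseʳ (l * l′))

    -- A linear functional which is 1 at the vector l.
    record Coordinate (l : Pt) : Set (c ⊔ ℓ₁) where
      field
        ρ        : Pt → Carrier
        ρ-cong   : ∀ {u v} → u ≈ₚ v → ρ u ≈ ρ v
        ρ-+      : ∀ u v → ρ (u +ₚ v) ≈ ρ u + ρ v
        ρ-·      : ∀ a v → ρ (a · v) ≈ a * ρ v
        ρ-l      : ρ l ≈ 1#
        ρ-recover : ∀ v → cross l v ≈ 0# → v ≈ₚ ρ v · l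

    coordinate : ((l , _) : Direction) → Coordinate l
    coordinate ((l , l′) , l≉0) with l ≟ 0# | l′ ≟ 0#
    ... | yes p | yes q = ⊥-elim (l≉0 (p , q))
    ... | no p | _ = record
      { ρ         = λ (v , _) → v * l ⁻¹
      ; ρ-cong    = λ (e , _) → *-congʳ e
      ; ρ-+       = λ _ _ → distribʳ _ _ _
      ; ρ-·       = λ _ _ → *-assoc _ _ _
      ; ρ-l       = *-inverseʳ p
      ; ρ-recover = λ (v , v′) e → sym ([yz⁻¹]z≈y v p) ,
          trans (*-cancelʳ-⁻¹ p (trans (*-comm v′ l) (trans (x∙y⁻¹≈ε⇒x≈y _ _ e) (*-comm l′ v))))
                (trans (*-assoc v l′ (l ⁻¹)) (x∙yz≈xz∙y v l′ (l ⁻¹)))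
      }
    ... | yes _ | no p = record
      { ρ         = λ (_ , v′) → v′ * l′ ⁻¹
      ; ρ-cong    = λ (_ , e) → *-congʳ e
      ; ρ-+       = λ _ _ → distribʳ _ _ _
      ; ρ-·       = λ _ _ → *-assoc _ _ _
      ; ρ-l       = *-inverseʳ p
      ; ρ-recover = λ (v , v′) e →
          trans (*-cancelʳ-⁻¹ p (trans (*-comm v l′) (trans (sym (x∙y⁻¹≈ε⇒x≈y _ _ e)) (*-comm l v′))))
                (trans (*-assoc v′ l (l′ ⁻¹)) (x∙yz≈xz∙y v′ l (l′ ⁻¹))) ,
          sym ([yz⁻¹]z≈y v′ p)
      }

    ≈ₚ-trans : ∀ {u v w} → u ≈ₚ v → v ≈ₚ w → u ≈ₚ w
    ≈ₚ-trans (e , e′) (d , d′) = trans e d , trans e′ d′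

    ≈ₚ-sym : ∀ {u v} → u ≈ₚ v → v ≈ₚ u
    ≈ₚ-sym (e , e′) = sym e , sym e′

    _≟ₚ_ : ∀ u v → Dec (u ≈ₚ v)
    (u , u′) ≟ₚ (v , v′) = (u ≟ v) ×-dec (u′ ≟ v′)

    recover : ∀ b {x v} → x -ₚ b ≈ₚ v → x ≈ₚ b +ₚ v
    recover _ (e , e′) = trans (sym (x+[y-x]≈y _ _)) (+-congˡ e) ,
                         trans (sym (x+[y-x]≈y _ _)) (+-congˡ e′)

    displacement : ∀ b {x v} → x ≈ₚ b +ₚ v → x -ₚ b ≈ₚ v
    displacement _ (e , e′) = x≈y+z⇒x-y≈z e , x≈y+z⇒x-y≈z e′

    OnRay-resp : ∀ {b l x y} → x ≈ₚ y → OnRay b l x → OnRay b l y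
    OnRay-resp e (t , 0<t , e′) = t , 0<t , ≈ₚ-trans (≈ₚ-sym e) e′

  module _ (b : Pt) (L : Direction) where
    private
      l = proj₁ L
      open Coordinate (coordinate L)

      height : Pt → Carrier
      height x = cross l (x -ₚ b)

      r : Pt → Carrier
      r x = ρ (x -ₚ b)

      height-ray : ∀ {x} → OnRay b L x → height x ≈ 0#
      height-ray {x} (t , _ , e) = begin
        height x        ≈⟨ cross-cong (displacement b e) ⟩
        cross l (t · l) ≈⟨ cross-· l t l ⟩
        t * cross l l   ≈⟨ *-congˡ (cross-self l) ⟩
        t * 0#          ≈⟨ zeroʳ t ⟩
        0#              ∎

      0<r-ray : ∀ {x} → OnRay b L x → 0# < r x
      0<r-ray {x} (t , 0<t , e) = <-respʳ (sym (begin
        r x        ≈⟨ ρ-cong (displacement b e) ⟩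
        ρ (t · l)  ≈⟨ ρ-· t l ⟩
        t * ρ l    ≈⟨ *-congˡ ρ-l ⟩
        t * 1#     ≈⟨ *-identityʳ t ⟩
        t          ∎)) 0<t

      on-ray : ∀ {x} → height x ≈ 0# → 0# < r x → OnRay b L x
      on-ray {x} e 0<r = r x , 0<r , recover b (ρ-recover (x -ₚ b) e)

    onRay? : ∀ x → Dec (OnRay b L x)
    onRay? x = map′ (λ (e , 0<r) → on-ray e 0<r) (λ o → height-ray o , 0<r-ray o)
                    ((height x ≟ 0#) ×-dec (0# <? r x))

    module _ (p q : Pt) where
      private
        d = q -ₚ p

        x-b : ∀ {x s} → x ≈ₚ p +ₚ s · d → x -ₚ b ≈ₚ (p -ₚ b) +ₚ s · d
        x-b {x} {s} (e , e′) = go e , go e′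
          where
          go : ∀ {x p b y} → x ≈ p + y → x - b ≈ (p - b) + y
          go {x} {p} {b} {y} e = begin
            x - b         ≈⟨ +-congʳ e ⟩
            (p + y) - b   ≈⟨ +-assoc p y (- b) ⟩
            p + (y - b)   ≈⟨ +-congˡ (+-comm y (- b)) ⟩
            p + (- b + y) ≈⟨ sym (+-assoc p (- b) y) ⟩
            (p - b) + y   ∎

        height-affine : ∀ {x s} → x ≈ₚ p +ₚ s · d → height x ≈ height p + s * cross l d
        height-affine {x} {s} e = begin
          height x                                 ≈⟨ cross-cong (x-b {x} {s} e) ⟩
          cross l ((p -ₚ b) +ₚ s · d)              ≈⟨ cross-+ l (p -ₚ b) (s · d) ⟩
          height p + cross l (s · d)               ≈⟨ +-congˡ (cross-· l s d) ⟩
          height p + s * cross l d                 ∎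

        r-affine : ∀ {x s} → x ≈ₚ p +ₚ s · d → r x ≈ r p + s * ρ d
        r-affine {x} {s} e = begin
          r x                     ≈⟨ ρ-cong (x-b {x} {s} e) ⟩
          ρ ((p -ₚ b) +ₚ s · d)   ≈⟨ ρ-+ (p -ₚ b) (s · d) ⟩
          r p + ρ (s · d)         ≈⟨ +-congˡ (ρ-· s d) ⟩
          r p + s * ρ d           ∎

        end : ∀ s → s ≈ 1# → q ≈ₚ p +ₚ s · d
        end s e = go , go
          where
          go : ∀ {p q} → q ≈ p + s * (q - p)
          go {p} {q} = sym (trans (+-congˡ (trans (*-congʳ e) (*-identityˡ (q - p)))) (x+[y-x]≈y p q))

        origin : p ≈ₚ p +ₚ 0# · d
        origin = go , go
          where
          go : ∀ {p y} → p ≈ p + 0# * y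
          go {p} {y} = sym (trans (+-congˡ (zeroˡ y)) (+-identityʳ p))

        r-q : r q ≈ r p + ρ d
        r-q = trans (r-affine {q} {1#} (end 1# refl)) (+-congˡ (*-identityˡ (ρ d)))

      rayMeetsSegment? : Dec (RayMeetsSegment b L p q)
      rayMeetsSegment? with cross l d ≟ 0#
      ... | no d≉0 = map′ to from ((0# ≤? s₀) ×-dec (s₀ ≤? 1#) ×-dec onRay? x₀)
        where
        s₀ = - height p * cross l d ⁻¹
        x₀ = p +ₚ s₀ · d

        to : (0# ≤ s₀) × (s₀ ≤ 1#) × OnRay b L x₀ → RayMeetsSegment b L p q
        to (0≤s , s≤1 , o) = x₀ , o , s₀ , 0≤s , s≤1 , refl , refl

        from : RayMeetsSegment b L p q → (0# ≤ s₀) × (s₀ ≤ 1#) × OnRay b L x₀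
        from (x , o , s , 0≤s , s≤1 , e) =
          ≤-respʳ s≈s₀ 0≤s , ≤-respˡ s≈s₀ s≤1 ,
          OnRay-resp {b} {L} (≈ₚ-trans e (+-congˡ (*-congʳ s≈s₀) , +-congˡ (*-congʳ s≈s₀))) o
          where
          s≈s₀ : s ≈ s₀
          s≈s₀ = *-cancelʳ-⁻¹ d≉0 (∙-cancelˡ (height p) _ _ (begin
            height p + s * cross l d  ≈⟨ sym (height-affine {x} {s} e) ⟩
            height x                  ≈⟨ height-ray o ⟩
            0#                        ≈⟨ sym (-‿inverseʳ (height p)) ⟩
            height p - height p       ∎))
      ... | yes d≈0 = map′ to from (onRay? p ⊎-dec onRay? q)
        where
        to : OnRay b L p ⊎ OnRay b L q → RayMeetsSegment b L p q
        to (inj₁ o) = p , o , 0# , inj₂ refl , inj₁ 0<1 , origin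
        to (inj₂ o) = q , o , 1# , inj₁ 0<1 , inj₂ refl , end 1# refl

        level : ∀ {x s} → x ≈ₚ p +ₚ s · d → height x ≈ height p
        level {x} {s} e = begin
          height x                  ≈⟨ height-affine {x} {s} e ⟩
          height p + s * cross l d  ≈⟨ +-congˡ (trans (*-congˡ d≈0) (zeroʳ s)) ⟩
          height p + 0#             ≈⟨ +-identityʳ (height p) ⟩
          height p                  ∎

        from : RayMeetsSegment b L p q → OnRay b L p ⊎ OnRay b L q
        from (x , o , s , 0≤s , s≤1 , e) with 0# <? r p | 0# <? r q
        ... | yes 0<rp | _ = inj₁ (on-ray (trans (sym (level {x} {s} e)) (height-ray o)) 0<rp)
        ... | _ | yes 0<rq = inj₂ (on-ray (trans (level {q} {1#} (end 1# refl))
                                     (trans (sym (level {x} {s} e)) (height-ray o))) 0<rq)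
        ... | no ≮p | no ≮q = ⊥-elim (<-irrefl refl (<-≤-trans (0<r-ray o)
                (≤-respˡ (sym (trans (r-affine {x} {s} e)
                    (+-congˡ (*-congˡ (sym (x≈y+z⇒x-y≈z r-q))))))
                  (between-≤0 0≤s s≤1 (≮⇒≥ ≮p) (≮⇒≥ ≮q)))))

data Colour : Set where
  white black : Colour

opposite : Colour → Colour
opposite white = black
opposite black = white

pattern boundary i = inj₁ i
pattern internal v = inj₂ v

module Plabic {c ℓ₁ ℓ₂} (K : OrderedField c ℓ₁ ℓ₂) where
  open OrderedField K
  open Plane K
  open RayMeetsSegmentDecidable K using (rayMeetsSegment?)

  -- The disk is the side of the oriented line through `origin` along `tangent`
  -- lying to the right of `tangent`, so that the boundary is run through
  -- clockwise in the direction of `tangent`.  The boundary vertex bᵢ is the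
  -- point of this line at abscissa i.  (A convex disk with a straight interval
  -- in its boundary lies on one side of that interval, and finitely many points
  -- of an open half-plane always lie in such a disk.)
  record Network (n : ℕ) : Set c where
    field
      origin tangent : Pt
      abscissa       : Fin n → Carrier
      #internal      : ℕ
      location       : Fin #internal → Pt
      colour         : Fin #internal → Colour
      #edges         : ℕ

    Vertex : Set
    Vertex = Fin n ⊎ Fin #internal

    Edge : Set
    Edge = Fin #edges

    field
      source target : Edge → Vertex
      weight        : Edge → Carrier

    InsideDisk : Pt → Set ℓ₂
    InsideDisk = RightOf origin (origin +ₚ tangent)

    pos : Vertex → Pt
    pos (boundary i) = origin +ₚ abscissa i · tangent
    pos (internal v) = location v

    vec : Edge → Pt
    vec e = pos (target e) -ₚ pos (source e)

    OnEdge : Edge → Pt → Set (c ⊔ ℓ₁ ⊔ ℓ₂)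
    OnEdge e = OnSegment (pos (source e)) (pos (target e))

    _≟ᵛ_ : DecidableEquality Vertex
    _≟ᵛ_ = Sum.≡-dec Fin._≟_ Fin._≟_

    indegree outdegree degree : Vertex → ℕ
    indegree  v = Vec.count (λ e → target e ≟ᵛ v) (Vec.allFin #edges)
    outdegree v = Vec.count (λ e → source e ≟ᵛ v) (Vec.allFin #edges)
    degree    v = indegree v ℕ.+ outdegree v

    IsEndpoint : Vertex → Edge → Set
    IsEndpoint v e = source e ≡ v ⊎ target e ≡ v

    Adjacent : Rel Vertex 0ℓ
    Adjacent u v = ∃[ e ] (source e ≡ u × target e ≡ v)

    IsSource IsSink : Fin n → Set
    IsSource i = ∃[ e ] source e ≡ boundary i
    IsSink   i = ∃[ e ] target e ≡ boundary i

    isSource? : ∀ i → Dec (IsSource i)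
    isSource? i = Fin.any? (λ e → source e ≟ᵛ boundary i)

    -- An edge not parallel to the gauge direction meets a gauge ray at most
    -- once, so intersection points are counted by counting rays.
    int : Direction → Edge → ℤ
    int l e = + Vec.count
      (λ i → isSource? i ×-dec
             rayMeetsSegment? (pos (boundary i)) l (pos (source e)) (pos (target e)))
      (Vec.allFin n)

  record IsPlabicNetwork {n} (k : ℕ) (N : Network n) : Set (c ⊔ ℓ₁ ⊔ ℓ₂) where
    open Network N
    field
      clockwise-labels : ∀ {i j} → i Fin.< j → abscissa i < abscissa j
      internal-inside  : ∀ v → InsideDisk (location v)
      pos-injective    : ∀ {u v} → pos u ≈ₚ pos v → u ≡ v
      no-loops         : ∀ e → source e ≢ target e
      -- as every vertex has an edge, this also keeps vertices off other edges
      planar           : ∀ {e f x} → e ≢ f → OnEdge e x → OnEdge f x →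
                         ∃[ v ] (IsEndpoint v e × IsEndpoint v f × x ≈ₚ pos v)
      no-isolated      : ∀ v → ∃[ i ] EqClosure Adjacent v (boundary i)
      boundary-degree  : ∀ i → degree (boundary i) ≡ 1
      internal-degree  : ∀ v → degree (internal v) ≡ 2 ⊎ degree (internal v) ≡ 3
      white-indegree   : ∀ v → colour v ≡ white → indegree (internal v) ≡ 1
      black-outdegree  : ∀ v → colour v ≡ black → outdegree (internal v) ≡ 1
      k-sources        : Vec.count isSource? (Vec.allFin n) ≡ k
      weight-positive  : ∀ e → 0# < weight e

  record IsGauge {n} (N : Network n) (l : Direction) : Set (c ⊔ ℓ₁ ⊔ ℓ₂) where
    open Network N
    field
      rays-inside  : ∀ i {x} → OnRay (pos (boundary i)) l x → InsideDisk x
      not-parallel : ∀ e {u v} → source e ≡ internal u → target e ≡ internal v →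
                     ¬ cross (vec e) (proj₁ l) ≈ 0#
      rays-avoid   : ∀ i v → ¬ OnRay (pos (boundary i)) l (location v)

  record Square {n} (N : Network n) : Set (c ⊔ ℓ₁ ⊔ ℓ₂) where
    open Network N
    field
      A B C D : Fin #internal
      h₁ h₂ h₃ h₄ e₁ e₂ e₃ e₄ : Edge

      A-white : colour A ≡ white
      B-black : colour B ≡ black
      C-white : colour C ≡ white
      D-black : colour D ≡ black

      A-trivalent : degree (internal A) ≡ 3
      B-trivalent : degree (internal B) ≡ 3
      C-trivalent : degree (internal C) ≡ 3
      D-trivalent : degree (internal D) ≡ 3

      h₁-source : source h₁ ≡ internal A
      h₁-target : target h₁ ≡ internal B
      h₂-source : source h₂ ≡ internal A
      h₂-target : target h₂ ≡ internal D
      h₃-source : source h₃ ≡ internal B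
      h₃-target : target h₃ ≡ internal C
      h₄-source : source h₄ ≡ internal C
      h₄-target : target h₄ ≡ internal D

      e₁-target : target e₁ ≡ internal A
      e₂-target : target e₂ ≡ internal B
      e₃-source : source e₃ ≡ internal D
      e₄-source : source e₄ ≡ internal C
      -- the other edges among the hᵢ, eᵢ at a common vertex differ by their
      -- endpoints
      e₂≢h₁     : e₂ ≢ h₁
      e₄≢h₄     : e₄ ≢ h₄

      clockwise : ClockwiseQuad (location A) (location B) (location C) (location D)
      face      : ∀ e {x} → OnEdge e x →
                  ¬ InteriorOfQuad (location A) (location B) (location C) (location D) x

    α₁ α₂ α₃ α₄ : Carrier
    α₁ = weight h₁
    α₂ = weight h₂
    α₃ = weight h₃
    α₄ = weight h₄

    α̃₁ α̃₂ α̃₃ α̃₄ : Carrier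
    α̃₂ = α₂ + α₁ * α₃ * α₄
    α̃₁ = α₃ * α₄ * α̃₂ ⁻¹
    α̃₃ = α₂ * α₃ * α̃₂ ⁻¹
    α̃₄ = α₁ * α₃ * α̃₂ ⁻¹

    OutsideSquare : Edge → Set
    OutsideSquare e = e ≢ h₁ × e ≢ h₂ × e ≢ h₃ × e ≢ h₄

    private
      _==_ : ∀ {k} → Fin k → Fin k → Bool
      i == j = does (i Fin.≟ j)

    -- Edges keep their names; h₁ and h₄ now stand for -h₁ and -h₄.
    squareMove : Network n
    squareMove = record N
      { colour = λ v → if (v == A) ∨ (v == B) ∨ (v == C) ∨ (v == D)
                       then opposite (colour v) else colour v
      ; source = λ e → if (e == h₁) ∨ (e == h₄) then target e else source e
      ; target = λ e → if (e == h₁) ∨ (e == h₄) then source e else target e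
      ; weight = λ e → if e == h₁ then α̃₁ else
                       if e == h₂ then α̃₂ else
                       if e == h₃ then α̃₃ else
                       if e == h₄ then α̃₄ else weight e
      }

  module EdgeVectors {m ℓm} (V : Module commutativeRing m ℓm) where
    open Module V
    open import Algebra.Properties.CommutativeMonoid.Sum +ᴹ-commutativeMonoid
      using (sum)

    -- Boundary vectors are indexed by all boundary vertices; the values at the
    -- sources are never used.
    SinksIndependent : ∀ {n} → Network n → (Fin n → Carrierᴹ) → Set _
    SinksIndependent {n} N b =
      (a : Fin n → Carrier) → (∀ i → ¬ IsSink i → a i ≈ 0#) →
      sum (λ i → a i *ₗ b i) ≈ᴹ 0ᴹ → ∀ i → a i ≈ 0#
      where open Network N

    -- E solves the linear system of the edge vectors with boundary vectors b.
    record IsEdgeVectorSystem {n} (N : Network n) (l : Direction)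
                              (b : Fin n → Carrierᴹ)
                              (E : Network.Edge N → Carrierᴹ) : Set ℓm where
      open Network N

      coefficient : Edge → Edge → Carrier
      coefficient e f = [-1]^ (int l e ℤ.+ wind l (vec e) (vec f)) * weight e

      field
        at-sink  : ∀ e j → target e ≡ boundary j →
                   E e ≈ᴹ ([-1]^ int l e * weight e) *ₗ b j
        at-black-or-bivalent :
                   ∀ v e f → colour v ≡ black ⊎ degree (internal v) ≡ 2 →
                   target e ≡ internal v → source f ≡ internal v →
                   E e ≈ᴹ coefficient e f *ₗ E f
        -- a white vertex with two outgoing edges is trivalent
        at-trivalent-white :
                   ∀ v e f g → colour v ≡ white → target e ≡ internal v →
                   source f ≡ internal v → source g ≡ internal v → f ≢ g →
                   E e ≈ᴹ coefficient e f *ₗ E f +ᴹ coefficient e g *ₗ E g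

{-# OPTIONS --safe #-}
module Submission where

-- The linear relations at C and D express Fe₄ and Fe₃ through F₃ and F₄, and the relations
-- after the move then give the new vectors; all that is left is to compare signs.  Three
-- facts are needed.  (1) int(h₁) + int(h₂) + int(h₃) + int(h₄) is even: every gauge ray
-- starts outside the square, and it meets a side exactly when the ends of the side are on
-- different sides of its line.  (2) As e₄ leaves the square, it lies to the left of the path
-- h₃ h₄, hence wind(h₃,h₄) + wind(h₃,e₄) + wind(-h₄,e₄) + γ₂(h₄) is odd.  (3) As e₃ leaves
-- the square, it lies to the left of the path h₄ (-h₂), hence
-- wind(h₂,-h₄) + wind(h₂,e₃) + wind(h₄,e₃) + γ₂(h₄) is odd.  For (2) and (3) one checks all
-- sign patterns of the cross products that are compatible with the Plücker relation.  That
-- the edges lie on the stated side holds because the corner of a clockwise simple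
-- quadrilateral is filled, near the vertex, by interior points, and no edge meets the
-- interior.

open import Defs
open import Algebra.Bundles using (CommutativeMonoid; CommutativeRing)
open import Algebra.Module.Bundles using (Module)
import Algebra.Solver.Ring as RingSolver
open import Algebra.Solver.Ring.AlmostCommutativeRing using (fromCommutativeRing; _-Raw-AlmostCommutative⟶_)
open import Data.Bool using (if_then_else_; _∧_; true; false; _xor_)
open import Data.Empty using (⊥; ⊥-elim)
open import Data.Fin as Fin using (Fin)
import Data.Fin.Properties as Fin
open import Data.Integer as ℤ using (ℤ; +_; -[1+_]; 0ℤ; 1ℤ; -1ℤ; _⊖_; _◃_; ∣_∣) renaming (_+_ to _⊕_)
import Data.Integer.Divisibility as ℤ
import Data.Integer.DivMod as ℤ
import Data.Integer.Properties as ℤ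
open import Data.List using (List; []; _∷_)
open import Data.List.Membership.Propositional using (_∈_)
open import Data.List.Relation.Unary.All as All using (All; all?)
open import Data.List.Relation.Unary.Any using (here; there)
open import Data.Maybe.Base using (Maybe; just; nothing)
open import Data.Nat as ℕ using (ℕ; zero; suc) renaming (_<_ to _<ℕ_)
open import Data.Nat.Divisibility using (_∣?_; divides)
import Data.Nat.Properties as ℕ
open import Data.Product using (_×_; _,_; proj₁; proj₂; ∃-syntax; map₂)
import Data.Sign as Sign
open import Data.Sum using (_⊎_; inj₁; inj₂; [_,_]′)
open import Data.Vec as Vec using (Vec; []; _∷_)
open import Function using (_∘_)
open import Function.Bundles using (mk⇔)
open import Level using (_⊔_)
open import Relation.Binary using (tri<; tri≈; tri>)
open import Relation.Binary.PropositionalEquality as ≡ using (_≡_; _≢_)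
open import Relation.Nullary using (¬_; Dec; yes; no; does)
open import Relation.Nullary.Decidable
  using (dec-true; dec-false; does-⇔; _×-dec_; _⊎-dec_; _→-dec_; ¬?; from-yes)
open import Relation.Unary using (Decidable; Pred)

-- The formulas mention neither `e₃` nor `e₄`, although the relations before and after the move are
-- linked only through the edge vectors there. The windings towards these two edges must therefore
-- drop out, and (2) and (3) are what trades them for `γ₂` and the windings inside the square. The
-- obstacle is that the square may be non-convex, possibly with its reflex corner at C or D: lying
-- outside such a corner is not the failure of a pair of inequalities. The corner is then cut by a
-- diagonal, and it is the simplicity of the quadrilateral that makes this diagonal interior. Over
-- an arbitrary ordered field no limits are available, so "near the vertex" becomes an explicit step
-- length. Fact (1) is independent of the shape of the square, because the parity of the crossings
-- of an edge splits into one sign for each end.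

-- Polynomial identities with integer coefficients

module IntegerRingSolver {c ℓ} (R : CommutativeRing c ℓ) where
  open CommutativeRing R
  open import Algebra.Properties.Ring ring
    using (-‿distribˡ-*; -‿distribʳ-*)
  open import Algebra.Properties.Group +-group
    using (⁻¹-involutive; ε⁻¹≈ε)
  open import Algebra.Properties.AbelianGroup +-abelianGroup using (⁻¹-∙-comm)
  open import Algebra.Properties.Monoid.Mult.TCOptimised +-monoid
    using (×-homo-+) renaming (_×_ to _×′_)
  open import Algebra.Properties.Semiring.Mult.TCOptimised semiring
    using (×1-homo-*)
  open import Relation.Binary.Reasoning.Setoid setoid

  -- Integer coefficients have an equality test that computes, which the solver needs for cancelling
  -- terms. With this multiplication `con 1ℤ` evaluates to `1#` and `con -1ℤ` to `- 1#`
  -- definitionally, so goals match without conversion.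
  fromℤ : ℤ → Carrier
  fromℤ (+ n)      = n ×′ 1#
  fromℤ (-[1+ n ]) = - (suc n ×′ 1#)

  fromℤ-⊖ : ∀ m n → fromℤ (m ⊖ n) ≈ m ×′ 1# - n ×′ 1#
  fromℤ-⊖ m       zero    = sym (trans (+-congˡ ε⁻¹≈ε) (+-identityʳ _))
  fromℤ-⊖ zero    (suc n) = sym (+-identityˡ _)
  fromℤ-⊖ (suc m) (suc n) = begin
    fromℤ (suc m ⊖ suc n)                    ≡⟨ ≡.cong fromℤ (ℤ.[1+m]⊖[1+n]≡m⊖n m n) ⟩
    fromℤ (m ⊖ n)                            ≈⟨ fromℤ-⊖ m n ⟩
    m ×′ 1# - n ×′ 1#                          ≈⟨ +-congʳ (+-identityˡ _) ⟨
    0# + m ×′ 1# - n ×′ 1#                     ≈⟨ +-congʳ (+-congʳ (-‿inverseˡ 1#)) ⟨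
    (- 1# + 1#) + m ×′ 1# - n ×′ 1#            ≈⟨ +-congʳ (+-assoc _ _ _) ⟩
    - 1# + (1# + m ×′ 1#) - n ×′ 1#            ≈⟨ +-congʳ (+-comm _ _) ⟩
    (1# + m ×′ 1#) + - 1# - n ×′ 1#            ≈⟨ +-assoc _ _ _ ⟩
    (1# + m ×′ 1#) + (- 1# - n ×′ 1#)          ≈⟨ +-congˡ (⁻¹-∙-comm _ _) ⟩
    (1# + m ×′ 1#) - (1# + n ×′ 1#)            ≈⟨ +-cong (×-homo-+ 1# 1 m) (-‿cong (×-homo-+ 1# 1 n)) ⟨
    suc m ×′ 1# - suc n ×′ 1#                  ∎

  fromℤ-neg-◃ : ∀ n → fromℤ (Sign.- ◃ n) ≈ - (n ×′ 1#)
  fromℤ-neg-◃ zero    = sym ε⁻¹≈ε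
  fromℤ-neg-◃ (suc n) = refl

  fromℤ-+ : ∀ i j → fromℤ (i ℤ.+ j) ≈ fromℤ i + fromℤ j
  fromℤ-+ (+ m)    (+ n)    = ×-homo-+ 1# m n
  fromℤ-+ (+ m)    -[1+ n ] = fromℤ-⊖ m (suc n)
  fromℤ-+ -[1+ m ] (+ n)    = trans (fromℤ-⊖ n (suc m)) (+-comm _ _)
  fromℤ-+ -[1+ m ] -[1+ n ] = begin
    - (suc (suc (m ℕ.+ n)) ×′ 1#)       ≡⟨ ≡.cong (λ k → - (suc k ×′ 1#)) (ℕ.+-suc m n) ⟨
    - ((suc m ℕ.+ suc n) ×′ 1#)         ≈⟨ -‿cong (×-homo-+ 1# (suc m) (suc n)) ⟩
    - (suc m ×′ 1# + suc n ×′ 1#)        ≈⟨ ⁻¹-∙-comm _ _ ⟨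
    - (suc m ×′ 1#) - suc n ×′ 1#        ∎

  fromℤ-* : ∀ i j → fromℤ (i ℤ.* j) ≈ fromℤ i * fromℤ j
  fromℤ-* (+ m)    (+ n)    = trans (reflexive (≡.cong fromℤ (ℤ.+◃n≡+n (m ℕ.* n)))) (×1-homo-* m n)
  fromℤ-* (+ m)    -[1+ n ] = trans (fromℤ-neg-◃ (m ℕ.* suc n))
    (trans (-‿cong (×1-homo-* m (suc n))) (-‿distribʳ-* _ _))
  fromℤ-* -[1+ m ] (+ n)    = trans (fromℤ-neg-◃ (suc m ℕ.* n))
    (trans (-‿cong (×1-homo-* (suc m) n)) (-‿distribˡ-* _ _))
  fromℤ-* -[1+ m ] -[1+ n ] = begin
    (suc m ℕ.* suc n) ×′ 1#              ≈⟨ ×1-homo-* (suc m) (suc n) ⟩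
    suc m ×′ 1# * suc n ×′ 1#             ≈⟨ ⁻¹-involutive _ ⟨
    - - (suc m ×′ 1# * suc n ×′ 1#)       ≈⟨ -‿cong (-‿distribˡ-* _ _) ⟩
    - (- (suc m ×′ 1#) * suc n ×′ 1#)     ≈⟨ -‿distribʳ-* _ _ ⟩
    - (suc m ×′ 1#) * - (suc n ×′ 1#)     ∎

  fromℤ-neg : ∀ i → fromℤ (ℤ.- i) ≈ - fromℤ i
  fromℤ-neg (+ zero)  = sym ε⁻¹≈ε
  fromℤ-neg (+ suc n) = refl
  fromℤ-neg -[1+ n ]  = sym (⁻¹-involutive _)

  morphism : ℤ.+-*-rawRing -Raw-AlmostCommutative⟶ fromCommutativeRing R
  morphism = record
    { ⟦_⟧    = fromℤ
    ; +-homo = fromℤ-+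
    ; *-homo = fromℤ-*
    ; -‿homo = fromℤ-neg
    ; 0-homo = refl
    ; 1-homo = refl
    }

  fromℤ-≟ : ∀ i j → Maybe (fromℤ i ≈ fromℤ j)
  fromℤ-≟ i j with i ℤ.≟ j
  ... | yes ≡.refl = just refl
  ... | no  _      = nothing

  open RingSolver ℤ.+-*-rawRing (fromCommutativeRing R) morphism fromℤ-≟ public
    using (solve; _:=_; _:+_; _:*_; _:-_; :-_; con; Polynomial)

-- Signs and powers of -1 in an ordered field

signs : List ℤ
signs = -1ℤ ∷ 0ℤ ∷ 1ℤ ∷ []

-- Necessary for u, v, w to be the signs of three numbers with sum zero.
NonnegativesVanish : ℤ → ℤ → ℤ → Set
NonnegativesVanish u v w =
  0ℤ ℤ.≤ u → 0ℤ ℤ.≤ v → 0ℤ ℤ.≤ w → u ≡ 0ℤ × v ≡ 0ℤ × w ≡ 0ℤ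

module OrderedFieldProperties {c ℓ₁ ℓ₂} (K : OrderedField c ℓ₁ ℓ₂) where
  open OrderedField K
  open IntegerRingSolver commutativeRing
  open import Algebra.Properties.Ring ring
    using (-‿distribʳ-*)
  open import Algebra.Properties.Group +-group
    using (⁻¹-involutive; ε⁻¹≈ε)
  open import Algebra.Properties.Semiring.Exp semiring using (^-homo-*; ^-assocʳ; ^-congˡ)
  open import Relation.Binary.Reasoning.Setoid setoid

  <-respʳ : ∀ {x y z} → y ≈ z → x < y → x < z
  <-respʳ = proj₁ <-resp-≈

  <-respˡ : ∀ {x y z} → y ≈ z → y < x → z < x
  <-respˡ = proj₂ <-resp-≈

  <⇒≉ : ∀ {x y} → x < y → ¬ x ≈ y
  <⇒≉ x<y x≈y = <-irrefl x≈y x<y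

  >⇒≉ : ∀ {x y} → x < y → ¬ y ≈ x
  >⇒≉ x<y y≈x = <-irrefl (sym y≈x) x<y

  neg-pos : ∀ {x} → x < 0# → 0# < - x
  neg-pos {x} x<0 = <-respˡ (-‿inverseʳ x) (<-respʳ (+-identityˡ (- x)) (+-monoˡ-< (- x) x<0))

  pos-neg : ∀ {x} → 0# < x → - x < 0#
  pos-neg {x} 0<x = <-respʳ (-‿inverseʳ x) (<-respˡ (+-identityˡ (- x)) (+-monoˡ-< (- x) 0<x))

  neg-pos⁻¹ : ∀ {x} → 0# < - x → x < 0#
  neg-pos⁻¹ p = <-respˡ (⁻¹-involutive _) (pos-neg p)

  pos+pos : ∀ {x y} → 0# < x → 0# < y → 0# < x + y
  pos+pos {x} {y} 0<x 0<y = <-trans 0<y (<-respˡ (+-identityˡ y) (+-monoˡ-< y 0<x))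

  pos+nonneg : ∀ {x y} → 0# < x → 0# ≤ y → 0# < x + y
  pos+nonneg 0<x (inj₁ 0<y) = pos+pos 0<x 0<y
  pos+nonneg {x} 0<x (inj₂ 0≈y) = <-respʳ (trans (sym (+-identityʳ x)) (+-congˡ 0≈y)) 0<x

  nonneg+nonneg : ∀ {x y} → 0# ≤ x → 0# ≤ y → 0# ≤ x + y
  nonneg+nonneg (inj₁ 0<x) 0≤y = inj₁ (pos+nonneg 0<x 0≤y)
  nonneg+nonneg {x} {y} (inj₂ 0≈x) 0≤y with 0≤y
  ... | inj₁ 0<y = inj₁ (<-respʳ (trans (sym (+-identityˡ y)) (+-congʳ 0≈x)) 0<y)
  ... | inj₂ 0≈y = inj₂ (trans (sym (+-identityʳ 0#)) (+-cong 0≈x 0≈y))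

  pos*neg : ∀ {x y} → 0# < x → y < 0# → x * y < 0#
  pos*neg 0<x y<0 = neg-pos⁻¹ (<-respʳ (sym (-‿distribʳ-* _ _)) (*-pos 0<x (neg-pos y<0)))

  neg*neg : ∀ {x y} → x < 0# → y < 0# → 0# < x * y
  neg*neg {x} {y} x<0 y<0 = <-respʳ
    (solve 2 (λ x y → (:- x) :* (:- y) := x :* y) refl x y)
    (*-pos (neg-pos x<0) (neg-pos y<0))

  ≮⇒≥ : ∀ {x y} → ¬ x < y → y ≤ x
  ≮⇒≥ {x} {y} x≮y with compare x y
  ... | tri< x<y _ _ = ⊥-elim (x≮y x<y)
  ... | tri≈ _ x≈y _ = inj₂ (sym x≈y)
  ... | tri> _ _ y<x = inj₁ y<x

  ⁻¹-pos : ∀ {x} → 0# < x → 0# < x ⁻¹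
  ⁻¹-pos {x} 0<x with compare (x ⁻¹) 0#
  ... | tri> _ _ p = p
  ... | tri≈ _ p _ = ⊥-elim (<⇒≉ 0<1
          (trans (sym (zeroʳ x)) (trans (*-congˡ (sym p)) (*-inverseʳ (>⇒≉ 0<x)))))
  ... | tri< p _ _ = ⊥-elim (<-asym 0<1
          (<-respˡ (*-inverseʳ (>⇒≉ 0<x)) (pos*neg 0<x p)))

  *-inverseˡ : ∀ {x} → ¬ x ≈ 0# → x ⁻¹ * x ≈ 1#
  *-inverseˡ x≉0 = trans (*-comm _ _) (*-inverseʳ x≉0)

  neg-≈0 : ∀ {x} → x ≈ 0# → - x ≈ 0#
  neg-≈0 e = trans (-‿cong e) ε⁻¹≈ε

  ≤-respʳ : ∀ {x y z} → y ≈ z → x ≤ y → x ≤ z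
  ≤-respʳ e (inj₁ p) = inj₁ (<-respʳ e p)
  ≤-respʳ e (inj₂ p) = inj₂ (trans p e)

  nonpos⇒nonneg : ∀ {x} → x ≤ 0# → 0# ≤ - x
  nonpos⇒nonneg (inj₁ p) = inj₁ (neg-pos p)
  nonpos⇒nonneg (inj₂ p) = inj₂ (sym (neg-≈0 p))

  nonneg⇒nonpos : ∀ {x} → 0# ≤ x → - x ≤ 0#
  nonneg⇒nonpos (inj₁ p) = inj₁ (pos-neg p)
  nonneg⇒nonpos (inj₂ p) = inj₂ (trans (-‿cong (sym p)) ε⁻¹≈ε)

  pos*nonneg : ∀ {x y} → 0# < x → 0# ≤ y → 0# ≤ x * y
  pos*nonneg 0<x (inj₁ 0<y) = inj₁ (*-pos 0<x 0<y)
  pos*nonneg {x} 0<x (inj₂ 0≈y) = inj₂ (trans (sym (zeroʳ x)) (*-congˡ 0≈y))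

  pos*nonpos : ∀ {x y} → 0# < x → y ≤ 0# → x * y ≤ 0#
  pos*nonpos 0<x (inj₁ y<0) = inj₁ (pos*neg 0<x y<0)
  pos*nonpos {x} 0<x (inj₂ y≈0) = inj₂ (trans (*-congˡ y≈0) (zeroʳ x))

  nonneg*nonneg : ∀ {x y} → 0# ≤ x → 0# ≤ y → 0# ≤ x * y
  nonneg*nonneg (inj₁ p) q = pos*nonneg p q
  nonneg*nonneg {x} {y} (inj₂ p) _ = inj₂ (trans (sym (zeroˡ y)) (*-congʳ p))

  pos-factor : ∀ {x y} → 0# < x → 0# < x * y → 0# < y
  pos-factor {x} {y} 0<x 0<xy with compare y 0#
  ... | tri> _ _ 0<y = 0<y
  ... | tri≈ _ y≈0 _ = ⊥-elim (>⇒≉ 0<xy (trans (*-congˡ y≈0) (zeroʳ x)))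
  ... | tri< y<0 _ _ = ⊥-elim (<-asym 0<xy (pos*neg 0<x y<0))

  ≤-respˡ : ∀ {x y z} → y ≈ z → y ≤ x → z ≤ x
  ≤-respˡ e (inj₁ p) = inj₁ (<-respˡ e p)
  ≤-respˡ e (inj₂ p) = inj₂ (trans (sym e) p)

  ratio∈[0,1] : ∀ {a b d} → 0# ≤ a → 0# ≤ b → a + b ≈ d → 0# < d →
                0# ≤ a * d ⁻¹ × a * d ⁻¹ ≤ 1#
  ratio∈[0,1] {a} {b} {d} 0≤a 0≤b a+b≈d 0<d = nonneg 0≤a , at-most-one (nonneg 0≤b)
    where
    i = d ⁻¹
    nonneg : ∀ {x} → 0# ≤ x → 0# ≤ x * i
    nonneg (inj₁ p) = inj₁ (*-pos p (⁻¹-pos 0<d))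
    nonneg (inj₂ p) = inj₂ (trans (sym (zeroˡ i)) (*-congʳ p))
    sum : b * i + a * i ≈ 1#
    sum = begin
      b * i + a * i  ≈⟨ distribʳ i b a ⟨
      (b + a) * i    ≈⟨ *-congʳ (trans (+-comm b a) a+b≈d) ⟩
      d * i          ≈⟨ *-inverseʳ (>⇒≉ 0<d) ⟩
      1#             ∎
    at-most-one : 0# ≤ b * i → a * i ≤ 1#
    at-most-one (inj₁ p) = inj₁ (<-respˡ (+-identityˡ _) (<-respʳ sum (+-monoˡ-< (a * i) p)))
    at-most-one (inj₂ p) = inj₂ (trans (sym (+-identityˡ _)) (trans (+-congʳ p) sum))

  -- Since `sign` is stuck on `compare`, the sign is an index here: one match replaces `sign x` by a
  -- numeral and supplies the inequality behind it.
  data HasSign (x : Carrier) : ℤ → Set (c ⊔ ℓ₁ ⊔ ℓ₂) where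
    positive : 0# < x → HasSign x 1ℤ
    null     : x ≈ 0# → HasSign x 0ℤ
    negative : x < 0# → HasSign x -1ℤ

  sign-view : ∀ x → HasSign x (sign x)
  sign-view x with compare x 0#
  ... | tri< p _ _ = negative p
  ... | tri≈ _ p _ = null p
  ... | tri> _ _ p = positive p

  sign-unique : ∀ {x s t} → HasSign x s → HasSign x t → s ≡ t
  sign-unique (positive _) (positive _) = ≡.refl
  sign-unique (positive p) (null q)     = ⊥-elim (>⇒≉ p q)
  sign-unique (positive p) (negative q) = ⊥-elim (<-asym p q)
  sign-unique (null p)     (positive q) = ⊥-elim (>⇒≉ q p)
  sign-unique (null _)     (null _)     = ≡.refl
  sign-unique (null p)     (negative q) = ⊥-elim (<⇒≉ q p)
  sign-unique (negative p) (positive q) = ⊥-elim (<-asym p q)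
  sign-unique (negative p) (null q)     = ⊥-elim (<⇒≉ p q)
  sign-unique (negative _) (negative _) = ≡.refl

  sign-≡ : ∀ {x s} → HasSign x s → sign x ≡ s
  sign-≡ v = sign-unique (sign-view _) v

  sign-cong : ∀ {x y} → x ≈ y → sign x ≡ sign y
  sign-cong {x} {y} x≈y = sign-≡ (go (sign-view y))
    where
    go : ∀ {s} → HasSign y s → HasSign x s
    go (positive p) = positive (<-respʳ (sym x≈y) p)
    go (null p)     = null (trans x≈y p)
    go (negative p) = negative (<-respˡ (sym x≈y) p)

  sign-neg : ∀ x → sign (- x) ≡ ℤ.- sign x
  sign-neg x with sign x | sign-view x
  ... | _ | positive p = sign-≡ (negative (pos-neg p))
  ... | _ | null p     = sign-≡ (null (neg-≈0 p))
  ... | _ | negative p = sign-≡ (positive (neg-pos p))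

  sign-* : ∀ x y → sign (x * y) ≡ sign x ℤ.* sign y
  sign-* x y with sign x | sign-view x | sign y | sign-view y
  ... | _ | positive p | _ | positive q = sign-≡ (positive (*-pos p q))
  ... | _ | positive p | _ | negative q = sign-≡ (negative (pos*neg p q))
  ... | _ | negative p | _ | positive q = sign-≡ (negative (<-respˡ (*-comm y x) (pos*neg q p)))
  ... | _ | negative p | _ | negative q = sign-≡ (positive (neg*neg p q))
  ... | _ | null p     | _ | positive _ = sign-≡ (null (trans (*-congʳ p) (zeroˡ y)))
  ... | _ | null p     | _ | null _     = sign-≡ (null (trans (*-congʳ p) (zeroˡ y)))
  ... | _ | null p     | _ | negative _ = sign-≡ (null (trans (*-congʳ p) (zeroˡ y)))
  ... | _ | positive _ | _ | null q     = sign-≡ (null (trans (*-congˡ q) (zeroʳ x)))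
  ... | _ | negative _ | _ | null q     = sign-≡ (null (trans (*-congˡ q) (zeroʳ x)))

  sign∈signs : ∀ x → sign x ∈ signs
  sign∈signs x with sign x | sign-view x
  ... | _ | positive _ = there (there (here ≡.refl))
  ... | _ | null _     = there (here ≡.refl)
  ... | _ | negative _ = here ≡.refl

  sign≡0 : ∀ {x} → sign x ≡ 0ℤ → x ≈ 0#
  sign≡0 {x} e with sign x | sign-view x
  ... | _ | null p = p

  0≤sign : ∀ {x} → 0ℤ ℤ.≤ sign x → 0# ≤ x
  0≤sign {x} 0≤s with sign x | sign-view x
  ... | _ | positive p = inj₁ p
  ... | _ | null p     = inj₂ (sym p)
  0≤sign () | _ | negative _

  zero-sum-signs : ∀ {x y z} → x + y + z ≈ 0# → NonnegativesVanish (sign x) (sign y) (sign z)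
  zero-sum-signs {x} {y} {z} s p q r =
      first s (0≤sign p) (0≤sign q) (0≤sign r)
    , first (trans (solve 3 (λ x y z → y :+ z :+ x := x :+ y :+ z) refl x y z) s)
            (0≤sign q) (0≤sign r) (0≤sign p)
    , first (trans (solve 3 (λ x y z → z :+ x :+ y := x :+ y :+ z) refl x y z) s)
            (0≤sign r) (0≤sign p) (0≤sign q)
    where
    first : ∀ {x y z} → x + y + z ≈ 0# → 0# ≤ x → 0# ≤ y → 0# ≤ z → sign x ≡ 0ℤ
    first s (inj₂ 0≈x) _ _ = sign-≡ (null (sym 0≈x))
    first s (inj₁ 0<x) q r = ⊥-elim (>⇒≉ (pos+nonneg (pos+nonneg 0<x q) r) s)

  -- This stands in for "for all sufficiently small t": a strict inequality survives a short step in
  -- any direction.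
  small-step : ∀ {a} b → a < 0# → ∃[ t ] (0# < t × t ≤ 1# × a + t * b < 0#)
  small-step {a} b a<0 with 0# <? b
  ... | no b≯0 = 1# , 0<1 , inj₂ refl ,
          neg-pos⁻¹ (<-respʳ (solve 2 (λ a b → (:- a) :+ (:- b) := :- (a :+ con 1ℤ :* b)) refl a b)
            (pos+nonneg (neg-pos a<0) (nonpos⇒nonneg (≮⇒≥ b≯0))))
  ... | yes 0<b = t , 0<t , inj₁ t<1 , neg-pos⁻¹ (<-respʳ value (*-pos (*-pos 0<-a 0<-a) (⁻¹-pos 0<d)))
    where
    d = - a + b
    0<-a = neg-pos a<0
    0<d = pos+pos 0<-a 0<b
    -- With this choice `a + t * b` equals -a²/(b - a), and `t` stays below 1 because `t` and
    -- `b * d ⁻¹` add up to 1.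
    t = - a * d ⁻¹
    0<t : 0# < t
    0<t = *-pos 0<-a (⁻¹-pos 0<d)
    t<1 : t < 1#
    t<1 = <-respˡ (+-identityˡ t) (<-respʳ
      (trans (sym (distribʳ _ _ _)) (trans (*-congʳ (+-comm _ _)) (*-inverseʳ (>⇒≉ 0<d))))
      (+-monoˡ-< t (*-pos 0<b (⁻¹-pos 0<d))))
    value : - a * - a * d ⁻¹ ≈ - (a + t * b)
    value = begin
      - a * - a * d ⁻¹                    ≈⟨ solve 3 (λ a b i →
                                              (:- a) :* (:- a) :* i
                                              := (:- a) :* ((:- a :+ b) :* i) :- ((:- a) :* i :* b))
                                              refl a b (d ⁻¹) ⟩
      - a * (d * d ⁻¹) - t * b            ≈⟨ +-congʳ (*-congˡ (*-inverseʳ (>⇒≉ 0<d))) ⟩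
      - a * 1# - t * b                    ≈⟨ solve 2 (λ a s → (:- a) :* con 1ℤ :- s := :- (a :+ s)) refl a (t * b) ⟩
      - (a + t * b)                       ∎

  square-1 : - 1# * - 1# ≈ 1#
  square-1 = solve 0 (con -1ℤ :* con -1ℤ := con 1ℤ) refl

  [-1]^-even : ∀ z → + 2 ℤ.∣ z → [-1]^ z ≈ 1#
  [-1]^-even z (divides q e) = begin
    (- 1#) ^ ∣ z ∣           ≡⟨ ≡.cong (λ k → (- 1#) ^ k) (≡.trans e (ℕ.*-comm q 2)) ⟩
    (- 1#) ^ (2 ℕ.* q)       ≈⟨ ^-assocʳ (- 1#) 2 q ⟨
    ((- 1#) ^ 2) ^ q         ≈⟨ ^-congˡ q (trans (*-congˡ (*-identityʳ _)) square-1) ⟩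
    1# ^ q                   ≈⟨ one q ⟩
    1#                       ∎
    where
    one : ∀ q → 1# ^ q ≈ 1#
    one zero    = refl
    one (suc q) = trans (*-identityˡ _) (one q)

  [-1]^-square : ∀ z → [-1]^ z * [-1]^ z ≈ 1#
  [-1]^-square z = trans (sym (^-homo-* (- 1#) ∣ z ∣ ∣ z ∣))
    ([-1]^-even (+ (∣ z ∣ ℕ.+ ∣ z ∣)) (divides ∣ z ∣ (double ∣ z ∣)))
    where
    double : ∀ n → n ℕ.+ n ≡ n ℕ.* 2
    double n = ≡.sym (≡.trans (ℕ.*-comm n 2) (≡.cong (n ℕ.+_) (ℕ.+-identityʳ n)))

  -- `[-1]^_` forgets the sign of its exponent, so additivity for exponents of opposite sign rests
  -- on (-1)(-1) = 1: lowering both numbers by one removes two factors -1.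
  [-1]^-⊖ : ∀ m n → [-1]^ (m ⊖ n) ≈ (- 1#) ^ m * (- 1#) ^ n
  [-1]^-⊖ m       zero    = sym (*-identityʳ _)
  [-1]^-⊖ zero    (suc n) = sym (*-identityˡ _)
  [-1]^-⊖ (suc m) (suc n) = begin
    [-1]^ (suc m ⊖ suc n)                    ≡⟨ ≡.cong [-1]^_ (ℤ.[1+m]⊖[1+n]≡m⊖n m n) ⟩
    [-1]^ (m ⊖ n)                            ≈⟨ [-1]^-⊖ m n ⟩
    (- 1#) ^ m * (- 1#) ^ n                  ≈⟨ solve 2 (λ x y → x :* y := (con -1ℤ :* x) :* (con -1ℤ :* y)) refl _ _ ⟩
    (- 1#) ^ suc m * (- 1#) ^ suc n          ∎

  [-1]^-+ : ∀ i j → [-1]^ (i ℤ.+ j) ≈ [-1]^ i * [-1]^ j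
  [-1]^-+ (+ m)    (+ n)    = ^-homo-* (- 1#) m n
  [-1]^-+ (+ m)    -[1+ n ] = [-1]^-⊖ m (suc n)
  [-1]^-+ -[1+ m ] (+ n)    = trans ([-1]^-⊖ n (suc m)) (*-comm _ _)
  [-1]^-+ -[1+ m ] -[1+ n ] = begin
    (- 1#) ^ suc (suc (m ℕ.+ n))           ≡⟨ ≡.cong (λ k → (- 1#) ^ suc k) (ℕ.+-suc m n) ⟨
    (- 1#) ^ (suc m ℕ.+ suc n)             ≈⟨ ^-homo-* (- 1#) (suc m) (suc n) ⟩
    (- 1#) ^ suc m * (- 1#) ^ suc n        ∎

-- The finite check of winding parities

-- The arguments are the signs of ⟨e,f⟩, ⟨e,l⟩, ⟨f,l⟩.
windOf : ℤ → ℤ → ℤ → ℤ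
windOf ef el fl = if does (ef ℤ.≟ el) ∧ does (el ℤ.≟ ℤ.- fl) then ef else 0ℤ

γ₂Of : ℤ → ℤ
γ₂Of el = (1ℤ ℤ.- el) ℤ./ (+ 2)

-- Arguments: the signs of ⟨a,x⟩, ⟨a,y⟩, ⟨x,y⟩.  The path enters a vertex along a and
-- leaves it along x; y points strictly to its left.
LeftOfPath : ℤ → ℤ → ℤ → Set
LeftOfPath ax ay xy = (ax ≡ -1ℤ × (ay ≡ 1ℤ ⊎ xy ≡ 1ℤ)) ⊎ (ay ≡ 1ℤ × xy ≡ 1ℤ)

leftOfPath? : ∀ ax ay xy → Dec (LeftOfPath ax ay xy)
leftOfPath? ax ay xy =
  ((ax ℤ.≟ -1ℤ) ×-dec ((ay ℤ.≟ 1ℤ) ⊎-dec (xy ℤ.≟ 1ℤ)))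
  ⊎-dec ((ay ℤ.≟ 1ℤ) ×-dec (xy ℤ.≟ 1ℤ))

nonnegativesVanish? : ∀ u v w → Dec (NonnegativesVanish u v w)
nonnegativesVanish? u v w =
  (0ℤ ℤ.≤? u) →-dec (0ℤ ℤ.≤? v) →-dec (0ℤ ℤ.≤? w) →-dec
  ((u ℤ.≟ 0ℤ) ×-dec (v ℤ.≟ 0ℤ) ×-dec (w ℤ.≟ 0ℤ))

-- Both corners share one configuration of signs. At C the path is `a` = h₃, `x` = h₄. At D it is
-- `a` = h₄, `x` = -h₂; the edge there has vector `-x`, so the windings at D are from `-x` to `-a`,
-- from `-x` to y and from `a` to y, which explains the negated arguments. In both components `γ₂Of`
-- is taken at h₄.
WindParities : (ax ay xy al xl yl : ℤ) → Set
WindParities ax ay xy al xl yl =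
    + 2 ℤ.∣ windOf ax al xl ℤ.+ windOf ay al yl ℤ.+ windOf (ℤ.- xy) (ℤ.- xl) yl ℤ.+ γ₂Of xl ℤ.+ 1ℤ
  × + 2 ℤ.∣ windOf (ℤ.- ax) (ℤ.- xl) (ℤ.- al) ℤ.+ windOf (ℤ.- xy) (ℤ.- xl) yl ℤ.+ windOf ay al yl
            ℤ.+ γ₂Of al ℤ.+ 1ℤ

-- The last two hypotheses are what the Plücker relation
-- ⟨a,x⟩⟨y,l⟩ - ⟨a,y⟩⟨x,l⟩ + ⟨a,l⟩⟨x,y⟩ = 0 says about signs.
WindClaim : (ax ay xy al xl yl : ℤ) → Set
WindClaim ax ay xy al xl yl =
  ¬ al ≡ 0ℤ → ¬ xl ≡ 0ℤ → ¬ yl ≡ 0ℤ →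
  LeftOfPath ax ay xy →
  NonnegativesVanish (ax ℤ.* yl) (ℤ.- (ay ℤ.* xl)) (al ℤ.* xy) →
  NonnegativesVanish (ℤ.- (ax ℤ.* yl)) (ay ℤ.* xl) (ℤ.- (al ℤ.* xy)) →
  WindParities ax ay xy al xl yl

windClaim? : ∀ ax ay xy al xl yl → Dec (WindClaim ax ay xy al xl yl)
windClaim? ax ay xy al xl yl =
  ¬? (al ℤ.≟ 0ℤ) →-dec ¬? (xl ℤ.≟ 0ℤ) →-dec ¬? (yl ℤ.≟ 0ℤ) →-dec
  leftOfPath? ax ay xy →-dec
  nonnegativesVanish? _ _ _ →-dec nonnegativesVanish? _ _ _ →-dec
  ((2 ∣? _) ×-dec (2 ∣? _))

-- Opaque, so that the evaluated case analysis is never unfolded.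
opaque
  windClaim : ∀ {ax ay xy al xl yl} →
    ax ∈ signs → ay ∈ signs → xy ∈ signs → al ∈ signs → xl ∈ signs → yl ∈ signs →
    WindClaim ax ay xy al xl yl
  windClaim p q r s t u =
    All.lookup (All.lookup (All.lookup (All.lookup (All.lookup (All.lookup all-patterns p) q) r) s) t) u
    where
    all-patterns : All (λ ax → All (λ ay → All (λ xy → All (λ al → All (λ xl → All (λ yl →
                     WindClaim ax ay xy al xl yl) signs) signs) signs) signs) signs) signs
    all-patterns =
      from-yes (all? (λ ax → all? (λ ay → all? (λ xy → all? (λ al → all? (λ xl → all? (λ yl →
        windClaim? ax ay xy al xl yl) signs) signs) signs) signs) signs) signs)

-- Cross products in the plane

module PlaneProperties {c ℓ₁ ℓ₂} (K : OrderedField c ℓ₁ ℓ₂) where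
  open OrderedField K
  open Plane K
  open OrderedFieldProperties K
  open IntegerRingSolver commutativeRing

  infixl 7 _·ᴾ_
  infixl 6 _-ᴾ_ _+ᴾ_
  Polyₚ : _ → Set
  Polyₚ n = Polynomial n × Polynomial n

  crossᴾ : ∀ {n} → Polyₚ n → Polyₚ n → Polynomial n
  crossᴾ (x , y) (x′ , y′) = x :* y′ :- y :* x′

  _-ᴾ_ _+ᴾ_ : ∀ {n} → Polyₚ n → Polyₚ n → Polyₚ n
  (x , y) -ᴾ (x′ , y′) = x :- x′ , y :- y′
  (x , y) +ᴾ (x′ , y′) = x :+ x′ , y :+ y′

  _·ᴾ_ : ∀ {n} → Polynomial n → Polyₚ n → Polyₚ n
  a ·ᴾ (x , y) = a :* x , a :* y

  ≈ₚ-sym : ∀ {u v} → u ≈ₚ v → v ≈ₚ u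
  ≈ₚ-sym (e , e′) = sym e , sym e′

  ≈ₚ-trans : ∀ {u v w} → u ≈ₚ v → v ≈ₚ w → u ≈ₚ w
  ≈ₚ-trans (e , e′) (d , d′) = trans e d , trans e′ d′

  swap-difference : ∀ p q → p -ₚ q ≈ₚ -ₚ (q -ₚ p)
  swap-difference (p , p′) (q , q′) = eq p q , eq p′ q′
    where
    eq : ∀ x y → x - y ≈ - (y - x)
    eq = solve 2 (λ x y → x :- y := :- (y :- x)) refl

  cross-cong : ∀ {u u′ v v′} → u ≈ₚ u′ → v ≈ₚ v′ → cross u v ≈ cross u′ v′
  cross-cong (e , e′) (d , d′) = +-cong (*-cong e d′) (-‿cong (*-cong e′ d))

  cross-antisym : ∀ u v → cross u v ≈ - cross v u
  cross-antisym (u , u′) (v , v′) =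
    solve 4 (λ u u′ v v′ → crossᴾ (u , u′) (v , v′) := :- crossᴾ (v , v′) (u , u′)) refl u u′ v v′

  cross-negˡ : ∀ u v → cross (-ₚ u) v ≈ - cross u v
  cross-negˡ (u , u′) (v , v′) =
    solve 4 (λ u u′ v v′ → crossᴾ (:- u , :- u′) (v , v′) := :- crossᴾ (u , u′) (v , v′)) refl u u′ v v′

  cross-negʳ : ∀ u v → cross u (-ₚ v) ≈ - cross u v
  cross-negʳ (u , u′) (v , v′) =
    solve 4 (λ u u′ v v′ → crossᴾ (u , u′) (:- v , :- v′) := :- crossᴾ (u , u′) (v , v′)) refl u u′ v v′

  plücker : ∀ u v w z →
            cross u v * cross w z + - (cross u w * cross v z) + cross u z * cross v w ≈ 0#
  plücker (a , a′) (b , b′) (c , c′) (d , d′) =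
    solve 8 (λ a a′ b b′ c c′ d d′ → let u = a , a′; v = b , b′; w = c , c′; z = d , d′ in
      crossᴾ u v :* crossᴾ w z :+ :- (crossᴾ u w :* crossᴾ v z) :+ crossᴾ u z :* crossᴾ v w := con 0ℤ)
      refl a a′ b b′ c c′ d d′

  -- Cramer's rule with the denominator cleared, so that it also holds for parallel `u` and `w`.
  cramer : ∀ u v w → cross u w · v ≈ₚ cross v w · u +ₚ cross u v · w
  cramer (a , a′) (b , b′) (c , c′) =
      solve 6 (λ a a′ b b′ c c′ → let u = a , a′; v = b , b′; w = c , c′ in
        crossᴾ u w :* b := crossᴾ v w :* a :+ crossᴾ u v :* c) refl a a′ b b′ c c′
    , solve 6 (λ a a′ b b′ c c′ → let u = a , a′; v = b , b′; w = c , c′ in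
        crossᴾ u w :* b′ := crossᴾ v w :* a′ :+ crossᴾ u v :* c′) refl a a′ b b′ c c′

  -- Positive on the left of the line from p to q.
  side : Pt → Pt → Pt → Carrier
  side p q x = cross (q -ₚ p) (x -ₚ p)

  side-rotate : ∀ p q r → side p q r ≈ side q r p
  side-rotate (p , p′) (q , q′) (r , r′) =
    solve 6 (λ p p′ q q′ r r′ → let P = p , p′; Q = q , q′; R = r , r′ in
      crossᴾ (Q -ᴾ P) (R -ᴾ P) := crossᴾ (R -ᴾ Q) (P -ᴾ Q)) refl p p′ q q′ r r′

  side-along : ∀ p q r t y → side p q (r +ₚ t · y) ≈ side p q r + t * cross (q -ₚ p) y
  side-along (p , p′) (q , q′) (r , r′) t (y , y′) =
    solve 9 (λ p p′ q q′ r r′ t y y′ → let P = p , p′; Q = q , q′; R = r , r′; Y = y , y′ in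
      crossᴾ (Q -ᴾ P) (R +ᴾ t ·ᴾ Y -ᴾ P) := crossᴾ (Q -ᴾ P) (R -ᴾ P) :+ t :* crossᴾ (Q -ᴾ P) Y)
      refl p p′ q q′ r r′ t y y′

  side-end : ∀ p q t y → side p q (q +ₚ t · y) ≈ t * cross (q -ₚ p) y
  side-end (p , p′) (q , q′) t (y , y′) =
    solve 7 (λ p p′ q q′ t y y′ → let P = p , p′; Q = q , q′; Y = y , y′ in
      crossᴾ (Q -ᴾ P) (Q +ᴾ t ·ᴾ Y -ᴾ P) := t :* crossᴾ (Q -ᴾ P) Y)
      refl p p′ q q′ t y y′

  side-start : ∀ p q t y → side p q (p +ₚ t · y) ≈ t * cross (q -ₚ p) y
  side-start (p , p′) (q , q′) t (y , y′) =
    solve 7 (λ p p′ q q′ t y y′ → let P = p , p′; Q = q , q′; Y = y , y′ in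
      crossᴾ (Q -ᴾ P) (P +ᴾ t ·ᴾ Y -ᴾ P) := t :* crossᴾ (Q -ᴾ P) Y)
      refl p p′ q q′ t y y′

  -- Cutting along the diagonal from `p` to `r`. Being a polynomial identity, it holds for signed
  -- areas of non-convex quadrilaterals as well.
  quad-area : ∀ p q r s → cross (r -ₚ p) (s -ₚ q) ≈ side p q r + side r s p
  quad-area (p , p′) (q , q′) (r , r′) (s , s′) =
    solve 8 (λ p p′ q q′ r r′ s s′ → let P = p , p′; Q = q , q′; R = r , r′; S = s , s′ in
      crossᴾ (R -ᴾ P) (S -ᴾ Q) := crossᴾ (Q -ᴾ P) (R -ᴾ P) :+ crossᴾ (S -ᴾ R) (P -ᴾ R))
      refl p p′ q q′ r r′ s s′

  quad-rotate : ∀ p q r s → cross (r -ₚ p) (s -ₚ q) ≈ cross (s -ₚ q) (p -ₚ r)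
  quad-rotate (p , p′) (q , q′) (r , r′) (s , s′) =
    solve 8 (λ p p′ q q′ r r′ s s′ → let P = p , p′; Q = q , q′; R = r , r′; S = s , s′ in
      crossᴾ (R -ᴾ P) (S -ᴾ Q) := crossᴾ (S -ᴾ Q) (P -ᴾ R))
      refl p p′ q q′ r r′ s s′

  OnSegment-reverse : ∀ {p q x} → OnSegment p q x → OnSegment q p x
  OnSegment-reverse {p} {q} (s , 0≤s , s≤1 , e , e′) =
    1# - s , flip s≤1 , flip′ 0≤s , trans e (eq (proj₁ p) (proj₁ q) s) , trans e′ (eq (proj₂ p) (proj₂ q) s)
    where
    eq : ∀ p q s → p + s * (q - p) ≈ q + (1# - s) * (p - q)
    eq = solve 3 (λ p q s → p :+ s :* (q :- p) := q :+ (con 1ℤ :- s) :* (p :- q)) refl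
    flip : ∀ {s} → s ≤ 1# → 0# ≤ 1# - s
    flip {s} (inj₁ p) = inj₁ (<-respˡ (-‿inverseʳ s) (+-monoˡ-< (- s) p))
    flip {s} (inj₂ p) = inj₂ (trans (sym (-‿inverseʳ s)) (+-congʳ p))
    flip′ : ∀ {s} → 0# ≤ s → 1# - s ≤ 1#
    flip′ {s} (inj₁ p) = inj₁ (<-respˡ (+-comm (- s) 1#) (<-respʳ (+-identityˡ 1#) (+-monoˡ-< 1# (pos-neg p))))
    flip′ {s} (inj₂ p) = inj₂ (trans (+-congˡ (-‿cong (sym p)))
      (solve 1 (λ s → s :- con 0ℤ := s) refl 1#))

-- Edges at a corner of a simple quadrilateral

module Corner {c ℓ₁ ℓ₂} (K : OrderedField c ℓ₁ ℓ₂) where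
  open OrderedField K
  open Plane K
  open OrderedFieldProperties K
  open PlaneProperties K
  open IntegerRingSolver commutativeRing
  open import Algebra.Properties.Group +-group using (ε⁻¹≈ε; ⁻¹-involutive)
  open import Relation.Binary.Reasoning.Setoid setoid

  ·-cancel : ∀ {a v} → ¬ a ≈ 0# → a · v ≈ₚ 0ₚ → v ≈ₚ 0ₚ
  ·-cancel {a} a≉0 (e , e′) = cancel e , cancel e′
    where
    cancel : ∀ {x} → a * x ≈ 0# → x ≈ 0#
    cancel {x} e = begin
      x               ≈⟨ *-identityˡ x ⟨
      1# * x          ≈⟨ *-congʳ (*-inverseˡ a≉0) ⟨
      a ⁻¹ * a * x    ≈⟨ *-assoc _ _ _ ⟩
      a ⁻¹ * (a * x)  ≈⟨ *-congˡ e ⟩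
      a ⁻¹ * 0#       ≈⟨ zeroʳ _ ⟩
      0#              ∎

  -- The parameters come from Cramer's rule. Both differences of sides equal the determinant `d`,
  -- positive by strictness, so each parameter and its complement to 1 are nonnegative quotients.
  -- The weak inequalities admit `r` on the line `p q` and `q` on the line `r s`, as at a straight
  -- corner.
  segments-meet : ∀ p q r s → 0# ≤ side p q r → side p q s < 0# → 0# ≤ side r s q → side r s p < 0# →
                  ∃[ x ] (OnSegment p q x × OnSegment r s x)
  segments-meet p q r s 0≤pqr pqs<0 0≤rsq rsp<0 = p +ₚ u · (q -ₚ p)
    , (u , proj₁ u-bounds , proj₂ u-bounds , refl , refl)
    , (t , proj₁ t-bounds , proj₂ t-bounds , same (proj₁ solution) , same (proj₂ solution))
    where
    solution = cramer (q -ₚ p) (r -ₚ p) (s -ₚ r)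
    d = cross (s -ₚ r) (q -ₚ p)
    i = d ⁻¹
    d≈pqr-pqs : ∀ p q r s → side p q r - side p q s ≈ cross (s -ₚ r) (q -ₚ p)
    d≈pqr-pqs (p , p′) (q , q′) (r , r′) (s , s′) =
      solve 8 (λ p p′ q q′ r r′ s s′ → let P = p , p′; Q = q , q′; R = r , r′; S = s , s′ in
        crossᴾ (Q -ᴾ P) (R -ᴾ P) :- crossᴾ (Q -ᴾ P) (S -ᴾ P) := crossᴾ (S -ᴾ R) (Q -ᴾ P))
        refl p p′ q q′ r r′ s s′
    d≈rsq-rsp : ∀ p q r s → - side r s p + side r s q ≈ cross (s -ₚ r) (q -ₚ p)
    d≈rsq-rsp (p , p′) (q , q′) (r , r′) (s , s′) =
      solve 8 (λ p p′ q q′ r r′ s s′ → let P = p , p′; Q = q , q′; R = r , r′; S = s , s′ in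
        :- crossᴾ (S -ᴾ R) (P -ᴾ R) :+ crossᴾ (S -ᴾ R) (Q -ᴾ R) := crossᴾ (S -ᴾ R) (Q -ᴾ P))
        refl p p′ q q′ r r′ s s′
    0<d : 0# < d
    0<d = <-respʳ (d≈rsq-rsp p q r s) (pos+nonneg (neg-pos rsp<0) 0≤rsq)
    t = side p q r * i
    u = - side r s p * i
    t-bounds = ratio∈[0,1] 0≤pqr (inj₁ (neg-pos pqs<0)) (d≈pqr-pqs p q r s) 0<d
    u-bounds = ratio∈[0,1] (inj₁ (neg-pos rsp<0)) 0≤rsq (d≈rsq-rsp p q r s) 0<d
    rsp≈ : ∀ p r s → cross (r -ₚ p) (s -ₚ r) ≈ side r s p
    rsp≈ (p , p′) (r , r′) (s , s′) =
      solve 6 (λ p p′ r r′ s s′ → let P = p , p′; R = r , r′; S = s , s′ in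
        crossᴾ (R -ᴾ P) (S -ᴾ R) := crossᴾ (S -ᴾ R) (P -ᴾ R)) refl p p′ r r′ s s′
    same : ∀ {p₀ q₀ r₀ s₀} →
           cross (q -ₚ p) (s -ₚ r) * (r₀ - p₀) ≈
             cross (r -ₚ p) (s -ₚ r) * (q₀ - p₀) + side p q r * (s₀ - r₀) →
           p₀ + u * (q₀ - p₀) ≈ r₀ + t * (s₀ - r₀)
    same {p₀} {q₀} {r₀} {s₀} e = begin
      p₀ + u * (q₀ - p₀)
        ≈⟨ solve 7 (λ p q r s a b i →
             p :+ (:- a) :* i :* (q :- p) :=
             r :+ b :* i :* (s :- r) :- (r :- p) :- i :* (a :* (q :- p) :+ b :* (s :- r)))
             refl p₀ q₀ r₀ s₀ (side r s p) (side p q r) i ⟩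
      r₀ + t * (s₀ - r₀) - (r₀ - p₀) - i * (side r s p * (q₀ - p₀) + side p q r * (s₀ - r₀))
        ≈⟨ +-congˡ (-‿cong (*-congˡ (trans (+-congʳ (*-congʳ (sym (rsp≈ p r s))))
             (trans (sym e) (*-congʳ (cross-antisym _ _)))))) ⟩
      r₀ + t * (s₀ - r₀) - (r₀ - p₀) - i * (- d * (r₀ - p₀))
        ≈⟨ solve 4 (λ x y d i → x :- y :- i :* ((:- d) :* y) := x :- y :+ (d :* i) :* y)
             refl (r₀ + t * (s₀ - r₀)) (r₀ - p₀) d i ⟩
      r₀ + t * (s₀ - r₀) - (r₀ - p₀) + (d * i) * (r₀ - p₀)
        ≈⟨ +-congˡ (*-congʳ (*-inverseʳ (>⇒≉ 0<d))) ⟩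
      r₀ + t * (s₀ - r₀) - (r₀ - p₀) + 1# * (r₀ - p₀)
        ≈⟨ solve 2 (λ x y → x :- y :+ con 1ℤ :* y := x) refl (r₀ + t * (s₀ - r₀)) (r₀ - p₀) ⟩
      r₀ + t * (s₀ - r₀) ∎

  Disjoint : (p q r s : Pt) → Set _
  Disjoint p q r s = ∀ {x} → OnSegment p q x → OnSegment r s x → ⊥

  -- Both diagonals cut off the same negative total area, so `side s p q` is negative. If one
  -- triangle at the diagonal from `p` to `r` were not clockwise, the other would be, and two
  -- opposite sides would meet: `p q` with `r s`, or `q r` with `s p`.
  reflex⇒diagonal : ∀ p q r s → ClockwiseQuad p q r s → Disjoint p q r s → Disjoint q r s p →
                    0# ≤ side q r s → side p q r < 0# × side r s p < 0#
  reflex⇒diagonal p q r s cw pq∩rs qr∩sp 0≤qrs = ≮0⇒< pqr≱0 , ≮0⇒< rsp≱0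
    where
    ≮0⇒< : ∀ {x} → ¬ 0# ≤ x → x < 0#
    ≮0⇒< {x} x≱0 with x <? 0#
    ... | yes x<0 = x<0
    ... | no x≮0 = ⊥-elim (x≱0 (≮⇒≥ x≮0))
    other : ∀ {x y} → x + y < 0# → 0# ≤ x → y < 0#
    other s<0 0≤x = ≮0⇒< (λ 0≤y → ≤⇒≯ (nonneg+nonneg 0≤x 0≤y) s<0)
      where
      ≤⇒≯ : ∀ {x} → 0# ≤ x → ¬ x < 0#
      ≤⇒≯ (inj₁ p) q = <-asym p q
      ≤⇒≯ (inj₂ p) q = >⇒≉ q p
    sum₁ : side p q r + side r s p < 0#
    sum₁ = <-respˡ (quad-area p q r s) cw
    sum₂ : side q r s + side s p q < 0#
    sum₂ = <-respˡ (trans (quad-rotate p q r s) (quad-area q r s p)) cw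
    spq<0 : side s p q < 0#
    spq<0 = other sum₂ 0≤qrs
    pqr≱0 : ¬ 0# ≤ side p q r
    pqr≱0 0≤pqr = meet (segments-meet p q r s 0≤pqr (<-respˡ (side-rotate s p q) spq<0)
                       (≤-respʳ (side-rotate q r s) 0≤qrs) (other sum₁ 0≤pqr))
      where
      meet : ∃[ x ] (OnSegment p q x × OnSegment r s x) → ⊥
      meet (x , on-pq , on-rs) = pq∩rs {x} on-pq on-rs
    rsp≱0 : ¬ 0# ≤ side r s p
    rsp≱0 0≤rsp = meet (segments-meet q r s p 0≤qrs
                       (<-respˡ (side-rotate p q r) (other (<-respˡ (+-comm _ _) sum₁) 0≤rsp))
                       (≤-respʳ (side-rotate r s p) 0≤rsp) spq<0)
      where
      meet : ∃[ x ] (OnSegment q r x × OnSegment s p x) → ⊥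
      meet (x , on-qr , on-sp) = qr∩sp {x} on-qr on-sp

  SameDirection : Pt → Pt → Set _
  SameDirection u v = ∃[ a ] ∃[ b ] (0# < a × 0# < b × a · u ≈ₚ b · v)

  -- The auxiliary vector `w` provides the two factors; their signs later distinguish equal from
  -- opposite directions without dividing.
  cross≈0⇒∥ : ∀ w {u y} → cross u y ≈ 0# → cross w u · y ≈ₚ cross w y · u
  cross≈0⇒∥ w {u} {y} e = ≈ₚ-trans (cramer w y u) (drop , drop)
    where
    drop : ∀ {x z} → cross y u * x + z ≈ z
    drop {x} {z} = begin
      cross y u * x + z  ≈⟨ +-congʳ (*-congʳ (trans (cross-antisym y u) (trans (-‿cong e) ε⁻¹≈ε))) ⟩
      0# * x + z         ≈⟨ +-congʳ (zeroˡ x) ⟩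
      0# + z             ≈⟨ +-identityˡ z ⟩
      z                  ∎

  cross≈0⇒SameDirection : ∀ w {u y} → cross u y ≈ 0# → 0# < cross w u → 0# < cross w y →
                          SameDirection y u
  cross≈0⇒SameDirection w {u} {y} e p q = cross w u , cross w y , p , q , cross≈0⇒∥ w e

  cross≈0⇒≈0 : ∀ w {u y} → cross u y ≈ 0# → cross w y ≈ 0# → ¬ cross w u ≈ 0# → y ≈ₚ 0ₚ
  cross≈0⇒≈0 w {u} {y} uy≈0 wy≈0 wu≉0 = ·-cancel wu≉0 (≈ₚ-trans (cross≈0⇒∥ w uy≈0) (vanish , vanish))
    where
    vanish : ∀ {x} → cross w y * x ≈ 0#
    vanish {x} = trans (*-congʳ wy≈0) (zeroˡ x)

  cross-neg-neg : ∀ u v → cross (-ₚ u) (-ₚ v) ≈ cross u v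
  cross-neg-neg u v = trans (cross-negˡ u (-ₚ v)) (trans (-‿cong (cross-negʳ u v)) (⁻¹-involutive _))

  neg-cross-pos : ∀ u v → cross u v < 0# → 0# < cross v u
  neg-cross-pos u v p = <-respʳ (sym (cross-antisym v u)) (neg-pos p)

  negˡ-cross-pos : ∀ u v → cross u v < 0# → 0# < cross (-ₚ u) v
  negˡ-cross-pos u v p = <-respʳ (sym (cross-negˡ u v)) (neg-pos p)

  module _ {a x y : Pt} (y≉0 : ¬ y ≈ₚ 0ₚ)
           (y≁x : ¬ SameDirection y x) (y≁-a : ¬ SameDirection y (-ₚ a)) where

    -- At a right turn the interior angle is the intersection of two open half-planes, bounded by
    -- the rays along `x` and `-a`. The sign patterns that are neither inside nor strictly to the
    -- left put `y` on one of these rays or make it zero.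
    convex-turn : cross a x < 0# → (cross a y < 0# → cross x y < 0# → ⊥) →
                  LeftOfPath s⟨ a , x ⟩ s⟨ a , y ⟩ s⟨ x , y ⟩
    convex-turn ax<0 inside = go (sign-view (cross a y)) (sign-view (cross x y))
      where
      go : ∀ {σ τ} → HasSign (cross a y) σ → HasSign (cross x y) τ →
           LeftOfPath s⟨ a , x ⟩ s⟨ a , y ⟩ s⟨ x , y ⟩
      go (positive p) _          = inj₁ (sign-≡ (negative ax<0) , inj₁ (sign-≡ (positive p)))
      go (null _) (positive q)     = inj₁ (sign-≡ (negative ax<0) , inj₂ (sign-≡ (positive q)))
      go (negative _) (positive q) = inj₁ (sign-≡ (negative ax<0) , inj₂ (sign-≡ (positive q)))
      go (negative p) (negative q) = ⊥-elim (inside p q)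
      go (null p) (null q)         = ⊥-elim (y≉0 (cross≈0⇒≈0 x p q (>⇒≉ (neg-cross-pos a x ax<0))))
      go (null p) (negative q)     = ⊥-elim (y≁-a (cross≈0⇒SameDirection (-ₚ x)
        (trans (cross-negˡ a y) (neg-≈0 p))
        (<-respʳ (sym (cross-neg-neg x a)) (neg-cross-pos a x ax<0))
        (negˡ-cross-pos x y q)))
      go (negative p) (null q)     = ⊥-elim (y≁x (cross≈0⇒SameDirection (-ₚ a)
        q (negˡ-cross-pos a x ax<0) (negˡ-cross-pos a y p)))

    -- Here z is the diagonal, which runs inside the angle: it cuts the angle into
    -- two convex ones.
    reflex-turn : ∀ z → 0# ≤ cross a x → cross a z < 0# → cross x z < 0# →
                  (cross a y < 0# → cross z y ≤ 0# → ⊥) → (cross x y < 0# → 0# ≤ cross z y → ⊥) →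
                  LeftOfPath s⟨ a , x ⟩ s⟨ a , y ⟩ s⟨ x , y ⟩
    reflex-turn z 0≤ax az<0 xz<0 inside₁ inside₂ =
      go (sign-view (cross z y))
      where
      0<za = neg-cross-pos a z az<0
      0<zx = neg-cross-pos x z xz<0
      -- The Plücker relation arranged so that `cross z x`, `cross z a` and `cross a x` are known to
      -- be nonnegative, the first two positive. Once the side of `z` on which `y` lies is known,
      -- one of ⟨a,y⟩ > 0 and ⟨x,y⟩ > 0 then forces the other.
      relation : ∀ a x y z → cross z x * cross a y ≈ cross a x * cross z y + cross z a * cross x y
      relation (a , a′) (b , b′) (c , c′) (d , d′) =
        solve 8 (λ a a′ b b′ c c′ d d′ → let A = a , a′; X = b , b′; Y = c , c′; Z = d , d′ in
          crossᴾ Z X :* crossᴾ A Y := crossᴾ A X :* crossᴾ Z Y :+ crossᴾ Z A :* crossᴾ X Y)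
          refl a a′ b b′ c c′ d d′

      left : 0# < cross a y → 0# < cross x y → LeftOfPath s⟨ a , x ⟩ s⟨ a , y ⟩ s⟨ x , y ⟩
      left p q = inj₂ (sign-≡ (positive p) , sign-≡ (positive q))

      behind : cross z y ≤ 0# → cross a y ≈ 0# → ⊥
      behind (inj₂ zy≈0) ay≈0 = y≉0 (cross≈0⇒≈0 z ay≈0 zy≈0 (>⇒≉ 0<za))
      behind (inj₁ zy<0) ay≈0 = y≁-a (cross≈0⇒SameDirection (-ₚ z)
        (trans (cross-negˡ a y) (neg-≈0 ay≈0))
        (<-respʳ (sym (cross-neg-neg z a)) 0<za)
        (negˡ-cross-pos z y zy<0))

      0<xy : 0# ≤ - cross z y → 0# < cross a y → 0# < cross x y
      0<xy 0≤-zy 0<ay = pos-factor 0<za (<-respʳ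
        (trans (+-congʳ (relation a x y z))
               (solve 3 (λ s t u → s :* t :+ u :+ s :* (:- t) := u) refl
                 (cross a x) (cross z y) (cross z a * cross x y)))
        (pos+nonneg (*-pos 0<zx 0<ay) (nonneg*nonneg 0≤ax 0≤-zy)))

      0<ay : 0# ≤ cross z y → 0# < cross x y → 0# < cross a y
      0<ay 0≤zy 0<xy = pos-factor 0<zx (<-respʳ
        (trans (+-comm _ _) (sym (relation a x y z)))
        (pos+nonneg (*-pos 0<za 0<xy) (nonneg*nonneg 0≤ax 0≤zy)))

      right-of-z : cross z y ≤ 0# → ∀ {τ} → HasSign (cross a y) τ →
                   LeftOfPath s⟨ a , x ⟩ s⟨ a , y ⟩ s⟨ x , y ⟩
      right-of-z zy≤0 (negative p) = ⊥-elim (inside₁ p zy≤0)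
      right-of-z zy≤0 (null p)     = ⊥-elim (behind zy≤0 p)
      right-of-z zy≤0 (positive p) = left p (0<xy (nonpos⇒nonneg zy≤0) p)

      left-of-z : 0# < cross z y → ∀ {υ} → HasSign (cross x y) υ →
                  LeftOfPath s⟨ a , x ⟩ s⟨ a , y ⟩ s⟨ x , y ⟩
      left-of-z 0<zy (negative p) = ⊥-elim (inside₂ p (inj₁ 0<zy))
      left-of-z 0<zy (null p)     = ⊥-elim (y≁x (cross≈0⇒SameDirection z p 0<zx 0<zy))
      left-of-z 0<zy (positive p) = left (0<ay (inj₁ 0<zy) p) p

      go : ∀ {σ} → HasSign (cross z y) σ → LeftOfPath s⟨ a , x ⟩ s⟨ a , y ⟩ s⟨ x , y ⟩
      go (negative p) = right-of-z (inj₁ p) (sign-view (cross a y))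
      go (null p)     = right-of-z (inj₂ p) (sign-view (cross a y))
      go (positive p) = left-of-z p (sign-view (cross x y))

  -- If `t` were seen from `r` within the interior angle, a point of the segment from `r` to `t`
  -- close to `r` would lie in one of the two triangles of an interior cut, contradicting that the
  -- segment avoids the interior. The last two hypotheses exclude the two sides bounding the angle.
  corner : ∀ p q r s t → ClockwiseQuad p q r s → Disjoint p q r s → Disjoint q r s p →
           (∀ {x} → OnSegment r t x → ¬ InteriorOfQuad p q r s x) →
           ¬ t -ₚ r ≈ₚ 0ₚ → ¬ SameDirection (t -ₚ r) (s -ₚ r) →
           ¬ SameDirection (t -ₚ r) (q -ₚ r) →
           LeftOfPath s⟨ r -ₚ q , s -ₚ r ⟩ s⟨ r -ₚ q , t -ₚ r ⟩ s⟨ s -ₚ r , t -ₚ r ⟩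
  corner p q r s t cw pq∩rs qr∩sp face y≉0 y≁x y≁q-r = go (sign-view (cross a x))
    where
    a = r -ₚ q
    x = s -ₚ r
    y = t -ₚ r
    z = p -ₚ r

    y≁-a : ¬ SameDirection y (-ₚ a)
    y≁-a (m , m′ , 0<m , 0<m′ , e , e′) = y≁q-r (m , m′ , 0<m , 0<m′ ,
      trans e (*-congˡ (sym (proj₁ (swap-difference q r)))) ,
      trans e′ (*-congˡ (sym (proj₂ (swap-difference q r)))))

    qrs≈ax : ∀ q r s → side q r s ≈ cross (r -ₚ q) (s -ₚ r)
    qrs≈ax (q , q′) (r , r′) (s , s′) =
      solve 6 (λ q q′ r r′ s s′ → let Q = q , q′; R = r , r′; S = s , s′ in
        crossᴾ (R -ᴾ Q) (S -ᴾ Q) := crossᴾ (R -ᴾ Q) (S -ᴾ R)) refl q q′ r r′ s s′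

    SmallStep : Carrier → Carrier → Set _
    SmallStep u v = ∃[ h ] (0# < h × h ≤ 1# × u + h * v < 0#)

    step : Carrier → Pt
    step h = r +ₚ h · y

    on-rt : ∀ {h} → 0# < h → h ≤ 1# → OnSegment r t (step h)
    on-rt {h} 0<h h≤1 = h , inj₁ 0<h , h≤1 , refl , refl

    -- Only the side that does not pass through `r` restricts the step length. The conditions for
    -- the two lines through `r` scale with the step and hold for every positive one.
    right-of-diagonal : side p q r < 0# → side r s p < 0# →
                        cross a y < 0# → cross z y ≤ 0# → ⊥
    right-of-diagonal pqr<0 rsp<0 ay<0 zy≤0 = go (small-step (cross (q -ₚ p) y) pqr<0)
      where
      go : SmallStep (side p q r) (cross (q -ₚ p) y) → ⊥
      go (h , 0<h , h≤1 , small) = face {step h} (on-rt 0<h h≤1)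
        (inj₁ (pqr<0 , rsp<0 , inj₁
          ( <-respˡ (sym (side-along p q r h y)) small
          , <-respˡ (sym (side-end q r h y)) (pos*neg 0<h ay<0)
          , ≤-respˡ (sym (side-start r p h y)) (pos*nonpos 0<h zy≤0))))

    left-of-diagonal : side p q r < 0# → side r s p < 0# →
                       cross x y < 0# → 0# ≤ cross z y → ⊥
    left-of-diagonal pqr<0 rsp<0 xy<0 0≤zy = go (small-step (cross (p -ₚ s) y)
        (<-respˡ (side-rotate r s p) rsp<0))
      where
      rpy≤0 : cross (r -ₚ p) y ≤ 0#
      rpy≤0 = ≤-respˡ
        (sym (trans (cross-cong {r -ₚ p} { -ₚ z} {y} {y} (swap-difference r p) (refl , refl))
                    (cross-negˡ z y)))
                (nonneg⇒nonpos 0≤zy)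
      go : SmallStep (side s p r) (cross (p -ₚ s) y) → ⊥
      go (h , 0<h , h≤1 , small) = face {step h} (on-rt 0<h h≤1)
        (inj₁ (pqr<0 , rsp<0 , inj₂
          ( <-respˡ (sym (side-start r s h y)) (pos*neg 0<h xy<0)
          , <-respˡ (sym (side-along s p r h y)) small
          , ≤-respˡ (sym (side-end p r h y)) (pos*nonpos 0<h rpy≤0))))

    between : side q r s < 0# → side s p q < 0# → cross a y < 0# → cross x y < 0# → ⊥
    between qrs<0 spq<0 ay<0 xy<0 = go (small-step (cross (q -ₚ s) y)
        (<-respˡ (trans (side-rotate q r s) (side-rotate r s q)) qrs<0))
      where
      go : SmallStep (side s q r) (cross (q -ₚ s) y) → ⊥
      go (h , 0<h , h≤1 , small) = face {step h} (on-rt 0<h h≤1)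
        (inj₂ (qrs<0 , spq<0 , inj₁
          ( <-respˡ (sym (side-end q r h y)) (pos*neg 0<h ay<0)
          , <-respˡ (sym (side-start r s h y)) (pos*neg 0<h xy<0)
          , inj₁ (<-respˡ (sym (side-along s q r h y)) small))))

    diagonal⇒⊥ : side p q r < 0# → side r s p < 0# → cross a y < 0# → cross x y < 0# → ⊥
    diagonal⇒⊥ pqr<0 rsp<0 ay<0 xy<0 with 0# <? cross z y
    ... | yes 0<zy = left-of-diagonal pqr<0 rsp<0 xy<0 (inj₁ 0<zy)
    ... | no zy≯0  = right-of-diagonal pqr<0 rsp<0 ay<0 (≮⇒≥ zy≯0)

    reflex : 0# ≤ cross a x → LeftOfPath s⟨ a , x ⟩ s⟨ a , y ⟩ s⟨ x , y ⟩
    reflex 0≤ax = go (reflex⇒diagonal p q r s cw pq∩rs qr∩sp (≤-respʳ (sym (qrs≈ax q r s)) 0≤ax))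
      where
      go : side p q r < 0# × side r s p < 0# → LeftOfPath s⟨ a , x ⟩ s⟨ a , y ⟩ s⟨ x , y ⟩
      go (pqr<0 , rsp<0) = reflex-turn {a} {x} {y} y≉0 y≁x y≁-a z 0≤ax
        (<-respˡ (trans (side-rotate p q r) (qrs≈ax q r p)) pqr<0) rsp<0
        (right-of-diagonal pqr<0 rsp<0) (left-of-diagonal pqr<0 rsp<0)

    inside : cross a x < 0# → cross a y < 0# → cross x y < 0# → ⊥
    inside ax<0 ay<0 xy<0 with side s p q <? 0#
    ... | yes spq<0 = between (<-respˡ (sym (qrs≈ax q r s)) ax<0) spq<0 ay<0 xy<0
    ... | no spq≮0  = diagonal⇒⊥ (proj₂ negative-halves) (proj₁ negative-halves) ay<0 xy<0
      where
      negative-halves = reflex⇒diagonal r s p q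
        (<-respˡ (trans (quad-rotate p q r s) (quad-rotate q r s p)) cw)
        (λ {x} on-rs on-pq → pq∩rs {x} on-pq on-rs) (λ {x} on-sp on-qr → qr∩sp {x} on-qr on-sp)
        (≮⇒≥ spq≮0)

    go : ∀ {σ} → HasSign (cross a x) σ → LeftOfPath s⟨ a , x ⟩ s⟨ a , y ⟩ s⟨ x , y ⟩
    go (negative p) = convex-turn {a} {x} {y} y≉0 y≁x y≁-a p (inside p)
    go (null p)     = reflex (inj₂ (sym p))
    go (positive p) = reflex (inj₁ p)

leftOfPath-resp : ∀ {i i′ j j′ k k′} → i ≡ i′ → j ≡ j′ → k ≡ k′ →
                  LeftOfPath i′ j′ k′ → LeftOfPath i j k
leftOfPath-resp ≡.refl ≡.refl ≡.refl p = p

-- From plane vectors to sign patterns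

module Winding {c ℓ₁ ℓ₂} (K : OrderedField c ℓ₁ ℓ₂) where
  open OrderedField K
  open Plane K
  open OrderedFieldProperties K
  open PlaneProperties K
  open IntegerRingSolver commutativeRing

  s-cong : ∀ {u u′ v v′} → u ≈ₚ u′ → v ≈ₚ v′ → s⟨ u , v ⟩ ≡ s⟨ u′ , v′ ⟩
  s-cong {u} {u′} {v} {v′} e d = sign-cong (cross-cong {u} {u′} {v} {v′} e d)

  s-antisym : ∀ u v → s⟨ u , v ⟩ ≡ ℤ.- s⟨ v , u ⟩
  s-antisym u v = ≡.trans (sign-cong (cross-antisym u v)) (sign-neg _)

  s-negˡ : ∀ u v → s⟨ -ₚ u , v ⟩ ≡ ℤ.- s⟨ u , v ⟩
  s-negˡ u v = ≡.trans (sign-cong (cross-negˡ u v)) (sign-neg _)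

  s-negʳ : ∀ u v → s⟨ u , -ₚ v ⟩ ≡ ℤ.- s⟨ u , v ⟩
  s-negʳ u v = ≡.trans (sign-cong (cross-negʳ u v)) (sign-neg _)

  module _ (L : Direction) where
    private l = proj₁ L

    wind≡windOf : ∀ u v {uv ul vl} → s⟨ u , v ⟩ ≡ uv → s⟨ u , l ⟩ ≡ ul → s⟨ v , l ⟩ ≡ vl →
                  wind L u v ≡ windOf uv ul vl
    wind≡windOf u v ≡.refl ≡.refl ≡.refl =
      ≡.cong (λ s → if does (s⟨ u , v ⟩ ℤ.≟ s⟨ u , l ⟩) ∧ does (s⟨ u , l ⟩ ℤ.≟ s)
                    then s⟨ u , v ⟩ else 0ℤ) (s-antisym l v)

    wind-cong : ∀ {u u′ v v′} → u ≈ₚ u′ → v ≈ₚ v′ → wind L u v ≡ wind L u′ v′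
    wind-cong {u} {u′} {v} {v′} e d =
      ≡.trans (wind≡windOf u v (s-cong {u} {u′} {v} {v′} e d)
                 (s-cong {u} {u′} {l} {l} e (refl , refl)) (s-cong {v} {v′} {l} {l} d (refl , refl)))
              (≡.sym (wind≡windOf u′ v′ ≡.refl ≡.refl ≡.refl))

    -- `NonnegativesVanish` only controls nonnegative terms, so the Plücker relation is used
    -- together with its negative, which controls nonpositive ones.
    signs-consistent : ∀ a x y →
      let ax = s⟨ a , x ⟩; ay = s⟨ a , y ⟩; xy = s⟨ x , y ⟩
          al = s⟨ a , l ⟩; xl = s⟨ x , l ⟩; yl = s⟨ y , l ⟩
      in NonnegativesVanish (ax ℤ.* yl) (ℤ.- (ay ℤ.* xl)) (al ℤ.* xy)
       × NonnegativesVanish (ℤ.- (ax ℤ.* yl)) (ay ℤ.* xl) (ℤ.- (al ℤ.* xy))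
    signs-consistent a x y =
        resp (sign-* _ _) (neg (sign-* _ _)) (sign-* _ _)
             (zero-sum-signs (plücker a x y l))
      , resp (neg (sign-* _ _)) (sign-* _ _) (neg (sign-* _ _))
             (zero-sum-signs (trans
               (solve 3 (λ u v w → :- u :+ v :+ :- w := :- (u :+ :- v :+ w)) refl
                  (cross a x * cross y l) (cross a y * cross x l) (cross a l * cross x y))
               (trans (-‿cong (plücker a x y l)) (solve 0 (:- con 0ℤ := con 0ℤ) refl))))
      where
      neg : ∀ {x s} → sign x ≡ s → sign (- x) ≡ ℤ.- s
      neg e = ≡.trans (sign-neg _) (≡.cong ℤ.-_ e)
      resp : ∀ {u u′ v v′ w w′} → u ≡ u′ → v ≡ v′ → w ≡ w′ →
             NonnegativesVanish u v w → NonnegativesVanish u′ v′ w′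
      resp ≡.refl ≡.refl ≡.refl p = p

    parities : ∀ a x y → ¬ cross a l ≈ 0# → ¬ cross x l ≈ 0# → ¬ cross y l ≈ 0# →
               LeftOfPath s⟨ a , x ⟩ s⟨ a , y ⟩ s⟨ x , y ⟩ →
               WindParities s⟨ a , x ⟩ s⟨ a , y ⟩ s⟨ x , y ⟩ s⟨ a , l ⟩ s⟨ x , l ⟩ s⟨ y , l ⟩
    parities a x y al≉0 xl≉0 yl≉0 left =
      windClaim (sign∈signs _) (sign∈signs _) (sign∈signs _)
                   (sign∈signs _) (sign∈signs _) (sign∈signs _)
        (λ e → al≉0 (sign≡0 e)) (λ e → xl≉0 (sign≡0 e))
        (λ e → yl≉0 (sign≡0 e)) left
        (proj₁ (signs-consistent a x y)) (proj₂ (signs-consistent a x y))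

    wind-parity-in : ∀ a x y → ¬ cross a l ≈ 0# → ¬ cross x l ≈ 0# → ¬ cross y l ≈ 0# →
      LeftOfPath s⟨ a , x ⟩ s⟨ a , y ⟩ s⟨ x , y ⟩ →
      + 2 ℤ.∣ wind L a x ℤ.+ wind L a y ℤ.+ wind L (-ₚ x) y ℤ.+ γ₂ L x ℤ.+ 1ℤ
    wind-parity-in a x y al≉0 xl≉0 yl≉0 left = ≡.subst (λ z → + 2 ℤ.∣ z ℤ.+ γ₂ L x ℤ.+ 1ℤ)
      (≡.sym (≡.cong₂ ℤ._+_ (≡.cong₂ ℤ._+_
        (wind≡windOf a x ≡.refl ≡.refl ≡.refl)
        (wind≡windOf a y ≡.refl ≡.refl ≡.refl))
        (wind≡windOf (-ₚ x) y (s-negˡ x y) (s-negˡ x l) ≡.refl)))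
      (proj₁ (parities a x y al≉0 xl≉0 yl≉0 left))

    -- The path leaves against the edge `b`, so the sign pattern is that of `x` = `-ₚ b`, and the
    -- signs of `b` are rewritten as negated signs of `-ₚ b`.
    wind-parity-out : ∀ a b y → ¬ cross a l ≈ 0# → ¬ cross b l ≈ 0# → ¬ cross y l ≈ 0# →
      LeftOfPath s⟨ a , -ₚ b ⟩ s⟨ a , y ⟩ s⟨ -ₚ b , y ⟩ →
      + 2 ℤ.∣ wind L b (-ₚ a) ℤ.+ wind L b y ℤ.+ wind L a y ℤ.+ γ₂ L a ℤ.+ 1ℤ
    wind-parity-out a b y al≉0 bl≉0 yl≉0 left = ≡.subst (λ z → + 2 ℤ.∣ z ℤ.+ γ₂ L a ℤ.+ 1ℤ)
      (≡.sym (≡.cong₂ ℤ._+_ (≡.cong₂ ℤ._+_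
        (wind≡windOf b (-ₚ a) (≡.trans (s-negʳ b a) (≡.cong ℤ.-_
             (≡.trans (s-antisym b a) (≡.sym (s-negʳ a b)))))
           b-sign (s-negˡ a l))
        (wind≡windOf b y (minus-minus (s-negˡ b y)) b-sign ≡.refl))
        (wind≡windOf a y ≡.refl ≡.refl ≡.refl)))
      (proj₂ (parities a (-ₚ b) y al≉0
        (λ e → bl≉0 (trans (solve 1 (λ x → x := :- :- x) refl _)
                   (trans (-‿cong (trans (sym (cross-negˡ b l)) e)) (solve 0 (:- con 0ℤ := con 0ℤ) refl))))
        yl≉0 left))
      where
      minus-minus : ∀ {i j} → i ≡ ℤ.- j → j ≡ ℤ.- i
      minus-minus {j = j} e = ≡.trans (≡.sym (ℤ.neg-involutive j)) (≡.cong ℤ.-_ (≡.sym e))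
      b-sign : s⟨ b , l ⟩ ≡ ℤ.- s⟨ -ₚ b , l ⟩
      b-sign = minus-minus (s-negˡ b l)

-- Parity of crossings with a gauge ray

module _ {a p q} {A : Set a} {P : Pred A p} {Q : Pred A q} (P? : Decidable P) (Q? : Decidable Q) where
  count-cong : (∀ x → does (P? x) ≡ does (Q? x)) →
               ∀ {n} (xs : Vec A n) → Vec.count P? xs ≡ Vec.count Q? xs
  count-cong e []       = ≡.refl
  count-cong e (x ∷ xs) with does (P? x) | does (Q? x) | e x
  ... | true  | _ | ≡.refl = ≡.cong suc (count-cong e xs)
  ... | false | _ | ≡.refl = count-cong e xs

module RayCrossing {c ℓ₁ ℓ₂} (K : OrderedField c ℓ₁ ℓ₂) where
  open OrderedField K
  open Plane K
  open OrderedFieldProperties K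
  open PlaneProperties K
  open Corner K
  open IntegerRingSolver commutativeRing
  open import Relation.Binary.Reasoning.Setoid setoid

  -- Modulo 2, counting is additive on symmetric differences: an element satisfying both `Q` and `R`
  -- contributes two factors -1, which cancel.
  [-1]^count-xor : ∀ {a p q r} {A : Set a} {P : Pred A p} {Q : Pred A q} {R : Pred A r}
    (P? : Decidable P) (Q? : Decidable Q) (R? : Decidable R) →
    (∀ x → does (P? x) ≡ does (Q? x) xor does (R? x)) → ∀ {n} (xs : Vec A n) →
    [-1]^ (+ Vec.count P? xs) ≈ [-1]^ (+ Vec.count Q? xs) * [-1]^ (+ Vec.count R? xs)
  [-1]^count-xor P? Q? R? e []       = sym (*-identityʳ 1#)
  [-1]^count-xor P? Q? R? e (x ∷ xs)
    with does (P? x) | does (Q? x) | does (R? x) | e x | [-1]^count-xor P? Q? R? e xs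
  ... | _ | false | false | ≡.refl | ih = ih
  ... | _ | false | true  | ≡.refl | ih = trans (*-congˡ ih)
        (solve 3 (λ m a b → m :* (a :* b) := a :* (m :* b)) refl (- 1#) _ _)
  ... | _ | true  | false | ≡.refl | ih = trans (*-congˡ ih) (sym (*-assoc (- 1#) _ _))
  ... | _ | true  | true  | ≡.refl | ih = trans ih
        (solve 2 (λ a b → a :* b := (con -1ℤ :* a) :* (con -1ℤ :* b)) refl _ _)

  combination-pos : ∀ {s u v} → 0# ≤ s → s ≤ 1# → 0# < u → 0# < v → 0# < (1# - s) * u + s * v
  combination-pos {s} {u} {v} 0≤s (inj₁ s<1) 0<u 0<v =
    pos+nonneg (*-pos (<-respˡ (-‿inverseʳ s) (+-monoˡ-< (- s) s<1)) 0<u)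
               (nonneg*nonneg 0≤s (inj₁ 0<v))
  combination-pos {s} {u} {v} 0≤s (inj₂ s≈1) 0<u 0<v = <-respʳ
    (sym (trans (+-cong (*-congʳ (trans (+-congˡ (-‿cong s≈1)) (-‿inverseʳ 1#))) (*-congʳ s≈1))
                (solve 2 (λ u v → con 0ℤ :* u :+ con 1ℤ :* v := v) refl u v))) 0<v

  combination-neg : ∀ {s u v} → 0# ≤ s → s ≤ 1# → u < 0# → v < 0# → (1# - s) * u + s * v < 0#
  combination-neg {s} {u} {v} 0≤s s≤1 u<0 v<0 = neg-pos⁻¹ (<-respʳ
    (solve 3 (λ s u v → (con 1ℤ :- s) :* (:- u) :+ s :* (:- v) := :- ((con 1ℤ :- s) :* u :+ s :* v)) refl s u v)
    (combination-pos 0≤s s≤1 (neg-pos u<0) (neg-pos v<0)))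

  cross-combination : ∀ l b p q s →
    cross l (p +ₚ s · (q -ₚ p) -ₚ b) ≈ (1# - s) * cross l (p -ₚ b) + s * cross l (q -ₚ b)
  cross-combination (l , l′) (b , b′) (p , p′) (q , q′) s =
    solve 9 (λ l l′ b b′ p p′ q q′ s → let L = l , l′; B = b , b′; P = p , p′; Q = q , q′ in
      crossᴾ L (P +ᴾ s ·ᴾ (Q -ᴾ P) -ᴾ B)
      := (con 1ℤ :- s) :* crossᴾ L (P -ᴾ B) :+ s :* crossᴾ L (Q -ᴾ B)) refl l l′ b b′ p p′ q q′ s

  RayMeetsSegment-reverse : ∀ b L p q → RayMeetsSegment b L p q → RayMeetsSegment b L q p
  RayMeetsSegment-reverse b L p q (x , on-ray , on-pq) = x , on-ray , OnSegment-reverse {p} {q} {x} on-pq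

  module _ (o τ : Pt) (m : Carrier) (L : Direction) where
    private
      l = proj₁ L
      b = o +ₚ m · τ

      Inside : Pt → Set ℓ₂
      Inside = RightOf o (o +ₚ τ)

      -- The base point may slide along the boundary line, so membership in the disk can be tested
      -- from the starting point of the ray.
      inside≈ : ∀ o τ m x → side o (o +ₚ τ) x ≈ cross τ (x -ₚ (o +ₚ m · τ))
      inside≈ (o , o′) (τ , τ′) m (x , x′) =
        solve 7 (λ o o′ τ τ′ m x x′ → let O = o , o′; T = τ , τ′; X = x , x′ in
          crossᴾ (O +ᴾ T -ᴾ O) (X -ᴾ O) := crossᴾ T (X -ᴾ (O +ᴾ m ·ᴾ T))) refl o o′ τ τ′ m x x′

      inside⇒ : ∀ x → Inside x → cross τ (x -ₚ b) < 0#
      inside⇒ x p = <-respˡ (inside≈ o τ m x) p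

    height : Pt → Carrier
    height x = cross l (x -ₚ b)

    module _ (rays-inside : ∀ {x} → OnRay b L x → Inside x) where
      private
        τl<0 : cross τ l < 0#
        τl<0 = <-respˡ (cross-cong {τ} {τ} {b +ₚ 1# · l -ₚ b} {l} (refl , refl) (eq , eq))
                 (inside⇒ (b +ₚ 1# · l) (rays-inside {b +ₚ 1# · l} (1# , 0<1 , refl , refl)))
          where
          eq : ∀ {b l} → b + 1# * l - b ≈ l
          eq {b} {l} = solve 2 (λ b l → b :+ con 1ℤ :* l :- b := l) refl b l

      -- Height zero gives only the full line of the ray. Both `l` and `x -ₚ b` point into the disk,
      -- so their ratio `t`, read off transversally to the boundary, is positive; the backward half
      -- of the line does not enter the disk.
      height≈0⇒OnRay : ∀ x → Inside x → height x ≈ 0# → OnRay b L x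
      height≈0⇒OnRay x x-inside h≈0 = t , *-pos 0<y (⁻¹-pos 0<u) , eq (proj₁ ∥) , eq (proj₂ ∥)
        where
        0<u : 0# < cross (-ₚ τ) l
        0<u = negˡ-cross-pos τ l τl<0
        0<y : 0# < cross (-ₚ τ) (x -ₚ b)
        0<y = negˡ-cross-pos τ (x -ₚ b) (inside⇒ x x-inside)
        t = cross (-ₚ τ) (x -ₚ b) * cross (-ₚ τ) l ⁻¹
        ∥ : cross (-ₚ τ) l · (x -ₚ b) ≈ₚ cross (-ₚ τ) (x -ₚ b) · l
        ∥ = cross≈0⇒∥ (-ₚ τ) {l} {x -ₚ b} h≈0
        i = cross (-ₚ τ) l ⁻¹
        eq : ∀ {x₀ b₀ l₀} → cross (-ₚ τ) l * (x₀ - b₀) ≈ cross (-ₚ τ) (x -ₚ b) * l₀ →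
             x₀ ≈ b₀ + t * l₀
        eq {x₀} {b₀} {l₀} e = begin
          x₀                                          ≈⟨ solve 2 (λ x b → x := b :+ con 1ℤ :* (x :- b)) refl x₀ b₀ ⟩
          b₀ + 1# * (x₀ - b₀)                         ≈⟨ +-congˡ (*-congʳ (*-inverseˡ (>⇒≉ 0<u))) ⟨
          b₀ + i * cross (-ₚ τ) l * (x₀ - b₀)         ≈⟨ +-congˡ (*-assoc _ _ _) ⟩
          b₀ + i * (cross (-ₚ τ) l * (x₀ - b₀))       ≈⟨ +-congˡ (*-congˡ e) ⟩
          b₀ + i * (cross (-ₚ τ) (x -ₚ b) * l₀)       ≈⟨ solve 4 (λ b i y l → b :+ i :* (y :* l) := b :+ y :* i :* l)
                                                          refl b₀ i (cross (-ₚ τ) (x -ₚ b)) l₀ ⟩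
          b₀ + t * l₀                                 ∎

      OnRay⇒height≈0 : ∀ {x} → OnRay b L x → height x ≈ 0#
      OnRay⇒height≈0 {x} (t , _ , e) = trans
        (cross-cong {l} {l} {x -ₚ b} {t · l} (refl , refl) (eq (proj₁ e) , eq (proj₂ e)))
        (self l)
        where
        eq : ∀ {x b y} → x ≈ b + y → x - b ≈ y
        eq {x} {b} {y} e = trans (+-congʳ e) (solve 2 (λ b y → b :+ y :- b := y) refl b y)
        self : ∀ l → cross l (t · l) ≈ 0#
        self (l , l′) = solve 3 (λ l l′ t → crossᴾ (l , l′) (t ·ᴾ (l , l′)) := con 0ℤ) refl l l′ t

      height-pos : ∀ x → Inside x → ¬ OnRay b L x → ¬ height x < 0# → 0# < height x
      height-pos x x-inside x∉ray h≮0 with ≮⇒≥ h≮0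
      ... | inj₁ 0<h = 0<h
      ... | inj₂ 0≈h = ⊥-elim (x∉ray (height≈0⇒OnRay x x-inside (sym 0≈h)))

      module _ (p q : Pt) (p-inside : Inside p) (q-inside : Inside q)
               (p∉ray : ¬ OnRay b L p) (q∉ray : ¬ OnRay b L q) where
        private
          -- The affine height vanishes at the parameter `s`. The half-plane is convex, so this zero
          -- lies inside the disk and hence on the ray itself.
          opposite⇒meets : ∀ {p q} → Inside p → Inside q → height p < 0# → 0# < height q →
                           RayMeetsSegment b L p q
          opposite⇒meets {p} {q} p-inside q-inside hp<0 0<hq =
            x , height≈0⇒OnRay x x-inside hx≈0 , (s , proj₁ bounds , proj₂ bounds , refl , refl)
            where
            d = - height p + height q
            0<d : 0# < d
            0<d = pos+pos (neg-pos hp<0) 0<hq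
            s = - height p * d ⁻¹
            x = p +ₚ s · (q -ₚ p)
            bounds = ratio∈[0,1] (inj₁ (neg-pos hp<0)) (inj₁ 0<hq) refl 0<d
            x-inside : Inside x
            x-inside = <-respˡ (sym (cross-combination (o +ₚ τ -ₚ o) o p q s))
              (combination-neg (proj₁ bounds) (proj₂ bounds) p-inside q-inside)
            hx≈0 : height x ≈ 0#
            hx≈0 = begin
              height x                                      ≈⟨ cross-combination l b p q s ⟩
              (1# - s) * height p + s * height q            ≈⟨ solve 3 (λ u v i →
                                                                 (con 1ℤ :- (:- u) :* i) :* u :+ (:- u) :* i :* v
                                                                 := u :+ (:- u) :* ((:- u :+ v) :* i))
                                                                 refl (height p) (height q) (d ⁻¹) ⟩
              height p + - height p * (d * d ⁻¹)            ≈⟨ +-congˡ (*-congˡ (*-inverseʳ (>⇒≉ 0<d))) ⟩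
              height p + - height p * 1#                    ≈⟨ solve 1 (λ u → u :+ (:- u) :* con 1ℤ := con 0ℤ) refl (height p) ⟩
              0#                                            ∎

          meets⇒combination≈0 : RayMeetsSegment b L p q →
            ∃[ s ] (0# ≤ s × s ≤ 1# × (1# - s) * height p + s * height q ≈ 0#)
          meets⇒combination≈0 (x , on-ray , s , 0≤s , s≤1 , e) = s , 0≤s , s≤1 , (begin
            (1# - s) * height p + s * height q       ≈⟨ cross-combination l b p q s ⟨
            cross l (p +ₚ s · (q -ₚ p) -ₚ b)         ≈⟨ cross-cong {l} {l} {x -ₚ b} {p +ₚ s · (q -ₚ p) -ₚ b} (refl , refl)
                                                          (+-congʳ (proj₁ e) , +-congʳ (proj₂ e)) ⟨
            height x                                 ≈⟨ OnRay⇒height≈0 {x} on-ray ⟩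
            0#                                       ∎)

        -- The decisions are arguments, so that matching on them evaluates `does` for whichever
        -- decision procedures the counting uses.
        Crosses : Dec (height p < 0#) → Dec (height q < 0#) → Dec (RayMeetsSegment b L p q) → Set
        Crosses p? q? m? = does m? ≡ does p? xor does q?

        crosses : ∀ p? q? m? → Crosses p? q? m?
        crosses (yes hp<0) (yes hq<0) m? = dec-false m? λ meets → same (meets⇒combination≈0 meets)
          where
          same : ¬ (∃[ s ] (0# ≤ s × s ≤ 1# × (1# - s) * height p + s * height q ≈ 0#))
          same (s , 0≤s , s≤1 , e) = <⇒≉ (combination-neg 0≤s s≤1 hp<0 hq<0) e
        crosses (no hp≮0) (no hq≮0) m? = dec-false m? λ meets → same (meets⇒combination≈0 meets)
          where
          same : ¬ (∃[ s ] (0# ≤ s × s ≤ 1# × (1# - s) * height p + s * height q ≈ 0#))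
          same (s , 0≤s , s≤1 , e) = >⇒≉
            (combination-pos 0≤s s≤1 (height-pos p p-inside p∉ray hp≮0)
                                     (height-pos q q-inside q∉ray hq≮0)) e
        crosses (yes hp<0) (no hq≮0) m? = dec-true m?
          (opposite⇒meets p-inside q-inside hp<0 (height-pos q q-inside q∉ray hq≮0))
        crosses (no hp≮0) (yes hq<0) m? = dec-true m?
          (RayMeetsSegment-reverse b L q p
            (opposite⇒meets q-inside p-inside hq<0 (height-pos p p-inside p∉ray hp≮0)))

-- Elimination in a module

module LinearElimination {c ℓ m ℓm} {R : CommutativeRing c ℓ} (V : Module R m ℓm) where
  open CommutativeRing R
  open Module V
  open import Algebra.Properties.CommutativeSemigroup
    (CommutativeMonoid.commutativeSemigroup +ᴹ-commutativeMonoid) using (xy∙z≈xz∙y)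
  open import Relation.Binary.Reasoning.Setoid ≈ᴹ-setoid

  -- Solving for a multiple of `h` with the multipliers given in advance replaces a division by `v`
  -- with two scalar identities.
  eliminate-second : ∀ {f g h x y u v w} →
                     f ≈ᴹ u *ₗ g +ᴹ v *ₗ h → x * u + y ≈ 0# → x * v ≈ w →
                     w *ₗ h ≈ᴹ x *ₗ f +ᴹ y *ₗ g
  eliminate-second {f} {g} {h} {x} {y} {u} {v} {w} f≈ xu+y≈0 xv≈w = ≈ᴹ-sym (begin
    x *ₗ f +ᴹ y *ₗ g                                ≈⟨ +ᴹ-congʳ (*ₗ-congˡ f≈) ⟩
    x *ₗ (u *ₗ g +ᴹ v *ₗ h) +ᴹ y *ₗ g               ≈⟨ +ᴹ-congʳ (*ₗ-distribˡ x _ _) ⟩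
    x *ₗ u *ₗ g +ᴹ x *ₗ v *ₗ h +ᴹ y *ₗ g            ≈⟨ xy∙z≈xz∙y _ _ _ ⟩
    x *ₗ u *ₗ g +ᴹ y *ₗ g +ᴹ x *ₗ v *ₗ h            ≈⟨ +ᴹ-cong (+ᴹ-congʳ (*ₗ-assoc x u g)) (*ₗ-assoc x v h) ⟨
    (x * u) *ₗ g +ᴹ y *ₗ g +ᴹ (x * v) *ₗ h          ≈⟨ +ᴹ-congʳ (*ₗ-distribʳ g (x * u) y) ⟨
    (x * u + y) *ₗ g +ᴹ (x * v) *ₗ h                ≈⟨ +ᴹ-cong (*ₗ-congʳ xu+y≈0) (*ₗ-congʳ xv≈w) ⟩
    0# *ₗ g +ᴹ w *ₗ h                               ≈⟨ +ᴹ-congʳ (*ₗ-zeroˡ g) ⟩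
    0ᴹ +ᴹ w *ₗ h                                    ≈⟨ +ᴹ-identityˡ _ ⟩
    w *ₗ h                                          ∎)

  -- The term in `h` must become a multiple of `k`. Stating the last hypothesis after multiplication
  -- by `w` avoids inverting `w`, a product of signs and a weight.
  substitute-first : ∀ {f g h k g′ x y u v w x′ y′} →
    f ≈ᴹ u *ₗ g +ᴹ v *ₗ h → k ≈ᴹ w *ₗ h → g ≈ᴹ x *ₗ g′ +ᴹ y *ₗ k → u * x ≈ x′ → u * y * w + v ≈ y′ * w →
    f ≈ᴹ x′ *ₗ g′ +ᴹ y′ *ₗ k
  substitute-first {f} {g} {h} {k} {g′} {x} {y} {u} {v} {w} {x′} {y′} f≈ k≈ g≈ ux≈x′ uyw+v≈y′w = begin
    f                                                     ≈⟨ f≈ ⟩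
    u *ₗ g +ᴹ v *ₗ h                                      ≈⟨ +ᴹ-congʳ (*ₗ-congˡ g≈) ⟩
    u *ₗ (x *ₗ g′ +ᴹ y *ₗ k) +ᴹ v *ₗ h                    ≈⟨ +ᴹ-congʳ (*ₗ-distribˡ u _ _) ⟩
    u *ₗ x *ₗ g′ +ᴹ u *ₗ y *ₗ k +ᴹ v *ₗ h                 ≈⟨ +ᴹ-congʳ (+ᴹ-congˡ (*ₗ-congˡ (*ₗ-congˡ k≈))) ⟩
    u *ₗ x *ₗ g′ +ᴹ u *ₗ y *ₗ w *ₗ h +ᴹ v *ₗ h
      ≈⟨ +ᴹ-congʳ (+ᴹ-congˡ (≈ᴹ-trans (*ₗ-assoc (u * y) w h) (*ₗ-assoc u y _))) ⟨
    u *ₗ x *ₗ g′ +ᴹ (u * y * w) *ₗ h +ᴹ v *ₗ h            ≈⟨ +ᴹ-assoc _ _ _ ⟩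
    u *ₗ x *ₗ g′ +ᴹ ((u * y * w) *ₗ h +ᴹ v *ₗ h)
      ≈⟨ +ᴹ-cong (*ₗ-assoc u x g′) (*ₗ-distribʳ h (u * y * w) v) ⟨
    (u * x) *ₗ g′ +ᴹ (u * y * w + v) *ₗ h                 ≈⟨ +ᴹ-cong (*ₗ-congʳ ux≈x′) (*ₗ-congʳ uyw+v≈y′w) ⟩
    x′ *ₗ g′ +ᴹ (y′ * w) *ₗ h
      ≈⟨ +ᴹ-congˡ (≈ᴹ-trans (*ₗ-assoc y′ w h) (*ₗ-congˡ (≈ᴹ-sym k≈))) ⟩
    x′ *ₗ g′ +ᴹ y′ *ₗ k                                   ∎

  proportional : ∀ {f g h x u v} → f ≈ᴹ u *ₗ h → g ≈ᴹ v *ₗ h → u ≈ x * v → f ≈ᴹ x *ₗ g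
  proportional {h = h} {x} {v = v} f≈ g≈ u≈xv = ≈ᴹ-trans f≈ (≈ᴹ-trans (*ₗ-congʳ u≈xv)
    (≈ᴹ-trans (*ₗ-assoc x v h) (*ₗ-congˡ (≈ᴹ-sym g≈))))

-- Scalar identities behind the formulas

module SquareScalars {c ℓ₁ ℓ₂} (K : OrderedField c ℓ₁ ℓ₂) where
  open OrderedField K
  open OrderedFieldProperties K
  open IntegerRingSolver commutativeRing
  open import Relation.Binary.Reasoning.Setoid setoid

  IsUnitSign : Carrier → Set ℓ₁
  IsUnitSign x = x * x ≈ 1#

  drop-1 : ∀ {x u} → u ≈ 1# → x * u ≈ x
  drop-1 {x} u≈1 = trans (*-congˡ u≈1) (*-identityʳ x)

  -- pᵢ stands for (-1)^int(hᵢ), γ for (-1)^γ₂(h₄); u, v, w for the winding signs of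
  -- (h₃,h₄), (h₃,e₄), (-h₄,e₄), and u′, v′, w′ for those of (h₂,-h₄), (h₂,e₃), (h₄,e₃).
  module Relations {p₁ p₂ p₃ p₄ u v w u′ v′ w′ γ : Carrier}
    (p₁² : IsUnitSign p₁) (p₃² : IsUnitSign p₃) (p₄² : IsUnitSign p₄)
    (u² : IsUnitSign u) (v² : IsUnitSign v) (w² : IsUnitSign w) (v′² : IsUnitSign v′)
    (p-even : p₁ * p₂ * p₃ * p₄ ≈ 1#)
    (at-C : u * v * w * γ * - 1# ≈ 1#)
    (at-D : u′ * v′ * w′ * γ * - 1# ≈ 1#)
    {α₁ α₂ α₃ α₄ : Carrier}
    (α₁≉0 : ¬ α₁ ≈ 0#) (α₃≉0 : ¬ α₃ ≈ 0#) (α₄≉0 : ¬ α₄ ≈ 0#)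
    (α̃₂≉0 : ¬ α₂ + α₁ * α₃ * α₄ ≈ 0#)
    where

    private
      α̃₂ α̃₃ α̃₄ ρ₃ : Carrier
      α̃₂ = α₂ + α₁ * α₃ * α₄
      α̃₃ = α₂ * α₃ * α̃₂ ⁻¹
      α̃₄ = α₁ * α₃ * α̃₂ ⁻¹
      ρ₃ = p₃ * p₄ * γ * u * - 1#

    F̃₄-from-F₄ : α̃₄ * α₃ ⁻¹ * ρ₃ * (p₃ * u * α₃) + α̃₄ * (p₄ * γ) ≈ 0#
    F̃₄-from-F₄ = begin
      α̃₄ * α₃ ⁻¹ * ρ₃ * (p₃ * u * α₃) + α̃₄ * (p₄ * γ)
        ≈⟨ +-congʳ (solve 7 (λ α̃ a i p q γ u →
             α̃ :* i :* (p :* q :* γ :* u :* con -1ℤ) :* (p :* u :* a)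
             := (:- (α̃ :* (q :* γ))) :* (p :* p) :* (u :* u) :* (a :* i)) refl α̃₄ α₃ (α₃ ⁻¹) p₃ p₄ γ u) ⟩
      - (α̃₄ * (p₄ * γ)) * (p₃ * p₃) * (u * u) * (α₃ * α₃ ⁻¹) + α̃₄ * (p₄ * γ)
        ≈⟨ +-congʳ (trans (drop-1 (*-inverseʳ α₃≉0)) (trans (drop-1 u²) (drop-1 p₃²))) ⟩
      - (α̃₄ * (p₄ * γ)) + α̃₄ * (p₄ * γ)
        ≈⟨ -‿inverseˡ _ ⟩
      0# ∎

    -- Inserting `w * w` completes the product of `at-C`; this absorbs `u`, `v` and `γ` and leaves
    -- the winding sign of the reversed edge.
    F̃₄-from-E₄ : α̃₄ * α₃ ⁻¹ * ρ₃ * (p₃ * v * α₃) ≈ p₄ * w * α̃₄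
    F̃₄-from-E₄ = begin
      α̃₄ * α₃ ⁻¹ * ρ₃ * (p₃ * v * α₃)
        ≈⟨ drop-1 w² ⟨
      α̃₄ * α₃ ⁻¹ * ρ₃ * (p₃ * v * α₃) * (w * w)
        ≈⟨ solve 9 (λ α̃ a i p q γ u v w →
             α̃ :* i :* (p :* q :* γ :* u :* con -1ℤ) :* (p :* v :* a) :* (w :* w)
             := q :* w :* α̃ :* (u :* v :* w :* γ :* con -1ℤ) :* (p :* p) :* (a :* i))
             refl α̃₄ α₃ (α₃ ⁻¹) p₃ p₄ γ u v w ⟩
      p₄ * w * α̃₄ * (u * v * w * γ * - 1#) * (p₃ * p₃) * (α₃ * α₃ ⁻¹)
        ≈⟨ trans (drop-1 (*-inverseʳ α₃≉0)) (trans (drop-1 p₃²) (drop-1 at-C)) ⟩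
      p₄ * w * α̃₄ ∎

    -- Inserting `p₁ * p₁` completes `p-even`, which trades the intersection signs of h₂, h₃ and h₄
    -- for that of h₁.
    F̃₂-from-F₃ : p₂ * u′ * α̃₂ * (α̃₄ * α₃ ⁻¹ * ρ₃) ≈ α₁ * (p₁ * γ * u′ * u * - 1#)
    F̃₂-from-F₃ = begin
      p₂ * u′ * α̃₂ * (α̃₄ * α₃ ⁻¹ * ρ₃)
        ≈⟨ drop-1 p₁² ⟨
      p₂ * u′ * α̃₂ * (α̃₄ * α₃ ⁻¹ * ρ₃) * (p₁ * p₁)
        ≈⟨ solve 12 (λ a x i b j p₁ p₂ p₃ p₄ γ u u′ →
             p₂ :* u′ :* x :* (a :* b :* i :* j :* (p₃ :* p₄ :* γ :* u :* con -1ℤ)) :* (p₁ :* p₁)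
             := a :* (p₁ :* γ :* u′ :* u :* con -1ℤ) :* (p₁ :* p₂ :* p₃ :* p₄) :* (x :* i) :* (b :* j))
             refl α₁ α̃₂ (α̃₂ ⁻¹) α₃ (α₃ ⁻¹) p₁ p₂ p₃ p₄ γ u u′ ⟩
      α₁ * (p₁ * γ * u′ * u * - 1#) * (p₁ * p₂ * p₃ * p₄) * (α̃₂ * α̃₂ ⁻¹) * (α₃ * α₃ ⁻¹)
        ≈⟨ trans (drop-1 (*-inverseʳ α₃≉0)) (trans (drop-1 (*-inverseʳ α̃₂≉0)) (drop-1 p-even)) ⟩
      α₁ * (p₁ * γ * u′ * u * - 1#) ∎

    -- The weight `α̃₂` is made for this: by `at-D` the path through -h₄ contributes minus the
    -- α₁α₃α₄ part of the direct term, and only α₂ remains.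
    F̃₂-from-F₄ : p₂ * u′ * α̃₂ * (α̃₄ * (p₄ * γ)) * (p₄ * w′ * α₄) + p₂ * v′ * α̃₂ ≈
                 α₂ * α₄ ⁻¹ * (- 1# * p₂ * p₄ * γ * u′) * (p₄ * w′ * α₄)
    F̃₂-from-F₄ = begin
      p₂ * u′ * α̃₂ * (α̃₄ * (p₄ * γ)) * (p₄ * w′ * α₄) + p₂ * v′ * α̃₂
        ≈⟨ +-congʳ left ⟩
      - (p₂ * v′ * (α₁ * α₃ * α₄)) + p₂ * v′ * α̃₂
        ≈⟨ solve 4 (λ p v x y → :- (p :* v :* x) :+ p :* v :* (y :+ x) := y :* p :* v) refl p₂ v′ (α₁ * α₃ * α₄) α₂ ⟩
      α₂ * p₂ * v′
        ≈⟨ right ⟨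
      α₂ * α₄ ⁻¹ * (- 1# * p₂ * p₄ * γ * u′) * (p₄ * w′ * α₄) ∎
      where
      left : p₂ * u′ * α̃₂ * (α̃₄ * (p₄ * γ)) * (p₄ * w′ * α₄) ≈ - (p₂ * v′ * (α₁ * α₃ * α₄))
      left = begin
        p₂ * u′ * α̃₂ * (α̃₄ * (p₄ * γ)) * (p₄ * w′ * α₄)
          ≈⟨ drop-1 v′² ⟨
        p₂ * u′ * α̃₂ * (α̃₄ * (p₄ * γ)) * (p₄ * w′ * α₄) * (v′ * v′)
          ≈⟨ solve 10 (λ p q u v w γ a x i b →
               p :* u :* x :* (a :* i :* (q :* γ)) :* (q :* w :* b) :* (v :* v)
               := (:- (p :* v :* (a :* b))) :* (u :* v :* w :* γ :* con -1ℤ) :* (x :* i) :* (q :* q))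
               refl p₂ p₄ u′ v′ w′ γ (α₁ * α₃) α̃₂ (α̃₂ ⁻¹) α₄ ⟩
        - (p₂ * v′ * (α₁ * α₃ * α₄)) * (u′ * v′ * w′ * γ * - 1#) * (α̃₂ * α̃₂ ⁻¹) * (p₄ * p₄)
          ≈⟨ trans (drop-1 p₄²) (trans (drop-1 (*-inverseʳ α̃₂≉0)) (drop-1 at-D)) ⟩
        - (p₂ * v′ * (α₁ * α₃ * α₄)) ∎
      right : α₂ * α₄ ⁻¹ * (- 1# * p₂ * p₄ * γ * u′) * (p₄ * w′ * α₄) ≈ α₂ * p₂ * v′
      right = begin
        α₂ * α₄ ⁻¹ * (- 1# * p₂ * p₄ * γ * u′) * (p₄ * w′ * α₄)
          ≈⟨ drop-1 v′² ⟨
        α₂ * α₄ ⁻¹ * (- 1# * p₂ * p₄ * γ * u′) * (p₄ * w′ * α₄) * (v′ * v′)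
          ≈⟨ solve 9 (λ p q u v w γ a b i →
               a :* i :* (con -1ℤ :* p :* q :* γ :* u) :* (q :* w :* b) :* (v :* v)
               := a :* p :* v :* (u :* v :* w :* γ :* con -1ℤ) :* (b :* i) :* (q :* q))
               refl p₂ p₄ u′ v′ w′ γ α₂ α₄ (α₄ ⁻¹) ⟩
        α₂ * p₂ * v′ * (u′ * v′ * w′ * γ * - 1#) * (α₄ * α₄ ⁻¹) * (p₄ * p₄)
          ≈⟨ trans (drop-1 p₄²) (trans (drop-1 (*-inverseʳ α₄≉0)) (drop-1 at-D)) ⟩
        α₂ * p₂ * v′ ∎

    -- The weights have ratio α̃₃/α̃₄ = α₂/α₁, and `at-C` exchanges `v` for the other three signs
    -- and -1.
    F̃₃-from-F̃₄ : p₃ * v * α̃₃ ≈ ρ₃ * α₂ * α₁ ⁻¹ * (p₄ * w * α̃₄)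
    F̃₃-from-F̃₄ = begin
      p₃ * v * α̃₃
        ≈⟨ trans (drop-1 (*-inverseʳ α₁≉0)) (trans (drop-1 p₄²) (drop-1 at-C)) ⟨
      p₃ * v * α̃₃ * (u * v * w * γ * - 1#) * (p₄ * p₄) * (α₁ * α₁ ⁻¹)
        ≈⟨ solve 11 (λ p q u v w γ a₂ a₃ i a j →
             p :* v :* (a₂ :* a₃ :* i) :* (u :* v :* w :* γ :* con -1ℤ) :* (q :* q) :* (a :* j)
             := p :* q :* γ :* u :* con -1ℤ :* a₂ :* j :* (q :* w :* (a :* a₃ :* i)) :* (v :* v))
             refl p₃ p₄ u v w γ α₂ α₃ (α̃₂ ⁻¹) α₁ (α₁ ⁻¹) ⟩
      ρ₃ * α₂ * α₁ ⁻¹ * (p₄ * w * α̃₄) * (v * v)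
        ≈⟨ drop-1 v² ⟩
      ρ₃ * α₂ * α₁ ⁻¹ * (p₄ * w * α̃₄) ∎

if-yes : ∀ {a p} {A : Set a} {P : Set p} (P? : Dec P) {x y : A} → P → (if does P? then x else y) ≡ x
if-yes P? p rewrite dec-true P? p = ≡.refl

if-no : ∀ {a p} {A : Set a} {P : Set p} (P? : Dec P) {x y : A} → ¬ P → (if does P? then x else y) ≡ y
if-no P? ¬p rewrite dec-false P? ¬p = ≡.refl

-- Edges and gauge rays of a plabic network

module NetworkProperties {c ℓ₁ ℓ₂} (K : OrderedField c ℓ₁ ℓ₂) {n k : ℕ}
  (N : Plabic.Network K n) (isN : Plabic.IsPlabicNetwork K k N)
  (L : Plane.Direction K) (G : Plabic.IsGauge K N L) where
  open OrderedField K
  open Plane K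
  open Plabic K
  open RayMeetsSegmentDecidable K using (rayMeetsSegment?)
  open OrderedFieldProperties K
  open PlaneProperties K
  open Corner K
  open Winding K
  open RayCrossing K
  open IntegerRingSolver commutativeRing
  open Network N
  open IsPlabicNetwork isN
  open IsGauge G
  open import Relation.Binary.Reasoning.Setoid setoid

  private l = proj₁ L

  vec≡ : ∀ {e u v} → source e ≡ u → target e ≡ v → vec e ≡ pos v -ₚ pos u
  vec≡ ≡.refl ≡.refl = ≡.refl

  onEdge : ∀ {e u v x} → source e ≡ u → target e ≡ v → OnSegment (pos u) (pos v) x → OnEdge e x
  onEdge ≡.refl ≡.refl o = o

  -- The orientation is forgotten: at a corner, every edge is regarded as leaving the common vertex.
  Joins : Edge → Vertex → Vertex → Set
  Joins e u v = (source e ≡ u × target e ≡ v) ⊎ (target e ≡ u × source e ≡ v)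

  joins-onEdge : ∀ {e u v x} → Joins e u v → OnSegment (pos u) (pos v) x → OnEdge e x
  joins-onEdge (inj₁ (s , t)) o = onEdge s t o
  joins-onEdge {u = u} {v} {x} (inj₂ (t , s)) o = onEdge s t (OnSegment-reverse {pos u} {pos v} {x} o)

  joins-endpoint : ∀ {e u v w} → Joins e u v → IsEndpoint w e → w ≡ u ⊎ w ≡ v
  joins-endpoint (inj₁ (≡.refl , ≡.refl)) (inj₁ p) = inj₁ (≡.sym p)
  joins-endpoint (inj₁ (≡.refl , ≡.refl)) (inj₂ p) = inj₂ (≡.sym p)
  joins-endpoint (inj₂ (≡.refl , ≡.refl)) (inj₁ p) = inj₂ (≡.sym p)
  joins-endpoint (inj₂ (≡.refl , ≡.refl)) (inj₂ p) = inj₁ (≡.sym p)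

  joins-≢ : ∀ {e u v} → Joins e u v → u ≢ v
  joins-≢ {e} (inj₁ (≡.refl , ≡.refl)) = no-loops e
  joins-≢ {e} (inj₂ (≡.refl , ≡.refl)) = no-loops e ∘ ≡.sym

  difference≈0⇒≡ : ∀ {u v} → pos v -ₚ pos u ≈ₚ 0ₚ → v ≡ u
  difference≈0⇒≡ (e , e′) = pos-injective (eq e , eq e′)
    where
    eq : ∀ {x y} → x - y ≈ 0# → x ≈ y
    eq {x} {y} e = trans (solve 2 (λ x y → x := (x :- y) :+ y) refl x y) (trans (+-congʳ e) (+-identityˡ y))

  joins-≉0 : ∀ {e u v} → Joins e u v → ¬ pos v -ₚ pos u ≈ₚ 0ₚ
  joins-≉0 j e = joins-≢ j (≡.sym (difference≈0⇒≡ e))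

  disjoint-edges : ∀ {e f t u v w} → Joins e t u → Joins f v w → e ≢ f →
                   t ≢ v → t ≢ w → u ≢ v → u ≢ w → Disjoint (pos t) (pos u) (pos v) (pos w)
  disjoint-edges {e} {f} {t} {u} {v} {w} je jf e≢f t≢v t≢w u≢v u≢w {x} o o′ =
    go (planar {x = x} e≢f (joins-onEdge je o) (joins-onEdge jf o′))
    where
    distinct : ∀ {z} → z ≡ t ⊎ z ≡ u → z ≡ v ⊎ z ≡ w → ⊥
    distinct (inj₁ p) (inj₁ q) = t≢v (≡.trans (≡.sym p) q)
    distinct (inj₁ p) (inj₂ q) = t≢w (≡.trans (≡.sym p) q)
    distinct (inj₂ p) (inj₁ q) = u≢v (≡.trans (≡.sym p) q)
    distinct (inj₂ p) (inj₂ q) = u≢w (≡.trans (≡.sym p) q)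
    go : ∃[ z ] (IsEndpoint z e × IsEndpoint z f × x ≈ₚ pos z) → ⊥
    go (z , ze , zf , _) = distinct (joins-endpoint je ze) (joins-endpoint jf zf)

  -- Edges in the same direction from a common vertex would share a point in the
  -- interior of both.
  ¬sameDirection : ∀ {e f u v w} → Joins e u v → Joins f u w → e ≢ f →
                   ¬ SameDirection (pos v -ₚ pos u) (pos w -ₚ pos u)
  ¬sameDirection {e} {f} {u} {v} {w} je jf e≢f (a , b , 0<a , 0<b , ap≈bq) =
    go (planar {x = x} e≢f
          (joins-onEdge je (a * i , proj₁ a-bounds , proj₂ a-bounds , refl , refl))
          (joins-onEdge jf (b * i , proj₁ b-bounds , proj₂ b-bounds ,
             +-congˡ (scale (proj₁ ap≈bq)) , +-congˡ (scale (proj₂ ap≈bq)))))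
    where
    p = pos v -ₚ pos u
    -- Normalising by `a + b` makes `a * i` and `b * i` positive with sum 1, so both are segment
    -- parameters. If the common point were the start or the far end of `e`, then `p` would vanish
    -- after multiplication by one of them.
    i = (a + b) ⁻¹
    x = pos u +ₚ (a * i) · p
    0<a+b = pos+pos 0<a 0<b
    0<i = ⁻¹-pos 0<a+b
    a-bounds = ratio∈[0,1] (inj₁ 0<a) (inj₁ 0<b) refl 0<a+b
    b-bounds = ratio∈[0,1] (inj₁ 0<b) (inj₁ 0<a) (+-comm b a) 0<a+b
    scale : ∀ {y z} → a * y ≈ b * z → a * i * y ≈ b * i * z
    scale {y} {z} e = trans (solve 3 (λ a i y → a :* i :* y := i :* (a :* y)) refl a i y)
      (trans (*-congˡ e) (solve 3 (λ b i z → i :* (b :* z) := b :* i :* z) refl b i z))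
    at-start : ∀ {y z} → y + a * i * z ≈ y → a * i * z ≈ 0#
    at-start {y} {z} e = trans (solve 2 (λ y z → z := y :+ z :- y) refl y (a * i * z))
      (trans (+-congʳ e) (-‿inverseʳ y))
    at-end : ∀ {y z} → y + a * i * (z - y) ≈ z → b * i * (z - y) ≈ 0#
    at-end {y} {z} e = begin
      b * i * (z - y)
        ≈⟨ solve 5 (λ a b i y z → b :* i :* (z :- y)
             := (a :+ b) :* i :* (z :- y) :+ y :- (y :+ a :* i :* (z :- y))) refl a b i y z ⟩
      (a + b) * i * (z - y) + y - (y + a * i * (z - y))
        ≈⟨ +-cong (+-congʳ (*-congʳ (*-inverseʳ (>⇒≉ 0<a+b)))) (-‿cong e) ⟩
      1# * (z - y) + y - z
        ≈⟨ solve 2 (λ y z → con 1ℤ :* (z :- y) :+ y :- z := con 0ℤ) refl y z ⟩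
      0#                                             ∎
    p≉0 = joins-≉0 je
    located : ∀ {z} → z ≡ u ⊎ z ≡ v → x ≈ₚ pos z → ⊥
    located (inj₁ ≡.refl) (e , e′) = p≉0 (·-cancel (>⇒≉ (*-pos 0<a 0<i)) (at-start e , at-start e′))
    located (inj₂ ≡.refl) (e , e′) = p≉0 (·-cancel (>⇒≉ (*-pos 0<b 0<i)) (at-end e , at-end e′))
    go : ∃[ z ] (IsEndpoint z e × IsEndpoint z f × x ≈ₚ pos z) → ⊥
    go (z , ze , _ , x≈) = located (joins-endpoint je ze) x≈

  -- `e₃` and `e₄` may end at a boundary sink, where `not-parallel` is silent. Were such an edge
  -- parallel to the gauge direction, its internal end would lie on the ray starting at that sink.
  outgoing-∦ : ∀ {e u} → source e ≡ internal u → ¬ cross (vec e) l ≈ 0#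
  outgoing-∦ {e} {u} s = go (target e) ≡.refl
    where
    go : ∀ v → target e ≡ v → ¬ cross (vec e) l ≈ 0#
    go (internal _) t ∥ = not-parallel e s t ∥
    go (boundary i) t ∥ = rays-avoid i u
      (height≈0⇒OnRay origin tangent (abscissa i) L (λ {x} → rays-inside i {x})
        (location u) (internal-inside u)
        (trans (flip l (location u) (pos (boundary i)))
          (≡.subst (λ y → cross y l ≈ 0#) (vec≡ s t) ∥)))
      where
      flip : ∀ l u b → cross l (u -ₚ b) ≈ cross (b -ₚ u) l
      flip (l , l′) (u , u′) (b , b′) =
        solve 6 (λ l l′ u u′ b b′ → let L = l , l′; U = u , u′; B = b , b′ in
          crossᴾ L (U -ᴾ B) := crossᴾ (B -ᴾ U) L) refl l l′ u u′ b b′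

  intBetween : Vertex → Vertex → ℤ
  intBetween u v = + Vec.count (λ i → isSource? i ×-dec rayMeetsSegment? (pos (boundary i)) L (pos u) (pos v))
                               (Vec.allFin n)

  int≡ : ∀ {e u v} → source e ≡ u → target e ≡ v → int L e ≡ intBetween u v
  int≡ ≡.refl ≡.refl = ≡.refl

  intBetween-sym : ∀ u v → intBetween u v ≡ intBetween v u
  intBetween-sym u v = ≡.cong +_ (count-cong _ _
    (λ i → ≡.cong (does (isSource? i) ∧_)
      (does-⇔ (mk⇔ (RayMeetsSegment-reverse (pos (boundary i)) L (pos u) (pos v))
                   (RayMeetsSegment-reverse (pos (boundary i)) L (pos v) (pos u)))
        (rayMeetsSegment? (pos (boundary i)) L (pos u) (pos v))
        (rayMeetsSegment? (pos (boundary i)) L (pos v) (pos u))))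
    (Vec.allFin n))

  private
    raySide? : ∀ (u : Fin #internal) (i : Fin n) →
      Dec (height origin tangent (abscissa i) L (location u) < 0#)
    raySide? u i = _ <? _

    right? : ∀ (u : Fin #internal) (i : Fin n) → Dec _
    right? u i = isSource? i ×-dec raySide? u i

  -- The factor (-1)^int of an edge between internal vertices splits into one factor per
  -- end, since the edge meets a gauge ray if and only if exactly one end is to its right.
  side-sign : Fin #internal → Carrier
  side-sign u = [-1]^ (+ Vec.count (right? u) (Vec.allFin n))

  [-1]^intBetween : ∀ u v → [-1]^ intBetween (internal u) (internal v) ≈ side-sign u * side-sign v
  [-1]^intBetween u v = [-1]^count-xor _ (right? u) (right? v) pointwise (Vec.allFin n)
    where
    pointwise : ∀ i → does (isSource? i ×-dec rayMeetsSegment? (pos (boundary i)) L (location u) (location v))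
                    ≡ does (right? u i) xor does (right? v i)
    pointwise i with does (isSource? i)
    ... | false = ≡.refl
    ... | true  = crosses origin tangent (abscissa i) L (λ {x} → rays-inside i {x})
                    (location u) (location v)
                    (internal-inside u) (internal-inside v) (rays-avoid i u) (rays-avoid i v)
                    (raySide? u i) (raySide? v i)
                    (rayMeetsSegment? (pos (boundary i)) L (location u) (location v))

-- Geometry of the square and effect of the move

module SquareMoveProperties {c ℓ₁ ℓ₂} (K : OrderedField c ℓ₁ ℓ₂) {n k : ℕ}
  (N : Plabic.Network K n) (isN : Plabic.IsPlabicNetwork K k N)
  (L : Plane.Direction K) (G : Plabic.IsGauge K N L) (S : Plabic.Square K N) where
  open OrderedField K
  open Plane K
  open Plabic K
  open RayMeetsSegmentDecidable K using (rayMeetsSegment?)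
  open OrderedFieldProperties K
  open PlaneProperties K
  open Corner K
  open Winding K
  open IntegerRingSolver commutativeRing
  open NetworkProperties K N isN L G
  open Network N
  open IsPlabicNetwork isN
  open Square S
  open import Relation.Binary.Reasoning.Setoid setoid

  private
    l = proj₁ L
    module N′ = Network squareMove

    a b c′ d : Pt
    a = location A
    b = location B
    c′ = location C
    d = location D

  internal-≢ : ∀ {u v} → u ≢ v → _≢_ {A = Vertex} (internal u) (internal v)
  internal-≢ u≢v ≡.refl = u≢v ≡.refl

  colours-differ : ∀ {u v} → colour u ≡ white → colour v ≡ black → u ≢ v
  colours-differ w b ≡.refl with ≡.trans (≡.sym w) b
  ... | ()

  A≢B : A ≢ B
  A≢B = colours-differ A-white B-black

  A≢D : A ≢ D
  A≢D = colours-differ A-white D-black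

  C≢B : C ≢ B
  C≢B = colours-differ C-white B-black

  C≢D : C ≢ D
  C≢D = colours-differ C-white D-black

  -- The colours agree here, so the vertices are separated by the area: a vanishing diagonal would
  -- make it zero.
  A≢C : A ≢ C
  A≢C A≡C = <⇒≉ clockwise (≡.subst (λ v → cross (location v -ₚ a) (d -ₚ b) ≈ 0#) A≡C (vanish a (d -ₚ b)))
    where
    vanish : ∀ p u → cross (p -ₚ p) u ≈ 0#
    vanish (p , p′) (u , u′) =
      solve 4 (λ p p′ u u′ → let P = p , p′; U = u , u′ in crossᴾ (P -ᴾ P) U := con 0ℤ) refl p p′ u u′

  B≢D : B ≢ D
  B≢D B≡D = <⇒≉ clockwise (≡.subst (λ v → cross (c′ -ₚ a) (location v -ₚ b) ≈ 0#) B≡D (vanish b (c′ -ₚ a)))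
    where
    vanish : ∀ p u → cross u (p -ₚ p) ≈ 0#
    vanish (p , p′) (u , u′) =
      solve 4 (λ p p′ u u′ → let P = p , p′; U = u , u′ in crossᴾ U (P -ᴾ P) := con 0ℤ) refl p p′ u u′

  sources-differ : ∀ {e f u v} → source e ≡ internal u → source f ≡ internal v → u ≢ v → e ≢ f
  sources-differ s s′ u≢v ≡.refl = internal-≢ u≢v (≡.trans (≡.sym s) s′)

  h₁≢h₂ : h₁ ≢ h₂
  h₁≢h₂ e≡f = internal-≢ B≢D (≡.trans (≡.sym h₁-target) (≡.trans (≡.cong target e≡f) h₂-target))

  h₁≢h₃ : h₁ ≢ h₃
  h₁≢h₃ = sources-differ h₁-source h₃-source A≢B

  h₁≢h₄ : h₁ ≢ h₄
  h₁≢h₄ = sources-differ h₁-source h₄-source A≢C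

  h₂≢h₃ : h₂ ≢ h₃
  h₂≢h₃ = sources-differ h₂-source h₃-source A≢B

  h₂≢h₄ : h₂ ≢ h₄
  h₂≢h₄ = sources-differ h₂-source h₄-source A≢C

  h₃≢h₄ : h₃ ≢ h₄
  h₃≢h₄ = sources-differ h₃-source h₄-source (C≢B ∘ ≡.sym)

  e₃-outside : OutsideSquare e₃
  e₃-outside = sources-differ e₃-source h₁-source (A≢D ∘ ≡.sym)
             , sources-differ e₃-source h₂-source (A≢D ∘ ≡.sym)
             , sources-differ e₃-source h₃-source (B≢D ∘ ≡.sym)
             , sources-differ e₃-source h₄-source (C≢D ∘ ≡.sym)

  e₄-outside : OutsideSquare e₄
  e₄-outside = sources-differ e₄-source h₁-source (A≢C ∘ ≡.sym)
             , sources-differ e₄-source h₂-source (A≢C ∘ ≡.sym)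
             , sources-differ e₄-source h₃-source C≢B
             , e₄≢h₄

  AB∩CD : Disjoint a b c′ d
  AB∩CD = disjoint-edges (inj₁ (h₁-source , h₁-target)) (inj₁ (h₄-source , h₄-target)) h₁≢h₄
    (internal-≢ A≢C) (internal-≢ A≢D) (internal-≢ (C≢B ∘ ≡.sym)) (internal-≢ B≢D)

  BC∩DA : Disjoint b c′ d a
  BC∩DA = disjoint-edges (inj₁ (h₃-source , h₃-target)) (inj₂ (h₂-target , h₂-source)) (h₂≢h₃ ∘ ≡.sym)
    (internal-≢ B≢D) (internal-≢ (A≢B ∘ ≡.sym)) (internal-≢ C≢D) (internal-≢ (A≢C ∘ ≡.sym))

  CD∩AB : Disjoint c′ d a b
  CD∩AB {x} o o′ = AB∩CD {x} o′ o

  -- The two cuts trade places, and reading a diagonal from its other end exchanges its two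
  -- triangles.
  interior-rotate : ∀ {p q r s x} → InteriorOfQuad q r s p x → InteriorOfQuad p q r s x
  interior-rotate (inj₁ i) = inj₂ i
  interior-rotate (inj₂ (i , j , inj₁ t)) = inj₁ (j , i , inj₂ t)
  interior-rotate (inj₂ (i , j , inj₂ t)) = inj₁ (j , i , inj₁ t)

  e₄-left-of-h₃h₄ : LeftOfPath s⟨ vec h₃ , vec h₄ ⟩ s⟨ vec h₃ , vec e₄ ⟩ s⟨ vec h₄ , vec e₄ ⟩
  e₄-left-of-h₃h₄ = leftOfPath-resp
    (≡.cong₂ s⟨_,_⟩ vec-h₃ vec-h₄) (≡.cong₂ s⟨_,_⟩ vec-h₃ vec-e₄) (≡.cong₂ s⟨_,_⟩ vec-h₄ vec-e₄)
    (corner a b c′ d (pos (target e₄)) clockwise AB∩CD BC∩DA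
      (λ {x} o → face e₄ {x} (onEdge e₄-source ≡.refl o))
      (joins-≉0 joins-e₄)
      (¬sameDirection joins-e₄ (inj₁ (h₄-source , h₄-target)) e₄≢h₄)
      (¬sameDirection joins-e₄ (inj₂ (h₃-target , h₃-source)) (proj₁ (proj₂ (proj₂ e₄-outside)))))
    where
    joins-e₄ : Joins e₄ (internal C) (target e₄)
    joins-e₄ = inj₁ (e₄-source , ≡.refl)
    vec-h₃ = vec≡ h₃-source h₃-target
    vec-h₄ = vec≡ h₄-source h₄-target
    vec-e₄ = vec≡ {e₄} e₄-source ≡.refl

  e₃-left-of-h₄-h₂ : LeftOfPath s⟨ vec h₄ , -ₚ vec h₂ ⟩ s⟨ vec h₄ , vec e₃ ⟩ s⟨ -ₚ vec h₂ , vec e₃ ⟩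
  e₃-left-of-h₄-h₂ = leftOfPath-resp
    (≡.trans (≡.cong₂ (λ u v → s⟨ u , -ₚ v ⟩) vec-h₄ vec-h₂)
             (s-cong {d -ₚ c′} {d -ₚ c′} { -ₚ (d -ₚ a)} {a -ₚ d} (refl , refl) a-d))
    (≡.cong₂ s⟨_,_⟩ vec-h₄ vec-e₃)
    (≡.trans (≡.cong₂ (λ u v → s⟨ -ₚ u , v ⟩) vec-h₂ vec-e₃)
             (s-cong { -ₚ (d -ₚ a)} {a -ₚ d} {t} {t} a-d (refl , refl)))
    -- `corner` treats its third vertex, so the quadrilateral is rotated to put D there; the side
    -- after D is then h₂ run backwards.
    (corner b c′ d a (pos (target e₃)) (<-respˡ (quad-rotate a b c′ d) clockwise) BC∩DA CD∩AB
      (λ {x} o i → face e₃ {x} (onEdge e₃-source ≡.refl o) (interior-rotate {a} {b} {c′} {d} {x} i))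
      (joins-≉0 joins-e₃)
      (¬sameDirection joins-e₃ (inj₂ (h₂-target , h₂-source)) (proj₁ (proj₂ e₃-outside)))
      (¬sameDirection joins-e₃ (inj₂ (h₄-target , h₄-source)) (proj₂ (proj₂ (proj₂ e₃-outside)))))
    where
    t = pos (target e₃) -ₚ d
    a-d : -ₚ (d -ₚ a) ≈ₚ a -ₚ d
    a-d = ≈ₚ-sym {a -ₚ d} { -ₚ (d -ₚ a)} (swap-difference a d)
    joins-e₃ : Joins e₃ (internal D) (target e₃)
    joins-e₃ = inj₁ (e₃-source , ≡.refl)
    vec-h₂ = vec≡ h₂-source h₂-target
    vec-h₄ = vec≡ h₄-source h₄-target
    vec-e₃ = vec≡ {e₃} e₃-source ≡.refl

  wind-at-C : + 2 ℤ.∣ wind L (vec h₃) (vec h₄) ℤ.+ wind L (vec h₃) (vec e₄)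
                      ℤ.+ wind L (-ₚ vec h₄) (vec e₄) ℤ.+ γ₂ L (vec h₄) ℤ.+ 1ℤ
  wind-at-C = wind-parity-in L (vec h₃) (vec h₄) (vec e₄)
    (outgoing-∦ h₃-source) (outgoing-∦ h₄-source) (outgoing-∦ e₄-source) e₄-left-of-h₃h₄

  wind-at-D : + 2 ℤ.∣ wind L (vec h₂) (-ₚ vec h₄) ℤ.+ wind L (vec h₂) (vec e₃)
                      ℤ.+ wind L (vec h₄) (vec e₃) ℤ.+ γ₂ L (vec h₄) ℤ.+ 1ℤ
  wind-at-D = wind-parity-out L (vec h₄) (vec h₂) (vec e₃)
    (outgoing-∦ h₄-source) (outgoing-∦ h₂-source) (outgoing-∦ e₃-source) e₃-left-of-h₄-h₂

  [-1]^int : ∀ {e u v} → source e ≡ internal u → target e ≡ internal v →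
             [-1]^ int L e ≈ side-sign u * side-sign v
  [-1]^int {u = u} {v} s t = trans (reflexive (≡.cong [-1]^_ (int≡ s t))) ([-1]^intBetween u v)

  -- Every vertex of the square is an end of two sides, so each vertex sign occurs squared.
  int-even : [-1]^ int L h₁ * [-1]^ int L h₂ * [-1]^ int L h₃ * [-1]^ int L h₄ ≈ 1#
  int-even = begin
    [-1]^ int L h₁ * [-1]^ int L h₂ * [-1]^ int L h₃ * [-1]^ int L h₄
      ≈⟨ *-cong (*-cong (*-cong ([-1]^int h₁-source h₁-target) ([-1]^int h₂-source h₂-target))
           ([-1]^int h₃-source h₃-target)) ([-1]^int h₄-source h₄-target) ⟩
    (τ A * τ B) * (τ A * τ D) * (τ B * τ C) * (τ C * τ D)
      ≈⟨ solve 4 (λ a b c d → (a :* b) :* (a :* d) :* (b :* c) :* (c :* d)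
           := (a :* a) :* (b :* b) :* ((c :* c) :* (d :* d))) refl (τ A) (τ B) (τ C) (τ D) ⟩
    (τ A * τ A) * (τ B * τ B) * ((τ C * τ C) * (τ D * τ D))
      ≈⟨ *-cong (*-cong τ² τ²) (*-cong τ² τ²) ⟩
    1# * 1# * (1# * 1#)
      ≈⟨ solve 0 (con 1ℤ :* con 1ℤ :* (con 1ℤ :* con 1ℤ) := con 1ℤ) refl ⟩
    1# ∎
    where
    τ = side-sign
    τ² : ∀ {u} → τ u * τ u ≈ 1#
    τ² {u} = [-1]^-square (+ Vec.count _ (Vec.allFin n))

  private
    -- `does` of `_⊎-dec_` unfolds to `_∨_`, so this decision computes to the Boolean condition in
    -- `squareMove`.
    reversed? : ∀ e → Dec (e ≡ h₁ ⊎ e ≡ h₄)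
    reversed? e = (e Fin.≟ h₁) ⊎-dec (e Fin.≟ h₄)

    corner? : ∀ v → Dec (v ≡ A ⊎ v ≡ B ⊎ v ≡ C ⊎ v ≡ D)
    corner? v = (v Fin.≟ A) ⊎-dec (v Fin.≟ B) ⊎-dec (v Fin.≟ C) ⊎-dec (v Fin.≟ D)

  source′-reversed : ∀ {e} → e ≡ h₁ ⊎ e ≡ h₄ → N′.source e ≡ target e
  source′-reversed {e} r = if-yes (reversed? e) r

  target′-reversed : ∀ {e} → e ≡ h₁ ⊎ e ≡ h₄ → N′.target e ≡ source e
  target′-reversed {e} r = if-yes (reversed? e) r

  source′-kept : ∀ {e} → e ≢ h₁ → e ≢ h₄ → N′.source e ≡ source e
  source′-kept {e} p q = if-no (reversed? e) [ p , q ]′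

  target′-kept : ∀ {e} → e ≢ h₁ → e ≢ h₄ → N′.target e ≡ target e
  target′-kept {e} p q = if-no (reversed? e) [ p , q ]′

  colour′ : ∀ {v} → v ≡ A ⊎ v ≡ B ⊎ v ≡ C ⊎ v ≡ D → N′.colour v ≡ opposite (colour v)
  colour′ {v} p = if-yes (corner? v) p

  weight′-h₁ : N′.weight h₁ ≡ α̃₁
  weight′-h₁ = if-yes (h₁ Fin.≟ h₁) ≡.refl

  weight′-h₂ : N′.weight h₂ ≡ α̃₂
  weight′-h₂ = ≡.trans (if-no (h₂ Fin.≟ h₁) (h₁≢h₂ ∘ ≡.sym)) (if-yes (h₂ Fin.≟ h₂) ≡.refl)

  weight′-h₃ : N′.weight h₃ ≡ α̃₃
  weight′-h₃ = ≡.trans (if-no (h₃ Fin.≟ h₁) (h₁≢h₃ ∘ ≡.sym))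
    (≡.trans (if-no (h₃ Fin.≟ h₂) (h₂≢h₃ ∘ ≡.sym)) (if-yes (h₃ Fin.≟ h₃) ≡.refl))

  weight′-h₄ : N′.weight h₄ ≡ α̃₄
  weight′-h₄ = ≡.trans (if-no (h₄ Fin.≟ h₁) (h₁≢h₄ ∘ ≡.sym))
    (≡.trans (if-no (h₄ Fin.≟ h₂) (h₂≢h₄ ∘ ≡.sym))
    (≡.trans (if-no (h₄ Fin.≟ h₃) (h₃≢h₄ ∘ ≡.sym)) (if-yes (h₄ Fin.≟ h₄) ≡.refl)))

  pos′≡ : ∀ v → N′.pos v ≡ pos v
  pos′≡ (boundary _) = ≡.refl
  pos′≡ (internal _) = ≡.refl

  vec′-kept : ∀ {e} → e ≢ h₁ → e ≢ h₄ → N′.vec e ≡ vec e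
  vec′-kept {e} p q = ≡.cong₂ _-ₚ_
    (≡.trans (pos′≡ (N′.target e)) (≡.cong pos (target′-kept p q)))
    (≡.trans (pos′≡ (N′.source e)) (≡.cong pos (source′-kept p q)))

  vec′-reversed : ∀ {e} → e ≡ h₁ ⊎ e ≡ h₄ → N′.vec e ≈ₚ -ₚ vec e
  vec′-reversed {e} r = ≡.subst (_≈ₚ -ₚ vec e) (≡.sym (≡.cong₂ _-ₚ_
    (≡.trans (pos′≡ (N′.target e)) (≡.cong pos (target′-reversed r)))
    (≡.trans (pos′≡ (N′.source e)) (≡.cong pos (source′-reversed r)))))
    (swap-difference (pos (source e)) (pos (target e)))

  wind-reversedˡ : ∀ {e} → e ≡ h₁ ⊎ e ≡ h₄ → ∀ y → wind L (N′.vec e) y ≡ wind L (-ₚ vec e) y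
  wind-reversedˡ {e} r y = wind-cong L {N′.vec e} { -ₚ vec e} {y} {y} (vec′-reversed r) (refl , refl)

  wind-reversedʳ : ∀ {e} → e ≡ h₁ ⊎ e ≡ h₄ → ∀ y → wind L y (N′.vec e) ≡ wind L y (-ₚ vec e)
  wind-reversedʳ {e} r y = wind-cong L {y} {y} {N′.vec e} { -ₚ vec e} (refl , refl) (vec′-reversed r)

  -- The two reversed edges have internal ends only, so no boundary source appears or disappears and
  -- the gauge rays stay the same.
  isSource-same : ∀ i → does (N′.isSource? i) ≡ does (isSource? i)
  isSource-same i = does-⇔ (mk⇔ to from) (N′.isSource? i) (isSource? i)
    where
    not-boundary : ∀ {u} {v : Vertex} {j : Fin n} → v ≡ internal u → v ≢ boundary j
    not-boundary ≡.refl ()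
    kept : ∀ {e} {X : Set} → (e ≡ h₁ → X) → (e ≡ h₄ → X) → (e ≢ h₁ → e ≢ h₄ → X) → X
    kept {e} f g h with e Fin.≟ h₁ | e Fin.≟ h₄
    ... | yes p | _     = f p
    ... | no _  | yes q = g q
    ... | no p  | no q  = h p q
    to : N′.IsSource i → IsSource i
    to (e , s) = e , kept
      (λ p → ⊥-elim (not-boundary (≡.trans (source′-reversed (inj₁ p)) (≡.trans
        (≡.cong target p) h₁-target)) s))
      (λ q → ⊥-elim (not-boundary (≡.trans (source′-reversed (inj₂ q)) (≡.trans
        (≡.cong target q) h₄-target)) s))
      (λ p q → ≡.trans (≡.sym (source′-kept p q)) s)
    from : IsSource i → N′.IsSource i
    from (e , s) = e , kept
      (λ p → ⊥-elim (not-boundary (≡.trans (≡.cong source p) h₁-source) s))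
      (λ q → ⊥-elim (not-boundary (≡.trans (≡.cong source q) h₄-source) s))
      (λ p q → ≡.trans (source′-kept p q) s)

  int′-between : ∀ {e u v} → N′.source e ≡ internal u → N′.target e ≡ internal v →
                 N′.int L e ≡ intBetween (internal u) (internal v)
  int′-between {e} {u} {v} s t = ≡.trans
    (≡.cong₂ (λ x y → + Vec.count (λ i → N′.isSource? i ×-dec
        rayMeetsSegment? (pos (boundary i)) L (N′.pos x) (N′.pos y)) (Vec.allFin n)) s t)
    (≡.cong +_ (count-cong _ _ (λ i →
      ≡.cong (_∧ does (rayMeetsSegment? (pos (boundary i)) L (location u) (location v)))
      (isSource-same i)) (Vec.allFin n)))

  int′-reversed : ∀ {e u v} → e ≡ h₁ ⊎ e ≡ h₄ → source e ≡ internal u → target e ≡ internal v →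
                  N′.int L e ≡ int L e
  int′-reversed {u = u} {v} r s t = ≡.trans
    (int′-between (≡.trans (source′-reversed r) t) (≡.trans (target′-reversed r) s))
    (≡.trans (intBetween-sym (internal v) (internal u)) (≡.sym (int≡ s t)))

  int′-kept : ∀ {e u v} → e ≢ h₁ → e ≢ h₄ → source e ≡ internal u → target e ≡ internal v →
              N′.int L e ≡ int L e
  int′-kept p q s t = ≡.trans
    (int′-between (≡.trans (source′-kept p q) s) (≡.trans (target′-kept p q) t))
    (≡.sym (int≡ s t))

-- Edge vectors before and after the move

module SquareMoveFormulas {c ℓ₁ ℓ₂ m ℓm} (K : OrderedField c ℓ₁ ℓ₂)
  (V : Module (OrderedField.commutativeRing K) m ℓm) {n k : ℕ}
  (N : Plabic.Network K n) (isN : Plabic.IsPlabicNetwork K k N)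
  (L : Plane.Direction K) (G : Plabic.IsGauge K N L) (S : Plabic.Square K N) where
  open OrderedField K
  open Module V
  open Plane K
  open Plabic K
  open EdgeVectors V
  open OrderedFieldProperties K
  open SquareMoveProperties K N isN L G S
  open SquareScalars K
  open LinearElimination V
  open Network N
  open IsPlabicNetwork isN
  open Square S

  private
    i₁ i₂ i₃ i₄ γ u v w u′ v′ w′ : ℤ
    i₁ = int L h₁
    i₂ = int L h₂
    i₃ = int L h₃
    i₄ = int L h₄
    γ  = γ₂ L (vec h₄)
    u  = wind L (vec h₃) (vec h₄)
    v  = wind L (vec h₃) (vec e₄)
    w  = wind L (-ₚ vec h₄) (vec e₄)
    u′ = wind L (vec h₂) (-ₚ vec h₄)
    v′ = wind L (vec h₂) (vec e₃)
    w′ = wind L (vec h₄) (vec e₃)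

    [-1]^1 : [-1]^ 1ℤ ≈ - 1#
    [-1]^1 = *-identityʳ (- 1#)

    [-1]^-+₅ : ∀ a b c d e → [-1]^ (a ℤ.+ b ℤ.+ c ℤ.+ d ℤ.+ e) ≈
               [-1]^ a * [-1]^ b * [-1]^ c * [-1]^ d * [-1]^ e
    [-1]^-+₅ a b c d e =
      trans ([-1]^-+ (a ℤ.+ b ℤ.+ c ℤ.+ d) e) (*-congʳ
        (trans ([-1]^-+ (a ℤ.+ b ℤ.+ c) d) (*-congʳ
          (trans ([-1]^-+ (a ℤ.+ b) c) (*-congʳ ([-1]^-+ a b))))))

    [-1]^-+₄+1 : ∀ a b c d → [-1]^ (a ℤ.+ b ℤ.+ c ℤ.+ d ℤ.+ 1ℤ) ≈
                 [-1]^ a * [-1]^ b * [-1]^ c * [-1]^ d * - 1#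
    [-1]^-+₄+1 a b c d = trans ([-1]^-+₅ a b c d 1ℤ) (*-congˡ [-1]^1)

    [-1]^-1+₄ : ∀ a b c d → [-1]^ (1ℤ ℤ.+ a ℤ.+ b ℤ.+ c ℤ.+ d) ≈
                - 1# * [-1]^ a * [-1]^ b * [-1]^ c * [-1]^ d
    [-1]^-1+₄ a b c d = trans ([-1]^-+₅ 1ℤ a b c d) (*-congʳ (*-congʳ (*-congʳ (*-congʳ [-1]^1))))

    α₁≉0 : ¬ α₁ ≈ 0#
    α₁≉0 = >⇒≉ (weight-positive h₁)

    α₃≉0 : ¬ α₃ ≈ 0#
    α₃≉0 = >⇒≉ (weight-positive h₃)

    α₄≉0 : ¬ α₄ ≈ 0#
    α₄≉0 = >⇒≉ (weight-positive h₄)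

    α̃₂≉0 : ¬ α̃₂ ≈ 0#
    α̃₂≉0 = >⇒≉ (pos+pos (weight-positive h₂)
      (*-pos (*-pos (weight-positive h₁) (weight-positive h₃)) (weight-positive h₄)))

    at-C : [-1]^ u * [-1]^ v * [-1]^ w * [-1]^ γ * - 1# ≈ 1#
    at-C = trans (sym ([-1]^-+₄+1 u v w γ)) ([-1]^-even (u ℤ.+ v ℤ.+ w ℤ.+ γ ℤ.+ 1ℤ) wind-at-C)

    at-D : [-1]^ u′ * [-1]^ v′ * [-1]^ w′ * [-1]^ γ * - 1# ≈ 1#
    at-D = trans (sym ([-1]^-+₄+1 u′ v′ w′ γ)) ([-1]^-even (u′ ℤ.+ v′ ℤ.+ w′ ℤ.+ γ ℤ.+ 1ℤ) wind-at-D)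

    coefficient≈ : ∀ {i i′ t t′ α α′} → i ≡ i′ → t ≡ t′ → α ≡ α′ →
                   [-1]^ (i ℤ.+ t) * α ≈ [-1]^ i′ * [-1]^ t′ * α′
    coefficient≈ {i} {t = t} ≡.refl ≡.refl ≡.refl = *-congʳ ([-1]^-+ i t)

    open Relations
      {[-1]^ i₁} {[-1]^ i₂} {[-1]^ i₃} {[-1]^ i₄}
      {[-1]^ u} {[-1]^ v} {[-1]^ w} {[-1]^ u′} {[-1]^ v′} {[-1]^ w′} {[-1]^ γ}
      ([-1]^-square i₁) ([-1]^-square i₃) ([-1]^-square i₄)
      ([-1]^-square u) ([-1]^-square v) ([-1]^-square w) ([-1]^-square v′)
      int-even at-C at-D {α₁} {α₂} {α₃} {α₄} α₁≉0 α₃≉0 α₄≉0 α̃₂≉0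

  module _ {b : Fin n → Carrierᴹ} {F F̃ : Edge → Carrierᴹ}
           (before : IsEdgeVectorSystem N L b F) (after : IsEdgeVectorSystem squareMove L b F̃)
           (outside : ∀ e → OutsideSquare e → F̃ e ≈ᴹ F e) where

    private
      module Before = IsEdgeVectorSystem before
      module After = IsEdgeVectorSystem after
      module N′ = Network squareMove

      h₂≢h₁ = h₁≢h₂ ∘ ≡.sym
      h₃≢h₁ = h₁≢h₃ ∘ ≡.sym
      e₃≢h₁ = proj₁ e₃-outside
      e₃≢h₄ = proj₂ (proj₂ (proj₂ e₃-outside))
      e₄≢h₁ = proj₁ e₄-outside

      black-A : N′.colour A ≡ black
      black-A = ≡.trans (colour′ (inj₁ ≡.refl)) (≡.cong opposite A-white)

      black-C : N′.colour C ≡ black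
      black-C = ≡.trans (colour′ (inj₂ (inj₂ (inj₁ ≡.refl)))) (≡.cong opposite C-white)

      white-D : N′.colour D ≡ white
      white-D = ≡.trans (colour′ (inj₂ (inj₂ (inj₂ ≡.refl)))) (≡.cong opposite D-black)

      same-vec : ∀ {e f} → e ≢ h₁ → e ≢ h₄ → f ≢ h₁ → f ≢ h₄ →
                 wind L (N′.vec e) (N′.vec f) ≡ wind L (vec e) (vec f)
      same-vec p q p′ q′ = ≡.cong₂ (wind L) (vec′-kept p q) (vec′-kept p′ q′)

    F₃≈ : F h₃ ≈ᴹ ([-1]^ i₃ * [-1]^ u * α₃) *ₗ F h₄ +ᴹ ([-1]^ i₃ * [-1]^ v * α₃) *ₗ F e₄
    F₃≈ = ≈ᴹ-trans
      (Before.at-trivalent-white C h₃ h₄ e₄ C-white h₃-target h₄-source e₄-source (e₄≢h₄ ∘ ≡.sym))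
      (+ᴹ-cong (*ₗ-congʳ (coefficient≈ {i₃} {t = u} ≡.refl ≡.refl ≡.refl))
               (*ₗ-congʳ (coefficient≈ {i₃} {t = v} ≡.refl ≡.refl ≡.refl)))

    F₄≈ : F h₄ ≈ᴹ ([-1]^ i₄ * [-1]^ w′ * α₄) *ₗ F e₃
    F₄≈ = ≈ᴹ-trans (Before.at-black-or-bivalent D h₄ e₃ (inj₁ D-black) h₄-target e₃-source)
      (*ₗ-congʳ (coefficient≈ {i₄} {t = w′} ≡.refl ≡.refl ≡.refl))

    F̃₁≈ : F̃ h₁ ≈ᴹ ([-1]^ i₁ * [-1]^ wind L (-ₚ vec h₁) (vec h₂) * α̃₁) *ₗ F̃ h₂
    F̃₁≈ = ≈ᴹ-trans
      (After.at-black-or-bivalent A h₁ h₂ (inj₁ black-A)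
        (≡.trans (target′-reversed (inj₁ ≡.refl)) h₁-source)
        (≡.trans (source′-kept h₂≢h₁ h₂≢h₄) h₂-source))
      (*ₗ-congʳ (coefficient≈ (int′-reversed (inj₁ ≡.refl) h₁-source h₁-target)
        (≡.trans (≡.cong (wind L (N′.vec h₁)) (vec′-kept h₂≢h₁ h₂≢h₄))
          (wind-reversedˡ (inj₁ ≡.refl) (vec h₂)))
        weight′-h₁))

    -- After the move D is white, with h₂ incoming and -h₄ and `e₃` outgoing; the vector at `e₃`,
    -- outside the square, is the old one.
    F̃₂≈ : F̃ h₂ ≈ᴹ ([-1]^ i₂ * [-1]^ u′ * α̃₂) *ₗ F̃ h₄ +ᴹ ([-1]^ i₂ * [-1]^ v′ * α̃₂) *ₗ F e₃
    F̃₂≈ = ≈ᴹ-trans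
      (After.at-trivalent-white D h₂ h₄ e₃ white-D
        (≡.trans (target′-kept h₂≢h₁ h₂≢h₄) h₂-target)
        (≡.trans (source′-reversed (inj₂ ≡.refl)) h₄-target)
        (≡.trans (source′-kept e₃≢h₁ e₃≢h₄) e₃-source)
        (e₃≢h₄ ∘ ≡.sym))
      (+ᴹ-cong
        (*ₗ-congʳ (coefficient≈ int-h₂
          (≡.trans (≡.cong (λ x → wind L x (N′.vec h₄)) (vec′-kept h₂≢h₁ h₂≢h₄))
            (wind-reversedʳ (inj₂ ≡.refl) (vec h₂)))
          weight′-h₂))
        (*ₗ-cong (coefficient≈ int-h₂ (same-vec h₂≢h₁ h₂≢h₄ e₃≢h₁ e₃≢h₄) weight′-h₂)
          (outside e₃ e₃-outside)))
      where int-h₂ = int′-kept h₂≢h₁ h₂≢h₄ h₂-source h₂-target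

    F̃₃≈ : F̃ h₃ ≈ᴹ ([-1]^ i₃ * [-1]^ v * α̃₃) *ₗ F e₄
    F̃₃≈ = ≈ᴹ-trans
      (After.at-black-or-bivalent C h₃ e₄ (inj₁ black-C)
        (≡.trans (target′-kept h₃≢h₁ h₃≢h₄) h₃-target)
        (≡.trans (source′-kept e₄≢h₁ e₄≢h₄) e₄-source))
      (*ₗ-cong (coefficient≈ (int′-kept h₃≢h₁ h₃≢h₄ h₃-source h₃-target)
          (same-vec h₃≢h₁ h₃≢h₄ e₄≢h₁ e₄≢h₄) weight′-h₃)
        (outside e₄ e₄-outside))

    F̃₄≈ : F̃ h₄ ≈ᴹ ([-1]^ i₄ * [-1]^ w * α̃₄) *ₗ F e₄
    F̃₄≈ = ≈ᴹ-trans
      (After.at-black-or-bivalent C h₄ e₄ (inj₁ black-C)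
        (≡.trans (target′-reversed (inj₂ ≡.refl)) h₄-source)
        (≡.trans (source′-kept e₄≢h₁ e₄≢h₄) e₄-source))
      (*ₗ-cong (coefficient≈ (int′-reversed (inj₂ ≡.refl) h₄-source h₄-target)
          (≡.trans (≡.cong (wind L (N′.vec h₄)) (vec′-kept e₄≢h₁ e₄≢h₄))
            (wind-reversedˡ (inj₂ ≡.refl) (vec e₄)))
          weight′-h₄)
        (outside e₄ e₄-outside))

    -- C is white before the move and black after it; eliminating `F e₄` between its two relations
    -- gives the formula.
    F̃₄-formula : F̃ h₄ ≈ᴹ
      (α̃₄ * α₃ ⁻¹ * [-1]^ (i₃ ℤ.+ i₄ ℤ.+ γ ℤ.+ u ℤ.+ 1ℤ)) *ₗ F h₃ +ᴹ (α̃₄ * [-1]^ (i₄ ℤ.+ γ)) *ₗ F h₄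
    F̃₄-formula = ≈ᴹ-trans F̃₄≈ (eliminate-second F₃≈
      (trans (+-cong (*-congʳ (*-congˡ ([-1]^-+₄+1 i₃ i₄ γ u))) (*-congˡ ([-1]^-+ i₄ γ))) F̃₄-from-F₄)
      (trans (*-congʳ (*-congˡ ([-1]^-+₄+1 i₃ i₄ γ u))) F̃₄-from-E₄))

    -- The old relation at D turns `F e₃` into a multiple of `F h₄`, and the formula for `F̃ h₄`
    -- supplies the rest.
    F̃₂-formula : F̃ h₂ ≈ᴹ
      (α₁ * [-1]^ (i₁ ℤ.+ γ ℤ.+ u′ ℤ.+ u ℤ.+ 1ℤ)) *ₗ F h₃
      +ᴹ (α₂ * α₄ ⁻¹ * [-1]^ (1ℤ ℤ.+ i₂ ℤ.+ i₄ ℤ.+ γ ℤ.+ u′)) *ₗ F h₄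
    F̃₂-formula = substitute-first F̃₂≈ F₄≈ F̃₄-formula
      (trans (*-congˡ (*-congˡ ([-1]^-+₄+1 i₃ i₄ γ u)))
        (trans F̃₂-from-F₃ (*-congˡ (sym ([-1]^-+₄+1 i₁ γ u′ u)))))
      (trans (+-congʳ (*-congʳ (*-congˡ (*-congˡ ([-1]^-+ i₄ γ)))))
        (trans F̃₂-from-F₄ (*-congʳ (*-congˡ (sym ([-1]^-1+₄ i₂ i₄ γ u′))))))

    F̃₁-formula : F̃ h₁ ≈ᴹ (α̃₁ * [-1]^ (i₁ ℤ.+ wind L (-ₚ vec h₁) (vec h₂))) *ₗ F̃ h₂
    F̃₁-formula = ≈ᴹ-trans F̃₁≈ (*ₗ-congʳ
      (trans (*-comm _ α̃₁) (*-congˡ (sym ([-1]^-+ i₁ (wind L (-ₚ vec h₁) (vec h₂)))))))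

    -- With C black, h₃ and -h₄ both enter it, so both vectors are multiples of `F e₄`.
    F̃₃-formula : F̃ h₃ ≈ᴹ ([-1]^ (i₃ ℤ.+ i₄ ℤ.+ γ ℤ.+ u ℤ.+ 1ℤ) * α₂ * α₁ ⁻¹) *ₗ F̃ h₄
    F̃₃-formula = proportional F̃₃≈ F̃₄≈ (trans F̃₃-from-F̃₄
      (*-congʳ (*-congʳ (*-congʳ (sym ([-1]^-+₄+1 i₃ i₄ γ u))))))

lemma6p1 :
  ∀ {c ℓ₁ ℓ₂ m ℓm} (K : OrderedField c ℓ₁ ℓ₂)
  (V : Module (OrderedField.commutativeRing K) m ℓm) →
  let open OrderedField K
      open Module V
      open Plane K
      open Plabic K
      open EdgeVectors V
  in
  (k n : ℕ) → 0 <ℕ k → k <ℕ n →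
  (N : Network n) → IsPlabicNetwork k N →
  (l : Direction) → IsGauge N l →
  (S : Square N) →
  let open Network N
      open Square S
  in
  (b : Fin n → Carrierᴹ) → SinksIndependent N b →
  (F F̃ : Edge → Carrierᴹ) →
  IsEdgeVectorSystem N l b F →
  IsEdgeVectorSystem squareMove l b F̃ →
  (∀ e → OutsideSquare e → F̃ e ≈ᴹ F e) →
  let γ₂h₄ = γ₂ l (vec h₄)
      wind[h₃,h₄]  = wind l (vec h₃) (vec h₄)
      wind[h₂,-h₄] = wind l (vec h₂) (-ₚ vec h₄)
      wind[-h₁,h₂] = wind l (-ₚ vec h₁) (vec h₂)
  in
  ( F̃ h₄ ≈ᴹ
      (α̃₄ * α₃ ⁻¹ * [-1]^ (int l h₃ ⊕ int l h₄ ⊕ γ₂h₄ ⊕ wind[h₃,h₄] ⊕ 1ℤ)) *ₗ F h₃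
      +ᴹ (α̃₄ * [-1]^ (int l h₄ ⊕ γ₂h₄)) *ₗ F h₄ )
  × ( F̃ h₂ ≈ᴹ
      (α₁ * [-1]^ (int l h₁ ⊕ γ₂h₄ ⊕ wind[h₂,-h₄] ⊕ wind[h₃,h₄] ⊕ 1ℤ)) *ₗ F h₃
      +ᴹ (α₂ * α₄ ⁻¹ * [-1]^ (1ℤ ⊕ int l h₂ ⊕ int l h₄ ⊕ γ₂h₄ ⊕ wind[h₂,-h₄])) *ₗ F h₄ )
  × ( F̃ h₁ ≈ᴹ (α̃₁ * [-1]^ (int l h₁ ⊕ wind[-h₁,h₂])) *ₗ F̃ h₂ )
  × ( F̃ h₃ ≈ᴹ
      ([-1]^ (int l h₃ ⊕ int l h₄ ⊕ γ₂h₄ ⊕ wind[h₃,h₄] ⊕ 1ℤ) * α₂ * α₁ ⁻¹) *ₗ F̃ h₄ )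
lemma6p1 K V k n _ _ N isN l G S b _ F F̃ before after outside =
    F̃₄-formula before after outside
  , F̃₂-formula before after outside
  , F̃₁-formula before after outside
  , F̃₃-formula before after outside
  where open SquareMoveFormulas K V N isN l G S
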